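{- Let $G$ be a simple graph. Then $$\hat{\pi}_3(G)=\begin{cases}1-\frac{1}{\chi(G)-1} & \text{if } \chi(G)\ge 4,\\ 0 & \text{if } G \text{ satisfies conditions (1) and (2) below},\\ \frac12 & \text{otherwise,}\end{cases}$$ where (1): $G$ is triangle-free and there is a vertex $v$ with $G-v$ bipartite; (2): there exists a bipartite subgraph $B\subseteq G$ with bipartition $(U_1,U_2)$ of $V(G)$ such that $E(G)\setminus E(B)$ is a (possibly empty) matching all of whose edges lie inside one and the same part $U_i$.
   Context: A 3-graph is a hypergraph all of whose edges have exactly 3 vertices. The shadow $\partial(\mathcal{H})$ of a hypergraph $\mathcal{H}$ is the simple graph on $V(\mathcal{H})$ in which $uv$ is an edge iff $\{u,v\}\subseteq h$ for some edge $h$ of $\mathcal{H}$. For a simple graph $G$, a hypergraph $\mathcal{H}$ is a Berge-$G$ if there is an injection $i:V(G)\to V(\mathcal{H})$ and a bijection $f:E(G)\to E(\mathcal{H})$ with $\{i(u),i(v)\}\subseteq f(uv)$ for every $uv\in E(G)$; $\mathcal{H}$ is Berge-$G$-free if no subhypergraph of it is a Berge-$G$. $\hat{\mathrm{ex}}_3(n,G)$ is the maximum number of edges of $\partial(\mathcal{H})$ over all Berge-$G$-free 3-graphs $\mathcal{H}$ on $n$ vertices, and $\hat{\pi}_3(G)=\limsup_{n\to\infty}\hat{\mathrm{ex}}_3(n,G)/\binom{n}{2}$. $\chi(G)$ is the chromatic number. -}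

module Defs where

open import Data.Nat using (ℕ; zero; suc; _+_; _≤_; _<ᵇ_)
open import Data.Nat.Combinatorics using (_C_)
open import Data.Bool using (Bool; true; false; _∧_; _∨_; if_then_else_)
open import Data.Fin using (Fin; toℕ)
import Data.Fin as Fin
open import Data.Fin.Subset using (Subset; ∣_∣)
open import Data.Vec using (lookup)
open import Data.Product using (Σ; ∃; _×_; _,_)
open import Data.Integer using (+_)
open import Data.Rational using (ℚ; _/_; 0ℚ; _<_; _-_; _*_) renaming (_≤_ to _≤ℚ_; _+_ to _+ℚ_)
open import Data.Empty using (⊥)
open import Data.Sum using (_⊎_)
open import Relation.Binary.PropositionalEquality using (_≡_; _≢_)
open import Relation.Nullary using (¬_)
open import Function.Definitions using (Injective)

record SimpleGraph (k : ℕ) : Set where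
  field
    adj     : Fin k → Fin k → Bool
    symm    : ∀ u v → adj u v ≡ adj v u
    irrefl  : ∀ u → adj u u ≡ false

open SimpleGraph public

Edge : ∀ {k} → SimpleGraph k → Fin k → Fin k → Set
Edge G u v = adj G u v ≡ true

HasEdge : ∀ {k} → SimpleGraph k → Set
HasEdge G = Σ _ λ u → Σ _ λ v → Edge G u v

Colorable : ∀ {k} → SimpleGraph k → ℕ → Set
Colorable {k} G c = Σ (Fin k → Fin c) λ col → ∀ u v → Edge G u v → col u ≢ col v

IsChromaticNumber : ∀ {k} → SimpleGraph k → ℕ → Set
IsChromaticNumber G c = Colorable G c × (∀ d → suc d ≤ c → ¬ Colorable G d)

TriangleFree : ∀ {k} → SimpleGraph k → Set
TriangleFree G = ∀ u v w → Edge G u v → Edge G v w → Edge G u w → ⊥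

Cond1 : ∀ {k} → SimpleGraph k → Set
Cond1 {k} G = TriangleFree G ×
  Σ (Fin k) λ x → Σ (Fin k → Bool) λ side →
    ∀ u v → u ≢ x → v ≢ x → Edge G u v → side u ≢ side v

-- condition (2): a bipartite subgraph B ⊆ G with bipartition (U₁,U₂) of V(G)
-- (side u ≡ false means u ∈ U₁, side u ≡ true means u ∈ U₂), such that
-- E(G) ∖ E(B) is a matching all of whose edges lie inside U_i for one i.
Cond2 : ∀ {k} → SimpleGraph k → Set
Cond2 {k} G =
  Σ (Fin k → Bool) λ side →
  Σ (Fin k → Fin k → Bool) λ inB →
    (∀ u v → inB u v ≡ inB v u) ×
    (∀ u v → inB u v ≡ true → Edge G u v) ×
    (∀ u v → inB u v ≡ true → side u ≢ side v) ×
    Σ Bool λ i →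
      (∀ u v → Edge G u v → inB u v ≡ false → side u ≡ i × side v ≡ i) ×
      (∀ u v w → Edge G u v → inB u v ≡ false →
                 Edge G u w → inB u w ≡ false → v ≡ w)

record ThreeGraph (n : ℕ) : Set where
  field
    m        : ℕ
    edge     : Fin m → Subset n
    distinct : Injective _≡_ _≡_ edge
    uniform  : ∀ j → ∣ edge j ∣ ≡ 3

open ThreeGraph public

-- H contains a Berge-G: injection i : V(G) → V(H) and an injection f from
-- E(G) into E(H) (i.e. a bijection onto a subhypergraph) with i(u),i(v) ∈ f(uv).
-- f is given on ordered pairs, required to be symmetric, and injective on
-- unordered edges.
ContainsBerge : ∀ {k n} → SimpleGraph k → ThreeGraph n → Set
ContainsBerge {k} {n} G H =
  Σ (Fin k → Fin n) λ i → Injective _≡_ _≡_ i ×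
  Σ (∀ u v → Edge G u v → Fin (m H)) λ f →
    (∀ u v (e : Edge G u v) (e' : Edge G v u) → f u v e ≡ f v u e') ×
    (∀ u v u' v' (e : Edge G u v) (e' : Edge G u' v') → f u v e ≡ f u' v' e' →
        (u ≡ u' × v ≡ v') ⊎ (u ≡ v' × v ≡ u')) ×
    (∀ u v (e : Edge G u v) →
        lookup (edge H (f u v e)) (i u) ≡ true ×
        lookup (edge H (f u v e)) (i v) ≡ true)

BergeFree : ∀ {k n} → SimpleGraph k → ThreeGraph n → Set
BergeFree G H = ¬ ContainsBerge G H

anyFin : (m : ℕ) → (Fin m → Bool) → Bool
anyFin zero    p = false
anyFin (suc m) p = p Fin.zero ∨ anyFin m (λ j → p (Fin.suc j))

sumFin : (n : ℕ) → (Fin n → ℕ) → ℕ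
sumFin zero    f = 0
sumFin (suc n) f = f Fin.zero + sumFin n (λ j → f (Fin.suc j))

shadowAdj : ∀ {n} → ThreeGraph n → Fin n → Fin n → Bool
shadowAdj H x y = anyFin (m H) (λ j → lookup (edge H j) x ∧ lookup (edge H j) y)

shadowSize : ∀ {n} → ThreeGraph n → ℕ
shadowSize {n} H =
  sumFin n λ x → sumFin n λ y →
    if (toℕ x <ᵇ toℕ y) ∧ shadowAdj H x y then 1 else 0

-- π̂₃(G) = q, with π̂₃(G) = limsup_{n→∞} êx₃(n,G) / (n choose 2), where
-- êx₃(n,G) = max { |E(∂H)| : H Berge-G-free 3-graph on n vertices }.
-- Unfolded: (upper) for every ε > 0, for all large n, every Berge-G-free H on
-- n vertices has |∂H| ≤ (q+ε)·C(n,2); (lower) for every ε > 0 and every N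
-- there are n ≥ N and a Berge-G-free H on n vertices with |∂H| ≥ (q-ε)·C(n,2).

ℕtoℚ : ℕ → ℚ
ℕtoℚ a = + a / 1

ShadowDensity : ∀ {k} → SimpleGraph k → ℚ → Set
ShadowDensity G q =
  (∀ ε → 0ℚ < ε → Σ ℕ λ N → ∀ n → N ≤ n → (H : ThreeGraph n) → BergeFree G H →
      ℕtoℚ (shadowSize H) ≤ℚ (q +ℚ ε) * ℕtoℚ (n C 2))
  ×
  (∀ ε → 0ℚ < ε → ∀ N → Σ ℕ λ n → N ≤ n × Σ (ThreeGraph n) λ H → BergeFree G H ×
      (q - ε) * ℕtoℚ (n C 2) ≤ℚ ℕtoℚ (shadowSize H))

{-# OPTIONS --safe #-}
module Submission where

-- The upper bound 1 - 1/(χ - 1) is Erdős–Stone for the shadow: in a large blow-up of K_χ, a random choice of one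
-- vertex per vertex of G avoids, for every edge uv, the third vertex of a hyperedge chosen through uv, so the
-- hyperedges assigned to different edges of G differ. The lower bounds come from three constructions: the complete
-- (χ - 1)-partite 3-graph; all triples {x₀, a, b} (a copy of G there gives a vertex v with G - v bipartite); and all
-- triples {a, a′, b} with aa′ in a perfect matching of one part (a copy of G there gives condition (2), and it has
-- no Berge triangle).
--
-- For the value 0, suppose the shadow is dense. After a random tripartition there is a dense bipartite graph F whose
-- edges xy have hyperedges {x, y, w(x, y)} with w(x, y) in the third class. Discard the edges of F that close to few
-- 4-cycles. If some w is the third vertex of a large matching xᵢyᵢ of the remaining graph, then for many i the 4-cycles
-- through xᵢyᵢ share a dense set of pairs, hence a biclique joined to all these xᵢ and yᵢ; with v sent to w and the
-- neighbours of v to xᵢ's and yⱼ's this accommodates every triangle-free G with G - v bipartite. Otherwise the edges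
-- with w(x, y) = w are covered by boundedly many vertices, for every w; then many pairs (x, w) have linear codegree and
-- one finds xᵢ, wᵢ and yⱼ with all {xᵢ, wᵢ, yⱼ} hyperedges, which contains every triangle-free G with condition (2).

-- The obstacle is that different edges of `G` must receive different hyperedges, while one
-- hyperedge lies over three pairs of the shadow. In the dense range randomness settles this. For
-- the value 0 the tripartition does: the colours in a hyperedge {x, y, w(x, y)} tell for which pair
-- xy it was chosen, so it is enough to send the edges of `G` to different pairs of F. The two
-- conditions mirror the two structures that a dense shadow may offer: a fan hosts `G` by (1), stars
-- host `G` by (2) together with triangle-freeness, and a 3-graph may contain only one of the two.
-- Triangle-freeness enters both embeddings, where an edge of `G` would need a pair that is missing
-- (fan) or already taken (stars).
--
-- The upper bound 1/2 is the three-colour case of the Erdős-Stone argument. For the lower bound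
-- 1/2, the matched construction excludes triangles as well as violations of (2), so the triples
-- through one vertex are left with the bipartiteness of `G - v` alone.
--
-- Densities are cross-multiplied into inequalities over ℕ, shadow edges are counted as ordered
-- pairs, and an expectation is a sum over all functions.

open import Defs
open import Axiom.UniquenessOfIdentityProofs.WithK using (uip)
open import Data.Bool using (Bool; true; false; _∧_; _∨_; _xor_; not; if_then_else_)
import Data.Bool.Properties as Boolₚ
open import Data.Empty using (⊥; ⊥-elim)
open import Data.Fin using (Fin; zero; suc; toℕ; punchIn; combine; remQuot; quotient; remainder; splitAt; _↑ˡ_; _↑ʳ_)
import Data.Fin as Fin
import Data.Fin.Properties as Finₚ
open import Data.Fin.Subset using (Subset; ∣_∣)
open import Data.Fin.Subset.Properties using (anySubset?)
open import Data.Nat hiding (_/_)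
open import Data.Nat.Properties
open import Data.Nat.Tactic.RingSolver using (solve-∀)
open import Data.Product using (Σ; _×_; _,_; proj₁; proj₂)
open import Data.Sum using (_⊎_; inj₁; inj₂; [_,_]′)
open import Data.Vec using (lookup; tabulate; []; _∷_)
import Data.Vec.Properties as Vecₚ
open import Function using (_∘_; id)
open import Function.Definitions using (Injective)
open import Relation.Binary using (tri<; tri≈; tri>)
open import Relation.Binary.PropositionalEquality
open import Relation.Nullary using (¬_; Dec; yes; no; does)
open import Relation.Nullary.Decidable using (_×-dec_; _→-dec_; ¬?)

-- Finite sums

Inj : ∀ {a} {A : Set a} {n} → (Fin n → A) → Set a
Inj f = Injective _≡_ _≡_ f

fin-positive : ∀ {k} → Fin k → 1 ≤ k
fin-positive zero    = s≤s z≤n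
fin-positive (suc _) = s≤s z≤n

first : ∀ {k} → 1 ≤ k → Fin k
first (s≤s _) = zero

sum-cong : ∀ n {f g : Fin n → ℕ} → (∀ i → f i ≡ g i) → sumFin n f ≡ sumFin n g
sum-cong zero    e = refl
sum-cong (suc n) e = cong₂ _+_ (e zero) (sum-cong n (e ∘ suc))

sum-mono : ∀ n {f g : Fin n → ℕ} → (∀ i → f i ≤ g i) → sumFin n f ≤ sumFin n g
sum-mono zero    e = z≤n
sum-mono (suc n) e = +-mono-≤ (e zero) (sum-mono n (e ∘ suc))

+-interchange : ∀ a b c d → (a + b) + (c + d) ≡ (a + c) + (b + d)
+-interchange = solve-∀

sum-+ : ∀ n (f g : Fin n → ℕ) → sumFin n (λ i → f i + g i) ≡ sumFin n f + sumFin n g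
sum-+ zero    f g = refl
sum-+ (suc n) f g = trans (cong (f zero + g zero +_) (sum-+ n (f ∘ suc) (g ∘ suc)))
  (+-interchange (f zero) (g zero) _ _)

sum-*ˡ : ∀ n c (f : Fin n → ℕ) → sumFin n (λ i → c * f i) ≡ c * sumFin n f
sum-*ˡ zero    c f = sym (*-zeroʳ c)
sum-*ˡ (suc n) c f = trans (cong (c * f zero +_) (sum-*ˡ n c (f ∘ suc)))
  (sym (*-distribˡ-+ c (f zero) _))

sum-*ʳ : ∀ n c (f : Fin n → ℕ) → sumFin n (λ i → f i * c) ≡ sumFin n f * c
sum-*ʳ n c f = trans (sum-cong n λ i → *-comm (f i) c) (trans (sum-*ˡ n c f) (*-comm c _))

sum-const : ∀ n c → sumFin n (λ _ → c) ≡ n * c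
sum-const zero    c = refl
sum-const (suc n) c = cong (c +_) (sum-const n c)

sum-≤-const : ∀ n {f : Fin n → ℕ} c → (∀ i → f i ≤ c) → sumFin n f ≤ n * c
sum-≤-const n c h = ≤-trans (sum-mono n h) (≤-reflexive (sum-const n c))

sum-≥-const : ∀ n {f : Fin n → ℕ} c → (∀ i → c ≤ f i) → n * c ≤ sumFin n f
sum-≥-const n c h = ≤-trans (≤-reflexive (sym (sum-const n c))) (sum-mono n h)

sum-swap : ∀ m n (f : Fin m → Fin n → ℕ) →
  sumFin m (λ i → sumFin n (λ j → f i j)) ≡ sumFin n (λ j → sumFin m (λ i → f i j))
sum-swap zero    n f = sym (trans (sum-const n 0) (*-zeroʳ n))
sum-swap (suc m) n f = trans (cong (sumFin n (f zero) +_) (sum-swap m n (f ∘ suc)))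
  (sym (sum-+ n (f zero) _))

term≤sum : ∀ n (f : Fin n → ℕ) i → f i ≤ sumFin n f
term≤sum (suc n) f zero    = m≤m+n _ _
term≤sum (suc n) f (suc i) = ≤-trans (term≤sum n (f ∘ suc) i) (m≤n+m _ _)

sum-remove : ∀ n (f : Fin (suc n) → ℕ) i → sumFin (suc n) f ≡ f i + sumFin n (f ∘ punchIn i)
sum-remove n       f zero    = refl
sum-remove (suc n) f (suc i) = trans (cong (f zero +_) (sum-remove n (f ∘ suc) i))
  (lemma (f zero) (f (suc i)) _)
  where
  lemma : ∀ a b c → a + (b + c) ≡ b + (a + c)
  lemma = solve-∀

sum-splitAt : ∀ m n (f : Fin (m + n) → ℕ) →
  sumFin (m + n) f ≡ sumFin m (λ i → f (i ↑ˡ n)) + sumFin n (λ j → f (m ↑ʳ j))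
sum-splitAt zero    n f = refl
sum-splitAt (suc m) n f = trans (cong (f zero +_) (sum-splitAt m n (f ∘ suc)))
  (sym (+-assoc (f zero) _ _))

sum-combine : ∀ m n (f : Fin (m * n) → ℕ) →
  sumFin (m * n) f ≡ sumFin m (λ i → sumFin n (λ j → f (combine i j)))
sum-combine zero    n f = refl
sum-combine (suc m) n f = trans (sum-splitAt n (m * n) f)
  (cong (sumFin n (λ j → f (j ↑ˡ (m * n))) +_) (sum-combine m n (λ k → f (n ↑ʳ k))))

sum≤max : ∀ n (f : Fin (suc n) → ℕ) → Σ (Fin (suc n)) λ i → sumFin (suc n) f ≤ suc n * f i
sum≤max zero    f = zero , ≤-refl
sum≤max (suc n) f with sum≤max n (f ∘ suc)
... | i , h with f zero ≤? f (suc i)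
...   | yes p = suc i , +-mono-≤ p h
...   | no  p = zero , +-monoʳ-≤ (f zero) (≤-trans h (*-monoʳ-≤ (suc n) (<⇒≤ (≰⇒> p))))

min≤sum : ∀ n (f : Fin (suc n) → ℕ) → Σ (Fin (suc n)) λ i → suc n * f i ≤ sumFin (suc n) f
min≤sum zero    f = zero , ≤-refl
min≤sum (suc n) f with min≤sum n (f ∘ suc)
... | i , h with f (suc i) ≤? f zero
...   | yes p = suc i , +-mono-≤ p h
...   | no  p = zero , +-monoʳ-≤ (f zero) (≤-trans (*-monoʳ-≤ (suc n) (<⇒≤ (≰⇒> p))) h)

∑∑ : ∀ m n → (Fin m → Fin n → ℕ) → ℕ
∑∑ m n f = sumFin m λ i → sumFin n λ j → f i j

∑∑-cong : ∀ m n {f g : Fin m → Fin n → ℕ} → (∀ i j → f i j ≡ g i j) → ∑∑ m n f ≡ ∑∑ m n g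
∑∑-cong m n h = sum-cong m λ i → sum-cong n (h i)

∑∑-mono : ∀ m n {f g : Fin m → Fin n → ℕ} → (∀ i j → f i j ≤ g i j) → ∑∑ m n f ≤ ∑∑ m n g
∑∑-mono m n h = sum-mono m λ i → sum-mono n (h i)

∑∑-+ : ∀ m n (f g : Fin m → Fin n → ℕ) → ∑∑ m n (λ i j → f i j + g i j) ≡ ∑∑ m n f + ∑∑ m n g
∑∑-+ m n f g = trans (sum-cong m λ i → sum-+ n (f i) (g i)) (sum-+ m _ _)

∑∑-*ˡ : ∀ m n c (f : Fin m → Fin n → ℕ) → ∑∑ m n (λ i j → c * f i j) ≡ c * ∑∑ m n f
∑∑-*ˡ m n c f = trans (sum-cong m λ i → sum-*ˡ n c (f i)) (sum-*ˡ m c _)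

-- Indicators and counting

𝟙 : Bool → ℕ
𝟙 b = if b then 1 else 0

𝟙≤1 : ∀ b → 𝟙 b ≤ 1
𝟙≤1 true  = ≤-refl
𝟙≤1 false = z≤n

𝟙-∧ : ∀ a b → 𝟙 (a ∧ b) ≡ 𝟙 a * 𝟙 b
𝟙-∧ true  b = sym (+-identityʳ _)
𝟙-∧ false b = refl

𝟙-not : ∀ a → 𝟙 a + 𝟙 (not a) ≡ 1
𝟙-not true  = refl
𝟙-not false = refl

𝟙-⇒ : ∀ {a b} → (a ≡ true → b ≡ true) → 𝟙 a ≤ 𝟙 b
𝟙-⇒ {true}  h rewrite h refl = ≤-refl
𝟙-⇒ {false} h = z≤n

𝟙-≥ : ∀ b {c} → (b ≡ true → 1 ≤ c) → 𝟙 b ≤ c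
𝟙-≥ true  h = h refl
𝟙-≥ false h = z≤n

∧-true : ∀ {a b} → a ∧ b ≡ true → a ≡ true × b ≡ true
∧-true {true} {true} _ = refl , refl

true-∧ : ∀ {a b} → a ≡ true → b ≡ true → a ∧ b ≡ true
true-∧ refl refl = refl

∨-true : ∀ {a b} → a ∨ b ≡ true → a ≡ true ⊎ b ≡ true
∨-true {true}  _ = inj₁ refl
∨-true {false} h = inj₂ h

not-true : ∀ {a} → not a ≡ true → a ≡ false
not-true {false} _ = refl

false-not : ∀ {a} → a ≡ false → not a ≡ true
false-not refl = refl

true≢false : ∀ {b} → b ≡ true → b ≡ false → ⊥
true≢false refl ()

¬true⇒false : ∀ {b} → ¬ (b ≡ true) → b ≡ false
¬true⇒false {true}  h = ⊥-elim (h refl)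
¬true⇒false {false} h = refl

bool-ext : ∀ {a b} → (a ≡ true → b ≡ true) → (b ≡ true → a ≡ true) → a ≡ b
bool-ext {true}          f g = sym (f refl)
bool-ext {false} {true}  f g = g refl
bool-ext {false} {false} f g = refl

¬false⇒true : ∀ {b} → ¬ (b ≡ false) → b ≡ true
¬false⇒true {true}  h = refl
¬false⇒true {false} h = ⊥-elim (h refl)

does-true : ∀ {p} {P : Set p} (d : Dec P) → does d ≡ true → P
does-true (yes p) _ = p

true-does : ∀ {p} {P : Set p} (d : Dec P) → P → does d ≡ true
true-does (yes _) _ = refl
true-does (no ¬p) p = ⊥-elim (¬p p)

does-false : ∀ {p} {P : Set p} (d : Dec P) → does d ≡ false → ¬ P
does-false (no ¬p) _ = ¬p

false-does : ∀ {p} {P : Set p} (d : Dec P) → ¬ P → does d ≡ false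
false-does (yes p) ¬p = ⊥-elim (¬p p)
false-does (no _)  _  = refl

_≟ᵇ_ : ∀ {n} → Fin n → Fin n → Bool
i ≟ᵇ j = does (i Finₚ.≟ j)

≟ᵇ⇒≡ : ∀ {n} (i j : Fin n) → (i ≟ᵇ j) ≡ true → i ≡ j
≟ᵇ⇒≡ i j = does-true (i Finₚ.≟ j)

≡⇒≟ᵇ : ∀ {n} (i j : Fin n) → i ≡ j → (i ≟ᵇ j) ≡ true
≡⇒≟ᵇ i j = true-does (i Finₚ.≟ j)

≢⇒≟ᵇ : ∀ {n} (i j : Fin n) → i ≢ j → (i ≟ᵇ j) ≡ false
≢⇒≟ᵇ i j = false-does (i Finₚ.≟ j)

≟ᵇ-refl : ∀ {n} (i : Fin n) → (i ≟ᵇ i) ≡ true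
≟ᵇ-refl i = ≡⇒≟ᵇ i i refl

≤ᵇ-true : ∀ {m n} → (m ≤ᵇ n) ≡ true → m ≤ n
≤ᵇ-true {m} {n} e = ≤ᵇ⇒≤ m n (subst Data.Bool.T (sym e) _)

≤ᵇ-false : ∀ {m n} → (m ≤ᵇ n) ≡ false → n < m
≤ᵇ-false {m} {n} e = ≰⇒> λ le → subst Data.Bool.T e (≤⇒≤ᵇ le)

-- The pointwise form of an averaging argument: summed over all points, a large total forces many
-- points to reach the threshold `t`, since the others contribute at most `t` each.
≤-threshold : ∀ t d u → d ≤ u → d ≤ 𝟙 (t ≤ᵇ d) * u + t
≤-threshold t d u d≤u with t ≤ᵇ d in eq
... | true  = ≤-trans d≤u (≤-trans (≤-reflexive (sym (+-identityʳ u))) (m≤m+n _ t))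
... | false = <⇒≤ (≤ᵇ-false eq)

𝟙-threshold : ∀ t d → t * 𝟙 (t ≤ᵇ d) ≤ d
𝟙-threshold t d with t ≤ᵇ d in eq
... | true  = ≤-trans (≤-reflexive (*-identityʳ t)) (≤ᵇ-true eq)
... | false = ≤-trans (≤-reflexive (*-zeroʳ t)) z≤n

count : ∀ n → (Fin n → Bool) → ℕ
count n p = sumFin n (𝟙 ∘ p)

sum-zero : ∀ n {f : Fin n → ℕ} → (∀ i → f i ≡ 0) → sumFin n f ≡ 0
sum-zero n h = trans (sum-cong n h) (trans (sum-const n 0) (*-zeroʳ n))

sum-single : ∀ n (f : Fin n → ℕ) i → (∀ j → j ≢ i → f j ≡ 0) → sumFin n f ≡ f i
sum-single (suc n) f i h = trans (sum-remove n f i) (trans (cong (f i +_) (sum-zero n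
  λ j → h (punchIn i j) (Finₚ.punchInᵢ≢i i j))) (+-identityʳ _))

sum-≟ : ∀ n i → sumFin n (λ j → 𝟙 (j ≟ᵇ i)) ≡ 1
sum-≟ n i = trans (sum-single n _ i λ j j≢i → cong 𝟙 (≢⇒≟ᵇ j i j≢i)) (cong 𝟙 (≟ᵇ-refl i))

sum-≟′ : ∀ n i → sumFin n (λ j → 𝟙 (i ≟ᵇ j)) ≡ 1
sum-≟′ n i = trans (sum-single n _ i λ j j≢i → cong 𝟙 (≢⇒≟ᵇ i j (j≢i ∘ sym))) (cong 𝟙 (≟ᵇ-refl i))

count≤ : ∀ n p → count n p ≤ n
count≤ n p = ≤-trans (sum-≤-const n 1 λ i → 𝟙≤1 (p i)) (≤-reflexive (*-identityʳ n))

count-⇒ : ∀ n {p q : Fin n → Bool} → (∀ i → p i ≡ true → q i ≡ true) → count n p ≤ count n q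
count-⇒ n h = sum-mono n λ i → 𝟙-⇒ (h i)

count-not : ∀ n p → count n p + count n (not ∘ p) ≡ n
count-not n p = trans (sym (sum-+ n _ _)) (trans (sum-cong n λ i → 𝟙-not (p i))
  (trans (sum-const n 1) (*-identityʳ n)))

count>0 : ∀ n p → 1 ≤ count n p → Σ (Fin n) λ i → p i ≡ true
count>0 (suc n) p h with p zero in eq
... | true = zero , eq
... | false with count>0 n (p ∘ suc) h
...   | i , pi = suc i , pi

pick : ∀ n (p : Fin n → Bool) t → t ≤ count n p →
  Σ (Fin t → Fin n) λ φ → Inj φ × (∀ i → p (φ i) ≡ true)
pick n p zero h = (λ ()) , (λ {}) , λ ()
pick (suc n) p (suc t) h with p zero in eq
... | true with pick n (p ∘ suc) t (s≤s⁻¹ h)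
...   | φ , φ-inj , pφ = φ′ , inj′ , p′
  where
  φ′ : Fin (suc t) → Fin (suc n)
  φ′ zero    = zero
  φ′ (suc i) = suc (φ i)
  inj′ : Inj φ′
  inj′ {zero}  {zero}  e = refl
  inj′ {suc i} {suc j} e = cong suc (φ-inj (Finₚ.suc-injective e))
  p′ : ∀ i → p (φ′ i) ≡ true
  p′ zero    = eq
  p′ (suc i) = pφ i
pick (suc n) p (suc t) h | false with pick n (p ∘ suc) (suc t) h
... | φ , φ-inj , pφ = suc ∘ φ , φ-inj ∘ Finₚ.suc-injective , pφ

count-split : ∀ n (p f : Fin n → Bool) →
  count n p ≡ count n (λ x → p x ∧ f x) + count n (λ x → p x ∧ not (f x))
count-split n p f = trans (sum-cong n λ x → lemma (p x) (f x)) (sum-+ n _ _)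
  where
  lemma : ∀ a b → 𝟙 a ≡ 𝟙 (a ∧ b) + 𝟙 (a ∧ not b)
  lemma true  b = sym (𝟙-not b)
  lemma false b = refl

majority : ∀ n (p f : Fin n → Bool) →
  Σ (Fin n → Bool) λ q → (∀ x → q x ≡ true → p x ≡ true) ×
    (∀ x y → q x ≡ true → q y ≡ true → f x ≡ f y) × count n p ≤ 2 * count n q
majority n p f with ≤-total (count n (λ x → p x ∧ f x)) (count n (λ x → p x ∧ not (f x)))
... | inj₁ h = (λ x → p x ∧ not (f x)) , (λ x → proj₁ ∘ ∧-true) ,
  (λ x y qx qy → trans (not-true (proj₂ (∧-true {p x} qx))) (sym (not-true (proj₂ (∧-true {p y} qy))))) ,
  ≤-trans (≤-reflexive (count-split n p f)) (+-mono-≤ h (≤-reflexive (sym (+-identityʳ _))))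
... | inj₂ h = (λ x → p x ∧ f x) , (λ x → proj₁ ∘ ∧-true) ,
  (λ x y qx qy → trans (proj₂ (∧-true {p x} qx)) (sym (proj₂ (∧-true {p y} qy)))) ,
  ≤-trans (≤-reflexive (count-split n p f)) (+-monoʳ-≤ _ (≤-trans h (≤-reflexive (sym (+-identityʳ _)))))

-- Each of the `L` tests keeps its more frequent outcome and so at worst halves the set.
refine : ∀ n L (f : Fin L → Fin n → Bool) (p : Fin n → Bool) →
  Σ (Fin n → Bool) λ q → (∀ x → q x ≡ true → p x ≡ true) ×
    (∀ l x y → q x ≡ true → q y ≡ true → f l x ≡ f l y) × count n p ≤ 2 ^ L * count n q
refine n zero    f p = p , (λ x h → h) , (λ ()) , ≤-reflexive (sym (+-identityʳ _))
refine n (suc L) f p with majority n p (f zero)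
... | q , q⇒p , same , le with refine n L (f ∘ suc) q
...   | q′ , q′⇒q , same′ , le′ = q′ , (λ x → q⇒p x ∘ q′⇒q x) ,
  (λ { zero x y qx qy → same x y (q′⇒q x qx) (q′⇒q y qy) ; (suc l) → same′ l }) ,
  ≤-trans le (≤-trans (*-monoʳ-≤ 2 le′) (≤-reflexive (sym (*-assoc 2 (2 ^ L) _))))

isImage : ∀ {m n} → (Fin m → Fin n) → Fin n → Bool
isImage {m} φ x = anyFin m (λ i → φ i ≟ᵇ x)

anyFin⁺ : ∀ m (p : Fin m → Bool) i → p i ≡ true → anyFin m p ≡ true
anyFin⁺ (suc m) p zero    h rewrite h = refl
anyFin⁺ (suc m) p (suc i) h = trans (cong (p zero ∨_) (anyFin⁺ m (p ∘ suc) i h)) (Boolₚ.∨-zeroʳ _)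

anyFin⁻ : ∀ m (p : Fin m → Bool) → anyFin m p ≡ true → Σ (Fin m) λ i → p i ≡ true
anyFin⁻ (suc m) p h with p zero in eq
... | true  = zero , eq
... | false with anyFin⁻ m (p ∘ suc) h
...   | i , e = suc i , e

𝟙-any≤sum : ∀ m (p : Fin m → Bool) → 𝟙 (anyFin m p) ≤ sumFin m (𝟙 ∘ p)
𝟙-any≤sum m p = 𝟙-≥ (anyFin m p) λ h → let i , e = anyFin⁻ m p h in
  ≤-trans (≤-reflexive (cong 𝟙 (sym e))) (term≤sum m (𝟙 ∘ p) i)

count-image : ∀ m n (φ : Fin m → Fin n) → count n (isImage φ) ≤ m
count-image m n φ = begin
  count n (isImage φ)                          ≤⟨ sum-mono n (λ x → 𝟙-any≤sum m _) ⟩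
  ∑∑ n m (λ x i → 𝟙 (φ i ≟ᵇ x))               ≡⟨ sum-swap n m _ ⟩
  ∑∑ m n (λ i x → 𝟙 (φ i ≟ᵇ x))               ≡⟨ sum-cong m (λ i → sum-≟′ n (φ i)) ⟩
  sumFin m (λ _ → 1)                           ≡⟨ trans (sum-const m 1) (*-identityʳ m) ⟩
  m                                            ∎
  where open ≤-Reasoning

count-injective : ∀ m n (φ : Fin m → Fin n) → Inj φ → ∀ x → count m (λ i → φ i ≟ᵇ x) ≤ 1
count-injective zero n φ φ-inj x = z≤n
count-injective (suc m) n φ φ-inj x with count (suc m) (λ i → φ i ≟ᵇ x) ≤? 0
... | yes h = ≤-trans h z≤n
... | no  h with count>0 (suc m) (λ i → φ i ≟ᵇ x) (≰⇒> h)
...   | i , e = ≤-trans (sum-mono (suc m) λ j → 𝟙-⇒ λ e′ → ≡⇒≟ᵇ j i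
                  (φ-inj (trans (≟ᵇ⇒≡ (φ j) x e′) (sym (≟ᵇ⇒≡ (φ i) x e))))) (≤-reflexive (sum-≟ (suc m) i))

-- An injective `φ` meets each `ψ j` at most once, so at most `u` of the `t + u` indices have to be
-- discarded.
avoid : ∀ t u n (φ : Fin (t + u) → Fin n) (ψ : Fin u → Fin n) → Inj φ →
  Σ (Fin t → Fin (t + u)) λ σ → Inj σ × (∀ i j → φ (σ i) ≢ ψ j)
avoid t u n φ ψ φ-inj = σ , σ-inj , λ i j e →
  true≢false (anyFin⁺ u _ j (≡⇒≟ᵇ _ _ (sym e))) (not-true (σ-good i))
  where
  bad : Fin (t + u) → Bool
  bad l = isImage ψ (φ l)
  bad≤ : count (t + u) bad ≤ u
  bad≤ = begin
    count (t + u) bad                                 ≤⟨ sum-mono (t + u) (λ l → 𝟙-any≤sum u _) ⟩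
    ∑∑ (t + u) u (λ l j → 𝟙 (ψ j ≟ᵇ φ l))            ≡⟨ sum-swap (t + u) u _ ⟩
    ∑∑ u (t + u) (λ j l → 𝟙 (ψ j ≟ᵇ φ l))            ≤⟨ ∑∑-mono u (t + u) (λ j l → 𝟙-⇒ (λ e → ≡⇒≟ᵇ (φ l) (ψ j) (sym (≟ᵇ⇒≡ (ψ j) (φ l) e)))) ⟩
    ∑∑ u (t + u) (λ j l → 𝟙 (φ l ≟ᵇ ψ j))            ≤⟨ sum-≤-const u 1 (λ j → count-injective (t + u) n φ φ-inj (ψ j)) ⟩
    u * 1                                             ≡⟨ *-identityʳ u ⟩
    u                                                 ∎
    where open ≤-Reasoning
  enough : t ≤ count (t + u) (not ∘ bad)
  enough = +-cancelʳ-≤ u t _ (begin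
    t + u                                             ≡⟨ count-not (t + u) bad ⟨
    count (t + u) bad + count (t + u) (not ∘ bad)     ≤⟨ +-monoˡ-≤ _ bad≤ ⟩
    u + count (t + u) (not ∘ bad)                     ≡⟨ +-comm u _ ⟩
    count (t + u) (not ∘ bad) + u                     ∎)
    where open ≤-Reasoning
  picked = pick (t + u) (not ∘ bad) t enough
  σ = proj₁ picked
  σ-inj = λ {i} {j} → proj₁ (proj₂ picked) {i} {j}
  σ-good = proj₂ (proj₂ picked)

-- Averages over all functions Fin k → Fin b

infixr 5 _◂_
_◂_ : ∀ {k} {A : Set} → A → (Fin k → A) → Fin (suc k) → A
(a ◂ c) zero    = a
(a ◂ c) (suc i) = c i

sumFun : ∀ k b → ((Fin k → Fin b) → ℕ) → ℕ
sumFun zero    b f = f λ ()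
sumFun (suc k) b f = sumFin b λ a → sumFun k b λ c → f (a ◂ c)

sumFun-mono : ∀ k b {f g : (Fin k → Fin b) → ℕ} → (∀ c → f c ≤ g c) → sumFun k b f ≤ sumFun k b g
sumFun-mono zero    b h = h _
sumFun-mono (suc k) b h = sum-mono b λ a → sumFun-mono k b λ c → h _

sumFun-const : ∀ k b x → sumFun k b (λ _ → x) ≡ b ^ k * x
sumFun-const zero    b x = sym (+-identityʳ x)
sumFun-const (suc k) b x = trans (sum-cong b λ _ → sumFun-const k b x)
  (trans (sum-const b _) (sym (*-assoc b (b ^ k) x)))

sumFun-sum : ∀ k b n (f : Fin n → (Fin k → Fin b) → ℕ) →
  sumFun k b (λ c → sumFin n λ i → f i c) ≡ sumFin n λ i → sumFun k b (f i)
sumFun-sum zero    b n f = refl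
sumFun-sum (suc k) b n f = trans (sum-cong b λ a → sumFun-sum k b n λ i c → f i (a ◂ c))
  (sum-swap b n _)

sumFun≤max : ∀ k b f → Σ (Fin k → Fin (suc b)) λ c → sumFun k (suc b) f ≤ suc b ^ k * f c
sumFun≤max zero    b f = (λ ()) , ≤-reflexive (sym (+-identityʳ _))
sumFun≤max (suc k) b f with sum≤max b (λ a → sumFun k (suc b) λ c → f (a ◂ c))
... | a , h with sumFun≤max k b (λ c → f (a ◂ c))
...   | c , h′ = a ◂ c , ≤-trans h (≤-trans (*-monoʳ-≤ (suc b) h′)
                  (≤-reflexive (sym (*-assoc (suc b) (suc b ^ k) _))))

min≤sumFun : ∀ k b f → Σ (Fin k → Fin (suc b)) λ c → suc b ^ k * f c ≤ sumFun k (suc b) f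
min≤sumFun zero    b f = (λ ()) , ≤-reflexive (+-identityʳ _)
min≤sumFun (suc k) b f with min≤sum b (λ a → sumFun k (suc b) λ c → f (a ◂ c))
... | a , h with min≤sumFun k b (λ c → f (a ◂ c))
...   | c , h′ = a ◂ c , ≤-trans (≤-trans (≤-reflexive (*-assoc (suc b) (suc b ^ k) _))
                  (*-monoʳ-≤ (suc b) h′)) h

AgreeOff : ∀ {k b} → Fin k → (Fin k → Fin b) → (Fin k → Fin b) → Set
AgreeOff z c c′ = ∀ i → i ≢ z → c i ≡ c′ i

agree-zero : ∀ {k b} (a a′ : Fin b) (c : Fin k → Fin b) → AgreeOff zero (a ◂ c) (a′ ◂ c)
agree-zero a a′ c zero    h = ⊥-elim (h refl)
agree-zero a a′ c (suc i) h = refl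

agree-suc : ∀ {k b} (a : Fin b) {z : Fin k} {c c′} → AgreeOff z c c′ → AgreeOff (suc z) (a ◂ c) (a ◂ c′)
agree-suc a h zero    _ = refl
agree-suc a h (suc i) n = h i λ { refl → n refl }

-- Under a uniformly random `c`, the event `c z ≡ i` has probability 1 / b and is independent of any
-- quantity that ignores the coordinate `z`.
sumFun-indep : ∀ k b (z : Fin k) (i : Fin b) (f : (Fin k → Fin b) → ℕ) →
  (∀ c c′ → AgreeOff z c c′ → f c ≡ f c′) →
  b * sumFun k b (λ c → 𝟙 (c z ≟ᵇ i) * f c) ≡ sumFun k b f
sumFun-indep (suc k) b zero i f indep = begin
  b * sumFin b (λ a → sumFun k b (λ c → 𝟙 (a ≟ᵇ i) * f (a ◂ c)))
    ≡⟨ cong (b *_) (sum-single b _ i (λ a a≢i → trans (cong (λ w → sumFun k b (λ c → 𝟙 w * f (a ◂ c))) (≢⇒≟ᵇ a i a≢i)) (trans (sumFun-const k b 0) (*-zeroʳ (b ^ k))))) ⟩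
  b * sumFun k b (λ c → 𝟙 (i ≟ᵇ i) * f (i ◂ c))
    ≡⟨ cong (λ w → b * sumFun k b (λ c → 𝟙 w * f (i ◂ c))) (≟ᵇ-refl i) ⟩
  b * sumFun k b (λ c → 1 * f (i ◂ c))
    ≡⟨ sum-const b _ ⟨
  sumFin b (λ a → sumFun k b (λ c → 1 * f (i ◂ c)))
    ≡⟨ sum-cong b (λ a → ≤-antisym
         (sumFun-mono k b λ c → ≤-reflexive (trans (+-identityʳ _) (indep _ _ (agree-zero i a c))))
         (sumFun-mono k b λ c → ≤-reflexive (sym (trans (+-identityʳ _) (indep _ _ (agree-zero i a c)))))) ⟩
  sumFin b (λ a → sumFun k b (λ c → f (a ◂ c))) ∎
  where open ≡-Reasoning
sumFun-indep (suc k) b (suc z) i f indep = trans (sym (sum-*ˡ b b _))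
  (sum-cong b λ a → sumFun-indep k b z i (λ c → f (a ◂ c)) λ c c′ h → indep _ _ (agree-suc a h))

-- Once all other coordinates are fixed, at most one value of `c z` satisfies `P`, so `P` has
-- probability at most 1 / b. This feeds the union bound in `BlockSelection`.
sumFun-unique : ∀ k b (z : Fin k) (P : (Fin k → Fin b) → Bool) →
  (∀ c c′ → AgreeOff z c c′ → P c ≡ true → P c′ ≡ true → c z ≡ c′ z) →
  b * sumFun k b (𝟙 ∘ P) ≤ b ^ k
sumFun-unique (suc k) b zero P uniq = *-monoʳ-≤ b (begin
  sumFin b (λ a → sumFun k b (λ c → 𝟙 (P (a ◂ c))))  ≡⟨ sumFun-sum k b b (λ a c → 𝟙 (P (a ◂ c))) ⟨
  sumFun k b (λ c → sumFin b (λ a → 𝟙 (P (a ◂ c))))  ≤⟨ sumFun-mono k b one ⟩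
  sumFun k b (λ c → 1)                                ≡⟨ trans (sumFun-const k b 1) (*-identityʳ _) ⟩
  b ^ k                                               ∎)
  where
  open ≤-Reasoning
  one : ∀ c → sumFin b (λ a → 𝟙 (P (a ◂ c))) ≤ 1
  one c with sumFin b (λ a → 𝟙 (P (a ◂ c))) ≤? 0
  ... | yes h = ≤-trans h z≤n
  ... | no  h with count>0 b (λ a → P (a ◂ c)) (≰⇒> h)
  ...   | a₀ , e = ≤-trans (count-⇒ b λ a e′ → ≡⇒≟ᵇ a a₀ (uniq _ _ (agree-zero a a₀ c) e′ e)) (≤-reflexive (sum-≟ b a₀))
sumFun-unique (suc k) b (suc z) P uniq = ≤-trans (≤-reflexive (sym (sum-*ˡ b b _)))
  (sum-≤-const b (b ^ k) λ a → sumFun-unique k b z (λ c → P (a ◂ c)) λ c c′ h → uniq _ _ (agree-suc a h))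

-- Dense families of sets, bicliques and matchings

1≤⇒nonZero : ∀ {n} → 1 ≤ n → NonZero n
1≤⇒nonZero (s≤s _) = _

*-cancel-≤ : ∀ {a b} c → 1 ≤ c → c * a ≤ c * b → a ≤ b
*-cancel-≤ {a} {b} c 1≤c h = *-cancelˡ-≤ c {{1≤⇒nonZero 1≤c}} h

-- Given 2ct subsets of density 1/c, a positive proportion of the points lie in at least t of them,
-- and many of these points lie in exactly the same ones.
commonPoints : ∀ N c t → 1 ≤ N → 1 ≤ c → 1 ≤ t → (S : Fin (2 * c * t) → Fin N → Bool) →
  (∀ i → N ≤ c * count N (S i)) →
  Σ (Fin t → Fin (2 * c * t)) λ σ → Inj σ × Σ (Fin N → Bool) λ q →
    (∀ i u → q u ≡ true → S (σ i) u ≡ true) ×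
    N ≤ 2 * c * 2 ^ (2 * c * t) * count N q
commonPoints N c t N≥1 c≥1 t≥1 S dense = σ , (λ {i} {j} → σ-inj {i} {j}) , q ,
  (λ i u qu → trans (same (σ i) u u₀ qu qu₀) (σ-in i)) , bound
  where
  open ≤-Reasoning
  M = 2 * c * t
  deg : Fin N → ℕ
  deg u = count M (λ i → S i u)
  good : Fin N → Bool
  good u = t ≤ᵇ deg u
  g = count N good
  deg≤ : ∀ u → deg u ≤ 𝟙 (good u) * M + t
  deg≤ u = ≤-threshold t (deg u) M (count≤ M _)
  -- Double counting of incidences: the 2ct sets give at least 2tN of them, and the points lying in
  -- fewer than t sets account for at most tN.
  many : t * N ≤ t * (2 * c * g)
  many = +-cancelʳ-≤ (N * t) _ _ (*-cancel-≤ c c≥1 (begin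
    c * (t * N + N * t)                    ≡⟨ e₁ c t N ⟩
    M * N                                  ≤⟨ sum-≥-const M N dense ⟩
    sumFin M (λ i → c * count N (S i))     ≡⟨ sum-*ˡ M c _ ⟩
    c * ∑∑ M N (λ i u → 𝟙 (S i u))         ≡⟨ cong (c *_) (sum-swap M N _) ⟩
    c * sumFin N deg                       ≤⟨ *-monoʳ-≤ c (sum-mono N deg≤) ⟩
    c * sumFin N (λ u → 𝟙 (good u) * M + t) ≡⟨ cong (c *_) (sum-+ N _ _) ⟩
    c * (sumFin N (λ u → 𝟙 (good u) * M) + sumFin N (λ _ → t))
      ≡⟨ cong (c *_) (cong₂ _+_ (sum-*ʳ N M _) (sum-const N t)) ⟩
    c * (g * M + N * t)                    ≡⟨ cong (λ z → c * (z + N * t)) (e₂ g c t) ⟩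
    c * (t * (2 * c * g) + N * t)          ∎))
    where
    e₁ : ∀ c t N → c * (t * N + N * t) ≡ 2 * c * t * N
    e₁ = solve-∀
    e₂ : ∀ g c t → g * (2 * c * t) ≡ t * (2 * c * g)
    e₂ = solve-∀
  refined = refine N M S good
  q = proj₁ refined
  same = proj₁ (proj₂ (proj₂ refined))
  bound : N ≤ 2 * c * 2 ^ M * count N q
  bound = begin
    N                              ≤⟨ *-cancel-≤ t t≥1 many ⟩
    2 * c * g                      ≤⟨ *-monoʳ-≤ (2 * c) (proj₂ (proj₂ (proj₂ refined))) ⟩
    2 * c * (2 ^ M * count N q)    ≡⟨ *-assoc (2 * c) (2 ^ M) _ ⟨
    2 * c * 2 ^ M * count N q      ∎
  positive : ∀ k → N ≤ 2 * c * 2 ^ M * k → 1 ≤ k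
  positive zero    h = ⊥-elim (<⇒≱ N≥1 (≤-trans h (≤-reflexive (*-zeroʳ (2 * c * 2 ^ M)))))
  positive (suc k) h = s≤s z≤n
  -- Points of `q` lie in exactly the same sets, so a single point `u₀` shows which `t` sets contain
  -- all of `q`.
  point = count>0 N q (positive _ bound)
  u₀ = proj₁ point
  qu₀ = proj₂ point
  picked = pick M (λ i → S i u₀) t (≤ᵇ-true (proj₁ (proj₂ refined) u₀ qu₀))
  σ = proj₁ picked
  σ-inj = λ {i} {j} → proj₁ (proj₂ picked) {i} {j}
  σ-in = proj₂ (proj₂ picked)

large : ∀ {n g} d k → 1 ≤ d → d * k ≤ n → n ≤ d * g → k ≤ g
large d k d≥1 h h′ = *-cancel-≤ d d≥1 (≤-trans h h′)

1≤2^ : ∀ k → 1 ≤ 2 ^ k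
1≤2^ k = m^n>0 2 k

-- `E` is read as a bipartite graph on two copies of the vertex set, so `xs` and `ys` may overlap;
-- `Matching` follows the same convention.
Biclique : ∀ {n} → (Fin n → Fin n → Bool) → ℕ → Set
Biclique {n} E t = Σ (Fin t → Fin n) λ xs → Σ (Fin t → Fin n) λ ys →
  Inj xs × Inj ys × (∀ i j → E (xs i) (ys j) ≡ true)

-- The dense case of Kővári-Sós-Turán. At least half of the edges lie in rows of degree at least n /
-- (2c), so at least n / (2c) rows have this degree, and `commonPoints` applies to `M` of them.
biclique : ∀ c t → 1 ≤ c → 1 ≤ t → Σ ℕ λ N → ∀ n → N ≤ n → (E : Fin n → Fin n → Bool) →
  n * n ≤ c * ∑∑ n n (λ x y → 𝟙 (E x y)) → Biclique E t
biclique c t c≥1 t≥1 = N₀ , proof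
  where
  2c≥1 : 1 ≤ 2 * c
  2c≥1 = *-mono-≤ {1} {2} (s≤s z≤n) c≥1
  M = 2 * (2 * c) * t
  K = 2 * (2 * c) * 2 ^ M
  N₀ = 1 + (2 * c * M + K * t)
  proof : ∀ n → N₀ ≤ n → (E : Fin n → Fin n → Bool) →
    n * n ≤ c * ∑∑ n n (λ x y → 𝟙 (E x y)) → Biclique E t
  proof n N₀≤n E dense = xs ∘ σ , ys , (λ e → σ-inj (xs-inj e)) , ys-inj , λ i j → common i (ys j) (ys-good j)
    where
    open ≤-Reasoning
    n≥1 : 1 ≤ n
    n≥1 = ≤-trans (s≤s z≤n) N₀≤n
    high : Fin n → Bool
    high x = n ≤ᵇ 2 * c * count n (E x)
    d≤ : ∀ x → 2 * c * count n (E x) ≤ 𝟙 (high x) * (2 * c * n) + n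
    d≤ x = ≤-threshold n _ _ (*-monoʳ-≤ (2 * c) (count≤ n _))
    n≤ : n ≤ 2 * c * count n high
    n≤ = *-cancel-≤ n n≥1 (+-cancelʳ-≤ (n * n) _ _ (begin
      n * n + n * n                                    ≤⟨ +-mono-≤ dense dense ⟩
      c * e + c * e                                    ≡⟨ e₁ c e ⟩
      2 * c * e                                        ≡⟨ sum-*ˡ n (2 * c) _ ⟨
      sumFin n (λ x → 2 * c * count n (E x))           ≤⟨ sum-mono n d≤ ⟩
      sumFin n (λ x → 𝟙 (high x) * (2 * c * n) + n)    ≡⟨ sum-+ n _ _ ⟩
      sumFin n (λ x → 𝟙 (high x) * (2 * c * n)) + sumFin n (λ _ → n) ≡⟨ cong₂ _+_ (sum-*ʳ n (2 * c * n) _) (sum-const n n) ⟩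
      count n high * (2 * c * n) + n * n               ≡⟨ cong (_+ n * n) (e₂ (count n high) c n) ⟩
      n * (2 * c * count n high) + n * n               ∎))
      where
      e = ∑∑ n n (λ x y → 𝟙 (E x y))
      e₁ : ∀ c e → c * e + c * e ≡ 2 * c * e
      e₁ = solve-∀
      e₂ : ∀ g c n → g * (2 * c * n) ≡ n * (2 * c * g)
      e₂ = solve-∀
    rows = pick n high M (large (2 * c) M 2c≥1
      (≤-trans (≤-trans (m≤m+n (2 * c * M) (K * t)) (n≤1+n _)) N₀≤n) n≤)
    xs = proj₁ rows
    xs-inj = λ {i} {j} → proj₁ (proj₂ rows) {i} {j}
    cp = commonPoints n (2 * c) t n≥1 2c≥1 t≥1 (λ i → E (xs i)) (λ i → ≤ᵇ-true (proj₂ (proj₂ rows) i))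
    σ = proj₁ cp
    σ-inj = λ {i} {j} → proj₁ (proj₂ cp) {i} {j}
    q = proj₁ (proj₂ (proj₂ cp))
    common = proj₁ (proj₂ (proj₂ (proj₂ cp)))
    cols = pick n q t (large K t (*-mono-≤ {1} {2 * (2 * c)} (*-mono-≤ {1} {2} (s≤s z≤n) 2c≥1) (1≤2^ M))
      (≤-trans (≤-trans (m≤n+m (K * t) (2 * c * M)) (n≤1+n _)) N₀≤n) (proj₂ (proj₂ (proj₂ (proj₂ cp)))))
    ys = proj₁ cols
    ys-inj = λ {i} {j} → proj₁ (proj₂ cols) {i} {j}
    ys-good = proj₂ (proj₂ cols)

Matching : ∀ {n} → (Fin n → Fin n → Bool) → ℕ → Set
Matching {n} L M = Σ (Fin M → Fin n) λ xs → Σ (Fin M → Fin n) λ ys →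
  Inj xs × Inj ys × (∀ i → L (xs i) (ys i) ≡ true)

Cover : ∀ {n} → (Fin n → Fin n → Bool) → ℕ → Set
Cover {n} L M = Σ (Fin n → Bool) λ A → Σ (Fin n → Bool) λ B → count n A ≤ M × count n B ≤ M ×
  (∀ x y → L x y ≡ true → A x ≡ true ⊎ B y ≡ true)

cover-suc : ∀ {n} {L : Fin n → Fin n → Bool} {M} → Cover L M → Cover L (suc M)
cover-suc (A , B , a , b , cov) = A , B , ≤-trans a (n≤1+n _) , ≤-trans b (n≤1+n _) , cov

◂-inj : ∀ {M n} (x : Fin n) (xs : Fin M → Fin n) → Inj xs → isImage xs x ≡ false → Inj (x ◂ xs)
◂-inj x xs inj h {zero}  {zero}  e = refl
◂-inj x xs inj h {zero}  {suc j} e = ⊥-elim (true≢false (anyFin⁺ _ _ j (≡⇒≟ᵇ (xs j) x (sym e))) h)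
◂-inj x xs inj h {suc i} {zero}  e = ⊥-elim (true≢false (anyFin⁺ _ _ i (≡⇒≟ᵇ (xs i) x e)) h)
◂-inj x xs inj h {suc i} {suc j} e = cong suc (inj e)

-- Greedy choice: when a matching cannot be prolonged, its endpoints meet every edge.
matching-or-cover : ∀ {n} (L : Fin n → Fin n → Bool) M → Matching L M ⊎ Cover L M
matching-or-cover L zero = inj₁ ((λ ()) , (λ ()) , (λ {}) , (λ {}) , λ ())
matching-or-cover {n} L (suc M) with matching-or-cover L M
... | inj₂ cov = inj₂ (cover-suc cov)
... | inj₁ (xs , ys , xs-inj , ys-inj , ok)
  with Finₚ.any? (λ x → Finₚ.any? λ y → (L x y Boolₚ.≟ true) ×-dec
         (isImage xs x Boolₚ.≟ false) ×-dec (isImage ys y Boolₚ.≟ false))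
...   | yes (x , y , l , x∉ , y∉) = inj₁ (x ◂ xs , y ◂ ys , ◂-inj x xs xs-inj x∉ , ◂-inj y ys ys-inj y∉ ,
          λ { zero → l ; (suc i) → ok i })
...   | no  maximal = inj₂ (cover-suc (isImage xs , isImage ys , count-image M n xs , count-image M n ys , cov))
  where
  cov : ∀ x y → L x y ≡ true → isImage xs x ≡ true ⊎ isImage ys y ≡ true
  cov x y l with isImage xs x in ex | isImage ys y in ey
  ... | true  | _     = inj₁ refl
  ... | false | true  = inj₂ refl
  ... | false | false = ⊥-elim (maximal (x , y , l , ex , ey))

-- The third vertex depends on `i` only: every pair {xs i, ws i} forms a hyperedge with every
-- `ys j`, the shape of the matched 3-graph in the lower bound.
Stars : ∀ {n} → (Fin n → Fin n → Bool) → (Fin n → Fin n → Fin n) → ℕ → Set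
Stars {n} F w t = Σ (Fin t → Fin n) λ xs → Σ (Fin t → Fin n) λ ws → Σ (Fin t → Fin n) λ ys →
  Inj xs × Inj ws × Inj ys × (∀ i j → F (xs i) (ys j) ≡ true × w (xs i) (ys j) ≡ ws i)

-- `C v` covers, from the x-side, the edges with third vertex `v`. Hence at most `M * n` pairs (x,
-- v) occur, and those occurring for fewer than n / b values of y, with b = 2aM, account for at most
-- half of `F`; so at least n / (2a) pairs are high. A row contains at most `b` high pairs and a
-- column at most `M`, so boundedly many rows and columns cannot cover them all: there is a matching
-- of high pairs, and `commonPoints` supplies common `ys`.
stars : ∀ a M t → 1 ≤ a → 1 ≤ M → 1 ≤ t → Σ ℕ λ N → ∀ n → N ≤ n → (F : Fin n → Fin n → Bool) (w : Fin n → Fin n → Fin n) →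
  (C : Fin n → Fin n → Bool) → (∀ v → count n (C v) ≤ M) →
  (∀ x y → F x y ≡ true → C (w x y) x ≡ true) →
  n * n ≤ a * ∑∑ n n (λ x y → 𝟙 (F x y)) → Stars F w t
stars a M t a≥1 M≥1 t≥1 = N₀ , proof
  where
  b = 2 * a * M
  b≥1 : 1 ≤ b
  b≥1 = *-mono-≤ (*-mono-≤ {1} {2} (s≤s z≤n) a≥1) M≥1
  M₂ = 2 * b * t
  K = 2 * b * 2 ^ M₂
  U = 2 * a * (M₂ * b + M₂ * M)
  N₀ = suc (U + K * t)
  proof : ∀ n → N₀ ≤ n → (F : Fin n → Fin n → Bool) (w : Fin n → Fin n → Fin n) →
    (C : Fin n → Fin n → Bool) → (∀ v → count n (C v) ≤ M) →
    (∀ x y → F x y ≡ true → C (w x y) x ≡ true) →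
    n * n ≤ a * ∑∑ n n (λ x y → 𝟙 (F x y)) → Stars F w t
  proof n N₀≤n F w C C≤ F⇒C dense = split (matching-or-cover high M₂)
    where
    open ≤-Reasoning
    n≥1 : 1 ≤ n
    n≥1 = ≤-trans (s≤s z≤n) N₀≤n
    nbr : Fin n → Fin n → Fin n → Bool
    nbr x v y = F x y ∧ (w x y ≟ᵇ v)
    k : Fin n → Fin n → ℕ
    k x v = count n (nbr x v)
    high : Fin n → Fin n → Bool
    high x v = n ≤ᵇ b * k x v
    h = ∑∑ n n (λ x v → 𝟙 (high x v))
    k>0⇒C : ∀ x v → 1 ≤ k x v → C v x ≡ true
    k>0⇒C x v h with count>0 n (nbr x v) h
    ... | y , e with ∧-true {F x y} e
    ...   | f , e′ rewrite sym (≟ᵇ⇒≡ (w x y) v e′) = F⇒C x y f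
    Σk : ∀ x → sumFin n (k x) ≡ count n (F x)
    Σk x = trans (sum-swap n n _) (sum-cong n λ y → trans (sum-cong n λ v → 𝟙-∧ (F x y) (w x y ≟ᵇ v))
      (trans (sum-*ˡ n (𝟙 (F x y)) _) (trans (cong (𝟙 (F x y) *_) (sum-≟′ n (w x y))) (*-identityʳ _))))
    bk≤ : ∀ x v → b * k x v ≤ 𝟙 (high x v) * (b * n) + 𝟙 (C v x) * n
    bk≤ x v with n ≤ᵇ b * k x v in eh
    ... | true = ≤-trans (*-monoʳ-≤ b (count≤ n _)) (≤-trans (≤-reflexive (sym (+-identityʳ (b * n)))) (m≤m+n _ _))
    ... | false with k x v in eq
    ...   | zero  = ≤-trans (≤-reflexive (*-zeroʳ b)) z≤n
    ...   | suc j rewrite k>0⇒C x v (≤-trans (s≤s z≤n) (≤-reflexive (sym eq))) =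
              ≤-trans (<⇒≤ (≤ᵇ-false eh)) (≤-reflexive (sym (+-identityʳ n)))
    n≤ : n ≤ 2 * a * h
    n≤ = *-cancel-≤ M M≥1 (*-cancel-≤ n n≥1 (+-cancelʳ-≤ (n * M * n) _ _ (begin
      n * (M * n) + n * M * n                   ≡⟨ e₁ n M ⟩
      2 * M * (n * n)                           ≤⟨ *-monoʳ-≤ (2 * M) dense ⟩
      2 * M * (a * _)                           ≡⟨ e₂ M a _ ⟩
      b * ∑∑ n n (λ x y → 𝟙 (F x y))            ≡⟨ cong (b *_) (sum-cong n Σk) ⟨
      b * ∑∑ n n (λ x v → k x v)                ≡⟨ ∑∑-*ˡ n n b _ ⟨
      ∑∑ n n (λ x v → b * k x v)                ≤⟨ ∑∑-mono n n bk≤ ⟩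
      ∑∑ n n (λ x v → 𝟙 (high x v) * (b * n) + 𝟙 (C v x) * n) ≡⟨ ∑∑-+ n n _ _ ⟩
      ∑∑ n n (λ x v → 𝟙 (high x v) * (b * n)) + ∑∑ n n (λ x v → 𝟙 (C v x) * n)
        ≡⟨ cong₂ _+_ (trans (sum-cong n λ x → sum-*ʳ n (b * n) _) (sum-*ʳ n (b * n) _))
                     (trans (sum-swap n n _) (trans (sum-cong n λ v → sum-*ʳ n n _) (sum-*ʳ n n _))) ⟩
      h * (b * n) + sumFin n (λ v → count n (C v)) * n ≤⟨ +-monoʳ-≤ (h * (b * n)) (*-monoˡ-≤ n (sum-≤-const n M C≤)) ⟩
      h * (b * n) + n * M * n                   ≡⟨ cong (_+ n * M * n) (e₃ h a M n) ⟩
      n * (M * (2 * a * h)) + n * M * n         ∎)))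
      where
      e₁ : ∀ n M → n * (M * n) + n * M * n ≡ 2 * M * (n * n)
      e₁ = solve-∀
      e₂ : ∀ M a f → 2 * M * (a * f) ≡ 2 * a * M * f
      e₂ = solve-∀
      e₃ : ∀ h a M n → h * (2 * a * M * n) ≡ n * (M * (2 * a * h))
      e₃ = solve-∀
    row≤ : ∀ x → sumFin n (λ v → 𝟙 (high x v)) ≤ b
    row≤ x = *-cancel-≤ n n≥1 (begin
      n * sumFin n (λ v → 𝟙 (high x v))         ≡⟨ sum-*ˡ n n _ ⟨
      sumFin n (λ v → n * 𝟙 (high x v))         ≤⟨ sum-mono n (λ v → 𝟙-threshold n _) ⟩
      sumFin n (λ v → b * k x v)                ≡⟨ sum-*ˡ n b _ ⟩
      b * sumFin n (k x)                        ≡⟨ cong (b *_) (Σk x) ⟩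
      b * count n (F x)                         ≤⟨ *-monoʳ-≤ b (count≤ n _) ⟩
      b * n                                     ≡⟨ *-comm b n ⟩
      n * b                                     ∎)
    col≤ : ∀ v → sumFin n (λ x → 𝟙 (high x v)) ≤ M
    col≤ v = ≤-trans (count-⇒ n λ x e → k>0⇒C x v (positive (k x v) (≤ᵇ-true {n} {b * k x v} e))) (C≤ v)
      where
      positive : ∀ j → n ≤ b * j → 1 ≤ j
      positive zero    l = ⊥-elim (<⇒≱ n≥1 (≤-trans l (≤-reflexive (*-zeroʳ b))))
      positive (suc j) _ = s≤s z≤n
    split : Matching high M₂ ⊎ Cover high M₂ → Stars F w t
    split (inj₂ (A , B , A≤ , B≤ , cov)) = ⊥-elim (<⇒≱ N₀≤n (begin
      n                              ≤⟨ n≤ ⟩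
      2 * a * h                      ≤⟨ *-monoʳ-≤ (2 * a) h≤ ⟩
      U                              ≤⟨ m≤m+n U (K * t) ⟩
      U + K * t                      ∎))
      where
      pointwise : ∀ x v → 𝟙 (high x v) ≤ 𝟙 (A x) * 𝟙 (high x v) + 𝟙 (B v) * 𝟙 (high x v)
      pointwise x v = 𝟙-≥ (high x v) λ e → lemma e (cov x v e)
        where
        lemma : high x v ≡ true → A x ≡ true ⊎ B v ≡ true → 1 ≤ 𝟙 (A x) * 𝟙 (high x v) + 𝟙 (B v) * 𝟙 (high x v)
        lemma e (inj₁ p) rewrite e | p = s≤s z≤n
        lemma e (inj₂ p) rewrite e | p = m≤n+m 1 _
      h≤ : h ≤ M₂ * b + M₂ * M
      h≤ = begin
        h ≤⟨ ∑∑-mono n n pointwise ⟩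
        ∑∑ n n (λ x v → 𝟙 (A x) * 𝟙 (high x v) + 𝟙 (B v) * 𝟙 (high x v)) ≡⟨ ∑∑-+ n n _ _ ⟩
        ∑∑ n n (λ x v → 𝟙 (A x) * 𝟙 (high x v)) + ∑∑ n n (λ x v → 𝟙 (B v) * 𝟙 (high x v))
          ≡⟨ cong₂ _+_ (sum-cong n λ x → sum-*ˡ n (𝟙 (A x)) _)
               (trans (sum-swap n n _) (sum-cong n λ v → sum-*ˡ n (𝟙 (B v)) _)) ⟩
        sumFin n (λ x → 𝟙 (A x) * sumFin n (λ v → 𝟙 (high x v))) + sumFin n (λ v → 𝟙 (B v) * sumFin n (λ x → 𝟙 (high x v)))
          ≤⟨ +-mono-≤ (sum-mono n λ x → *-monoʳ-≤ (𝟙 (A x)) (row≤ x)) (sum-mono n λ v → *-monoʳ-≤ (𝟙 (B v)) (col≤ v)) ⟩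
        sumFin n (λ x → 𝟙 (A x) * b) + sumFin n (λ v → 𝟙 (B v) * M) ≡⟨ cong₂ _+_ (sum-*ʳ n b _) (sum-*ʳ n M _) ⟩
        count n A * b + count n B * M ≤⟨ +-mono-≤ (*-monoˡ-≤ b A≤) (*-monoˡ-≤ M B≤) ⟩
        M₂ * b + M₂ * M ∎
    split (inj₁ (xs , ws , xs-inj , ws-inj , ok)) =
      xs ∘ σ , ws ∘ σ , ys , (λ e → σ-inj (xs-inj e)) , (λ e → σ-inj (ws-inj e)) , ys-inj ,
      λ i j → let f , e = ∧-true {F (xs (σ i)) (ys j)} (common i (ys j) (ys-good j)) in f , ≟ᵇ⇒≡ _ _ e
      where
      cp = commonPoints n b t n≥1 b≥1 t≥1 (λ i → nbr (xs i) (ws i)) (λ i → ≤ᵇ-true (ok i))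
      σ = proj₁ cp
      σ-inj = λ {i} {j} → proj₁ (proj₂ cp) {i} {j}
      q = proj₁ (proj₂ (proj₂ cp))
      common = proj₁ (proj₂ (proj₂ (proj₂ cp)))
      cols = pick n q t (large K t (*-mono-≤ {1} {2 * b} (*-mono-≤ {1} {2} (s≤s z≤n) b≥1) (1≤2^ M₂))
        (≤-trans (≤-trans (m≤n+m (K * t) U) (n≤1+n _)) N₀≤n) (proj₂ (proj₂ (proj₂ (proj₂ cp)))))
      ys = proj₁ cols
      ys-inj = λ {i} {j} → proj₁ (proj₂ cols) {i} {j}
      ys-good = proj₂ (proj₂ cols)

-- Edges closing to many 4-cycles

cauchy-schwarz : ∀ n (f : Fin n → ℕ) → sumFin n f * sumFin n f ≤ n * sumFin n (λ i → f i * f i)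
cauchy-schwarz n f = *-cancelˡ-≤ 2 (begin
  2 * (sumFin n f * sumFin n f)                        ≡⟨ cong (2 *_) (sum-*ʳ n _ f) ⟨
  2 * sumFin n (λ i → f i * sumFin n f)                ≡⟨ cong (2 *_) (sum-cong n λ i → sum-*ˡ n (f i) f) ⟨
  2 * ∑∑ n n (λ i j → f i * f j)                       ≡⟨ ∑∑-*ˡ n n 2 _ ⟨
  ∑∑ n n (λ i j → 2 * (f i * f j))                     ≤⟨ ∑∑-mono n n (λ i j → am-gm (f i) (f j)) ⟩
  ∑∑ n n (λ i j → f i * f i + f j * f j)               ≡⟨ ∑∑-+ n n _ _ ⟩
  ∑∑ n n (λ i j → f i * f i) + ∑∑ n n (λ i j → f j * f j)
    ≡⟨ cong₂ _+_ (trans (sum-cong n λ i → sum-const n _) (sum-*ˡ n n _)) (sum-const n _) ⟩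
  n * sumFin n (λ i → f i * f i) + n * sumFin n (λ i → f i * f i) ≡⟨ cong (n * sumFin n (λ i → f i * f i) +_) (+-identityʳ _) ⟨
  2 * (n * sumFin n (λ i → f i * f i))                 ∎)
  where
  open ≤-Reasoning
  -- Writing the larger number as a + d turns the AM-GM inequality into an identity with remainder d
  -- * d, free of subtraction.
  ordered : ∀ a d → 2 * (a * (a + d)) ≤ a * a + (a + d) * (a + d)
  ordered a d = ≤-trans (m≤m+n _ (d * d)) (≤-reflexive (e a d))
    where
    e : ∀ a d → 2 * (a * (a + d)) + d * d ≡ a * a + (a + d) * (a + d)
    e = solve-∀
  am-gm : ∀ a b → 2 * (a * b) ≤ a * a + b * b
  am-gm a b with ≤-total a b
  ... | inj₁ h = subst (λ z → 2 * (a * z) ≤ a * a + z * z) (m+[n∸m]≡n h) (ordered a (b ∸ a))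
  ... | inj₂ h = subst (λ z → 2 * (z * b) ≤ z * z + b * b) (m+[n∸m]≡n h)
    (≤-trans (≤-reflexive (cong (2 *_) (*-comm _ b))) (≤-trans (ordered b (a ∸ b)) (≤-reflexive (+-comm (b * b) _))))

edges : ∀ {n} → (Fin n → Fin n → Bool) → ℕ
edges {n} F = ∑∑ n n (λ x y → 𝟙 (F x y))

closes : ∀ {n} → (Fin n → Fin n → Bool) → Fin n → Fin n → Fin n → Fin n → Bool
closes F x y x′ y′ = (F x y′ ∧ F x′ y) ∧ F x′ y′

paths : ∀ {n} → (Fin n → Fin n → Bool) → Fin n → Fin n → ℕ
paths {n} F x y = ∑∑ n n (λ x′ y′ → 𝟙 (closes F x y x′ y′))

-- Cauchy-Schwarz for the degrees, then for the codegrees. The sum on the right counts closed walks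
-- of length 4, including the degenerate ones with x = x′ or y = y′.
4-cycles : ∀ {n} (F : Fin n → Fin n → Bool) →
  edges F * edges F * (edges F * edges F) ≤
  n * n * (n * n) * ∑∑ n n (λ x y → 𝟙 (F x y) * paths F x y)
4-cycles {n} F = begin
  E * E * (E * E)                                  ≤⟨ *-mono-≤ E²≤ E²≤ ⟩
  n * S * (n * S)                                  ≡⟨ e₁ n S ⟩
  n * n * (S * S)                                  ≤⟨ *-monoʳ-≤ (n * n) S²≤ ⟩
  n * n * (n * n * ∑∑ n n (λ x x′ → codeg x x′ * codeg x x′)) ≡⟨ *-assoc (n * n) (n * n) _ ⟨
  n * n * (n * n) * ∑∑ n n (λ x x′ → codeg x x′ * codeg x x′) ≡⟨ cong (n * n * (n * n) *_) rearrange ⟩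
  n * n * (n * n) * ∑∑ n n (λ x y → 𝟙 (F x y) * paths F x y) ∎
  where
  open ≤-Reasoning
  E = edges F
  codeg : Fin n → Fin n → ℕ
  codeg x x′ = sumFin n (λ y → 𝟙 (F x y) * 𝟙 (F x′ y))
  S = ∑∑ n n codeg
  e₁ : ∀ n S → n * S * (n * S) ≡ n * n * (S * S)
  e₁ = solve-∀
  E²≤ : E * E ≤ n * S
  E²≤ = begin
    E * E ≡⟨ cong₂ _*_ (sum-swap n n _) (sum-swap n n _) ⟩
    sumFin n d * sumFin n d ≤⟨ cauchy-schwarz n d ⟩
    n * sumFin n (λ y → d y * d y) ≡⟨ cong (n *_) (sum-cong n λ y → trans (sym (sum-*ʳ n (d y) _)) (sum-cong n λ x → sym (sum-*ˡ n (𝟙 (F x y)) _))) ⟩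
    n * sumFin n (λ y → ∑∑ n n (λ x x′ → 𝟙 (F x y) * 𝟙 (F x′ y))) ≡⟨ cong (n *_) (trans (sum-swap n n _) (sum-cong n λ x → sum-swap n n _)) ⟩
    n * S ∎
    where
    d : Fin n → ℕ
    d y = sumFin n (λ x → 𝟙 (F x y))
  S²≤ : S * S ≤ n * n * ∑∑ n n (λ x x′ → codeg x x′ * codeg x x′)
  S²≤ = begin
    S * S ≤⟨ cauchy-schwarz n _ ⟩
    n * sumFin n (λ x → sumFin n (codeg x) * sumFin n (codeg x)) ≤⟨ *-monoʳ-≤ n (sum-mono n λ x → cauchy-schwarz n (codeg x)) ⟩
    n * sumFin n (λ x → n * sumFin n (λ x′ → codeg x x′ * codeg x x′)) ≡⟨ cong (n *_) (sum-*ˡ n n _) ⟩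
    n * (n * ∑∑ n n (λ x x′ → codeg x x′ * codeg x x′)) ≡⟨ *-assoc n n _ ⟨
    n * n * ∑∑ n n (λ x x′ → codeg x x′ * codeg x x′) ∎
  term : ∀ x x′ y y′ → 𝟙 (F x y) * 𝟙 (F x′ y) * (𝟙 (F x y′) * 𝟙 (F x′ y′)) ≡ 𝟙 (F x y) * 𝟙 (closes F x y x′ y′)
  term x x′ y y′ = trans (e (𝟙 (F x y)) (𝟙 (F x′ y)) (𝟙 (F x y′)) (𝟙 (F x′ y′))) (cong (𝟙 (F x y) *_)
    (sym (trans (𝟙-∧ (F x y′ ∧ F x′ y) _) (cong (_* 𝟙 (F x′ y′)) (𝟙-∧ (F x y′) (F x′ y))))))
    where
    e : ∀ a b c d → a * b * (c * d) ≡ a * (c * b * d)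
    e = solve-∀
  rearrange : ∑∑ n n (λ x x′ → codeg x x′ * codeg x x′) ≡ ∑∑ n n (λ x y → 𝟙 (F x y) * paths F x y)
  rearrange = sum-cong n λ x → trans
    (sum-cong n λ x′ → trans (sym (sum-*ʳ n (codeg x x′) _)) (sum-cong n λ y → trans (sym (sum-*ˡ n (𝟙 (F x y) * 𝟙 (F x′ y)) _)) (sum-cong n λ y′ → term x x′ y y′)))
    (trans (sum-swap n n _) (sum-cong n λ y → ∑∑-*ˡ n n (𝟙 (F x y)) _))

-- Just above 8a³. If E₁ ≥ n² / (2a) edges each closed to fewer than n² / C cycles, `4-cycles`
-- applied to them would give C E₁⁴ ≤ n⁶ E₁, while n⁶ ≤ 8a³ E₁³; so C would be at most 8a³.
closing : ℕ → ℕ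
closing a = suc (8 * (a * a * a))

-- The cycles are counted in all of `F` and not among the retained edges, so a single round of
-- pruning suffices.
Closable : ∀ {n} → ℕ → (Fin n → Fin n → Bool) → Fin n → Fin n → Bool
Closable {n} C F x y = F x y ∧ (n * n ≤ᵇ C * paths F x y)

edges-closable : ∀ {n} a (F : Fin n → Fin n → Bool) → 1 ≤ n →
  n * n ≤ a * edges F → n * n ≤ 2 * a * edges (Closable (closing a) F)
edges-closable {n} a F n≥1 dense = +-cancelʳ-≤ (n * n) _ _ (begin
  n * n + n * n                          ≤⟨ +-mono-≤ dense dense ⟩
  a * edges F + a * edges F              ≡⟨ cong (λ z → a * z + a * z) E≡ ⟩
  a * (E′ + E₁) + a * (E′ + E₁)          ≡⟨ e₁ a E′ E₁ ⟩
  2 * a * E′ + 2 * a * E₁                ≤⟨ +-monoʳ-≤ (2 * a * E′) few ⟩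
  2 * a * E′ + n * n                     ∎)
  where
  open ≤-Reasoning
  C = closing a
  F₁ : Fin n → Fin n → Bool
  F₁ x y = F x y ∧ not (n * n ≤ᵇ C * paths F x y)
  E′ = edges (Closable (closing a) F)
  E₁ = edges F₁
  e₁ : ∀ a x y → a * (x + y) + a * (x + y) ≡ 2 * a * x + 2 * a * y
  e₁ = solve-∀
  E≡ : edges F ≡ E′ + E₁
  E≡ = trans (∑∑-cong n n λ x y → split (F x y) (n * n ≤ᵇ C * paths F x y)) (∑∑-+ n n _ _)
    where
    split : ∀ a b → 𝟙 a ≡ 𝟙 (a ∧ b) + 𝟙 (a ∧ not b)
    split true  b = sym (𝟙-not b)
    split false b = refl
  closes-mono : ∀ x y x′ y′ → closes F₁ x y x′ y′ ≡ true → closes F x y x′ y′ ≡ true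
  closes-mono x y x′ y′ h = let h₁ , h₂ = ∧-true {F₁ x y′ ∧ F₁ x′ y} h
                                h₃ , h₄ = ∧-true {F₁ x y′} h₁ in
    true-∧ (true-∧ (proj₁ (∧-true {F x y′} h₃)) (proj₁ (∧-true {F x′ y} h₄))) (proj₁ (∧-true {F x′ y′} h₂))
  few-paths : ∀ x y → 𝟙 (F₁ x y) * paths F₁ x y * C ≤ 𝟙 (F₁ x y) * (n * n)
  few-paths x y with F₁ x y in eq
  ... | false = z≤n
  ... | true  = begin
    (paths F₁ x y + 0) * C     ≡⟨ cong (_* C) (+-identityʳ (paths F₁ x y)) ⟩
    paths F₁ x y * C           ≤⟨ *-monoˡ-≤ C (∑∑-mono n n λ x′ y′ → 𝟙-⇒ (closes-mono x y x′ y′)) ⟩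
    paths F x y * C            ≡⟨ *-comm _ C ⟩
    C * paths F x y            ≤⟨ <⇒≤ (≤ᵇ-false (not-true (proj₂ (∧-true {F x y} eq)))) ⟩
    n * n                      ≡⟨ +-identityʳ _ ⟨
    n * n + 0                  ∎
  main : E₁ * E₁ * (E₁ * E₁) * C ≤ n * n * (n * n) * (E₁ * (n * n))
  main = begin
    E₁ * E₁ * (E₁ * E₁) * C                         ≤⟨ *-monoˡ-≤ C (4-cycles F₁) ⟩
    n * n * (n * n) * ∑∑ n n (λ x y → 𝟙 (F₁ x y) * paths F₁ x y) * C ≡⟨ *-assoc (n * n * (n * n)) _ C ⟩
    n * n * (n * n) * (∑∑ n n (λ x y → 𝟙 (F₁ x y) * paths F₁ x y) * C)
      ≡⟨ cong (n * n * (n * n) *_) (trans (sum-cong n λ x → sum-*ʳ n C _) (sum-*ʳ n C _)) ⟨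
    n * n * (n * n) * ∑∑ n n (λ x y → 𝟙 (F₁ x y) * paths F₁ x y * C) ≤⟨ *-monoʳ-≤ (n * n * (n * n)) (∑∑-mono n n few-paths) ⟩
    n * n * (n * n) * ∑∑ n n (λ x y → 𝟙 (F₁ x y) * (n * n))
      ≡⟨ cong (n * n * (n * n) *_) (trans (sum-cong n λ x → sum-*ʳ n (n * n) _) (sum-*ʳ n (n * n) _)) ⟩
    n * n * (n * n) * (E₁ * (n * n))                ∎
  impossible : ∀ e s → 1 ≤ s → s ≤ 2 * a * e → e * e * (e * e) * C ≤ s * s * (e * s) → ⊥
  impossible zero s s≥1 h _ = <⇒≱ s≥1 (≤-trans h (≤-reflexive (*-zeroʳ (2 * a))))
  impossible e@(suc _) s s≥1 h h′ = <⇒≱ (n<1+n (8 * (a * a * a))) (*-cancelˡ-≤ (e * e * (e * e)) (begin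
    e * e * (e * e) * C                               ≤⟨ h′ ⟩
    s * s * (e * s)                                   ≤⟨ *-mono-≤ (*-mono-≤ h h) (*-monoʳ-≤ e h) ⟩
    2 * a * e * (2 * a * e) * (e * (2 * a * e))       ≡⟨ e₂ a e ⟩
    e * e * (e * e) * (8 * (a * a * a))               ∎))
    where
    e₂ : ∀ a e → 2 * a * e * (2 * a * e) * (e * (2 * a * e)) ≡ e * e * (e * e) * (8 * (a * a * a))
    e₂ = solve-∀
  few : 2 * a * E₁ ≤ n * n
  few with ≤-total (2 * a * E₁) (n * n)
  ... | inj₁ h = h
  ... | inj₂ h = ⊥-elim (impossible E₁ (n * n) (*-mono-≤ n≥1 n≥1) h main)

-- The matching edges from `xs i` to `ys i` share the third vertex `v`, and every `as j`, `bs k`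
-- closes each of them to a 4-cycle. There are `t + t` of them, so that vertices placed among the
-- `xs` and vertices placed among the `ys` can be kept on different matching edges.
Fan : ∀ {n} → (Fin n → Fin n → Bool) → (Fin n → Fin n → Fin n) → ℕ → Set
Fan {n} F w t = Σ (Fin n) λ v →
  Σ (Fin (t + t) → Fin n) λ xs → Σ (Fin (t + t) → Fin n) λ ys →
  Σ (Fin t → Fin n) λ as → Σ (Fin t → Fin n) λ bs →
  Inj xs × Inj ys × Inj as × Inj bs ×
  (∀ i → F (xs i) (ys i) ≡ true × w (xs i) (ys i) ≡ v) ×
  (∀ i j → F (xs i) (as j) ≡ true) × (∀ j i → F (bs j) (ys i) ≡ true) × (∀ j k → F (bs j) (as k) ≡ true) ×
  (∀ j i → as j ≢ ys i) × (∀ j i → bs j ≢ xs i)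

-- Each matching edge xᵢyᵢ closes to 4-cycles with a positive proportion of all pairs (x′, y′);
-- a pair common to many i is joined to all the corresponding xᵢ and yᵢ.
fan : ∀ C t → 1 ≤ C → 1 ≤ t → Σ ℕ λ M → 1 ≤ M × Σ ℕ λ N → ∀ n → N ≤ n →
  (F : Fin n → Fin n → Bool) (w : Fin n → Fin n → Fin n) (v : Fin n) →
  Matching (λ x y → Closable C F x y ∧ (w x y ≟ᵇ v)) M → Fan F w t
fan C t C≥1 t≥1 = M , M≥1 , suc (proj₁ bic) , proof
  where
  s = t + t
  s≥1 : 1 ≤ s
  s≥1 = ≤-trans t≥1 (m≤m+n t t)
  2C≥1 : 1 ≤ 2 * C
  2C≥1 = *-mono-≤ {1} {2} (s≤s z≤n) C≥1
  M = 2 * C * s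
  M≥1 : 1 ≤ M
  M≥1 = *-mono-≤ {1} {2 * C} 2C≥1 s≥1
  K = 2 * C * 2 ^ M
  -- The additional `s` vertices on each side allow for those that collide with ends of the matching
  -- and are discarded.
  bic = biclique K (t + s) (*-mono-≤ {1} {2 * C} 2C≥1 (1≤2^ M)) (≤-trans t≥1 (m≤m+n t s))
  proof : ∀ n → suc (proj₁ bic) ≤ n →
    (F : Fin n → Fin n → Bool) (w : Fin n → Fin n → Fin n) (v : Fin n) →
    Matching (λ x y → Closable C F x y ∧ (w x y ≟ᵇ v)) M → Fan F w t
  proof n N≤n F w v (xs₀ , ys₀ , xs₀-inj , ys₀-inj , ok) =
    v , xs , ys , as₀ ∘ α , bs₀ ∘ β ,
    (λ e → σ-inj (xs₀-inj e)) , (λ e → σ-inj (ys₀-inj e)) , (λ e → α-inj (as₀-inj e)) , (λ e → β-inj (bs₀-inj e)) ,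
    (λ i → proj₁ (∧-true (proj₁ (closable (σ i)))) , ≟ᵇ⇒≡ _ v (proj₂ (closable (σ i)))) ,
    (λ i j → proj₁ (∧-true (proj₁ (joined i (β (first t≥1)) (α j))))) ,
    (λ j i → proj₂ (∧-true {F (xs i) (as₀ (α (first t≥1)))} (proj₁ (joined i (β j) (α (first t≥1)))))) ,
    (λ j k → proj₂ (joined (first s≥1) (β j) (α k))) ,
    α-avoids , β-avoids
    where
    n≥1 : 1 ≤ n
    n≥1 = ≤-trans (s≤s z≤n) N≤n
    closable : ∀ i → Closable C F (xs₀ i) (ys₀ i) ≡ true × (w (xs₀ i) (ys₀ i) ≟ᵇ v) ≡ true
    closable i = ∧-true (ok i)
    -- The points for `commonPoints` are the pairs (x′, y′), coded in `Fin (n * n)`; the common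
    -- points found are then the dense bipartite graph `E`.
    pair : Fin (n * n) → Fin n × Fin n
    pair = remQuot n
    S : Fin M → Fin (n * n) → Bool
    S i u = closes F (xs₀ i) (ys₀ i) (proj₁ (pair u)) (proj₂ (pair u))
    S-count : ∀ i → count (n * n) (S i) ≡ paths F (xs₀ i) (ys₀ i)
    S-count i = trans (sum-combine n n _) (∑∑-cong n n λ x y →
      cong (λ z → 𝟙 (closes F (xs₀ i) (ys₀ i) (proj₁ z) (proj₂ z))) (Finₚ.remQuot-combine x y))
    cp = commonPoints (n * n) C s (*-mono-≤ n≥1 n≥1) C≥1 s≥1 S λ i → ≤-trans
      (≤ᵇ-true (proj₂ (∧-true {F (xs₀ i) (ys₀ i)} (proj₁ (closable i))))) (≤-reflexive (cong (C *_) (sym (S-count i))))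
    σ = proj₁ cp
    σ-inj = λ {i} {j} → proj₁ (proj₂ cp) {i} {j}
    q = proj₁ (proj₂ (proj₂ cp))
    common = proj₁ (proj₂ (proj₂ (proj₂ cp)))
    xs = xs₀ ∘ σ
    ys = ys₀ ∘ σ
    E : Fin n → Fin n → Bool
    E x y = q (combine x y)
    bq = proj₂ bic n (≤-trans (n≤1+n _) N≤n) E
      (≤-trans (proj₂ (proj₂ (proj₂ (proj₂ cp)))) (≤-reflexive (cong (K *_) (sum-combine n n _))))
    bs₀ = proj₁ bq
    as₀ = proj₁ (proj₂ bq)
    bs₀-inj = λ {i} {j} → proj₁ (proj₂ (proj₂ bq)) {i} {j}
    as₀-inj = λ {i} {j} → proj₁ (proj₂ (proj₂ (proj₂ bq))) {i} {j}
    joined : ∀ i j k → (F (xs i) (as₀ k) ∧ F (bs₀ j) (ys i)) ≡ true × F (bs₀ j) (as₀ k) ≡ true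
    joined i j k = ∧-true (subst (λ z → closes F (xs i) (ys i) (proj₁ z) (proj₂ z) ≡ true)
      (Finₚ.remQuot-combine (bs₀ j) (as₀ k)) (common i _ (proj₂ (proj₂ (proj₂ (proj₂ bq))) j k)))
    avoid-ys = avoid t s n as₀ ys as₀-inj
    α = proj₁ avoid-ys
    α-inj = λ {i} {j} → proj₁ (proj₂ avoid-ys) {i} {j}
    α-avoids = proj₂ (proj₂ avoid-ys)
    avoid-xs = avoid t s n bs₀ xs bs₀-inj
    β = proj₁ avoid-xs
    β-inj = λ {i} {j} → proj₁ (proj₂ avoid-xs) {i} {j}
    β-avoids = proj₂ (proj₂ avoid-xs)

∃⊎∀ : ∀ n {P Q : Fin n → Set} → (∀ i → P i ⊎ Q i) → Σ (Fin n) P ⊎ (∀ i → Q i)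
∃⊎∀ zero    h = inj₂ λ ()
∃⊎∀ (suc n) h with h zero | ∃⊎∀ n (h ∘ suc)
... | inj₁ p | _            = inj₁ (zero , p)
... | inj₂ q | inj₁ (i , p) = inj₁ (suc i , p)
... | inj₂ q | inj₂ r       = inj₂ λ { zero → q ; (suc i) → r i }

-- Pruning costs a factor 2. If no `v` yields a large matching, every `L v` has a bounded cover and
-- each remaining edge is covered at its x-end or at its y-end. The more frequent kind, at the cost
-- of another factor 2, feeds `stars`, with the two sides exchanged in the second case.
fan-or-stars : ∀ a t → 1 ≤ a → 1 ≤ t → Σ ℕ λ N → ∀ n → N ≤ n →
  (F : Fin n → Fin n → Bool) (w : Fin n → Fin n → Fin n) → n * n ≤ a * edges F →
  Fan F w t ⊎ (Stars F w t ⊎ Stars (λ y x → F x y) (λ y x → w x y) t)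
fan-or-stars a t a≥1 t≥1 = suc (N₁ + N₂) , proof
  where
  fan′ = fan (closing a) t (s≤s z≤n) t≥1
  M = proj₁ fan′
  N₁ = proj₁ (proj₂ (proj₂ fan′))
  2·2a≥1 : 1 ≤ 2 * (2 * a)
  2·2a≥1 = *-mono-≤ {1} {2} (s≤s z≤n) (*-mono-≤ {1} {2} (s≤s z≤n) a≥1)
  stars′ = stars (2 * (2 * a)) M t 2·2a≥1 (proj₁ (proj₂ fan′)) t≥1
  N₂ = proj₁ stars′
  proof : ∀ n → suc (N₁ + N₂) ≤ n →
    (F : Fin n → Fin n → Bool) (w : Fin n → Fin n → Fin n) → n * n ≤ a * edges F →
    Fan F w t ⊎ (Stars F w t ⊎ Stars (λ y x → F x y) (λ y x → w x y) t)
  proof n N≤n F w dense = dispatch (∃⊎∀ n λ v → matching-or-cover (L v) M)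
    where
    open ≤-Reasoning
    n≥1 : 1 ≤ n
    n≥1 = ≤-trans (s≤s z≤n) N≤n
    N₁≤n : N₁ ≤ n
    N₁≤n = ≤-trans (≤-trans (m≤m+n N₁ N₂) (n≤1+n _)) N≤n
    N₂≤n : N₂ ≤ n
    N₂≤n = ≤-trans (≤-trans (m≤n+m N₂ N₁) (n≤1+n _)) N≤n
    F′ = Closable (closing a) F
    L : Fin n → Fin n → Fin n → Bool
    L v x y = F′ x y ∧ (w x y ≟ᵇ v)
    dense′ : n * n ≤ 2 * a * edges F′
    dense′ = edges-closable a F n≥1 dense
    dispatch : Σ (Fin n) (λ v → Matching (L v) M) ⊎ (∀ v → Cover (L v) M) →
      Fan F w t ⊎ (Stars F w t ⊎ Stars (λ y x → F x y) (λ y x → w x y) t)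
    dispatch (inj₁ (v , matching)) = inj₁ (proj₂ (proj₂ (proj₂ fan′)) n N₁≤n F w v matching)
    dispatch (inj₂ cover) = inj₂ (half (≤-total (edges FY) (edges FX)))
      where
      CX CY : Fin n → Fin n → Bool
      CX v = proj₁ (cover v)
      CY v = proj₁ (proj₂ (cover v))
      FX FY : Fin n → Fin n → Bool
      FX x y = F′ x y ∧ CX (w x y) x
      FY x y = F′ x y ∧ CY (w x y) y
      pointwise : ∀ x y → 𝟙 (F′ x y) ≤ 𝟙 (FX x y) + 𝟙 (FY x y)
      pointwise x y = 𝟙-≥ (F′ x y) λ e → lemma e
        (proj₂ (proj₂ (proj₂ (proj₂ (cover (w x y))))) x y (true-∧ e (≟ᵇ-refl (w x y))))
        where
        lemma : F′ x y ≡ true → CX (w x y) x ≡ true ⊎ CY (w x y) y ≡ true → 1 ≤ 𝟙 (FX x y) + 𝟙 (FY x y)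
        lemma e (inj₁ c) = ≤-trans (≤-reflexive (cong 𝟙 (sym (true-∧ e c)))) (m≤m+n _ _)
        lemma e (inj₂ c) = ≤-trans (≤-reflexive (cong 𝟙 (sym (true-∧ e c)))) (m≤n+m _ (𝟙 (FX x y)))
      E′≤ : edges F′ ≤ edges FX + edges FY
      E′≤ = ≤-trans (∑∑-mono n n pointwise) (≤-reflexive (∑∑-+ n n _ _))
      bound : ∀ e → edges F′ ≤ e + e → n * n ≤ 2 * (2 * a) * e
      bound e h = begin
        n * n               ≤⟨ dense′ ⟩
        2 * a * edges F′    ≤⟨ *-monoʳ-≤ (2 * a) h ⟩
        2 * a * (e + e)     ≡⟨ eq a e ⟩
        2 * (2 * a) * e     ∎
        where
        eq : ∀ a e → 2 * a * (e + e) ≡ 2 * (2 * a) * e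
        eq = solve-∀
      half : edges FY ≤ edges FX ⊎ edges FX ≤ edges FY →
        Stars F w t ⊎ Stars (λ y x → F x y) (λ y x → w x y) t
      half (inj₁ h)
        with proj₂ stars′ n N₂≤n FX w CX (λ v → proj₁ (proj₂ (proj₂ (cover v))))
               (λ x y e → proj₂ (∧-true {F′ x y} e)) (bound (edges FX) (≤-trans E′≤ (+-monoʳ-≤ _ h)))
      ... | xs , ws , ys , i₁ , i₂ , i₃ , ok = inj₁ (xs , ws , ys , i₁ , i₂ , i₃ ,
              λ i j → proj₁ (∧-true (proj₁ (∧-true {F′ (xs i) (ys j)} (proj₁ (ok i j))))) , proj₂ (ok i j))
      half (inj₂ h)
        with proj₂ stars′ n N₂≤n (λ y x → FY x y) (λ y x → w x y) CY (λ v → proj₁ (proj₂ (proj₂ (proj₂ (cover v)))))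
               (λ y x e → proj₂ (∧-true {F′ x y} e))
               (≤-trans (bound (edges FY) (≤-trans E′≤ (+-monoˡ-≤ _ h))) (≤-reflexive (cong (2 * (2 * a) *_) (sum-swap n n _))))
      ... | xs , ws , ys , i₁ , i₂ , i₃ , ok = inj₂ (xs , ws , ys , i₁ , i₂ , i₃ ,
              λ i j → proj₁ (∧-true (proj₁ (∧-true {F′ (ys j) (xs i)} (proj₁ (ok i j))))) , proj₂ (ok i j))

-- Hyperedges and Berge copies

card≡count : ∀ {n} (S : Subset n) → ∣ S ∣ ≡ count n (lookup S)
card≡count []          = refl
card≡count (true ∷ S)  = cong suc (card≡count S)
card≡count (false ∷ S) = card≡count S

_∖_ : ∀ {n} → (Fin n → Bool) → Fin n → Fin n → Bool
(p ∖ x) z = p z ∧ not (z ≟ᵇ x)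

∖-true : ∀ {n} (p : Fin n → Bool) x z → (p ∖ x) z ≡ true → p z ≡ true × z ≢ x
∖-true p x z h = let pz , ne = ∧-true h in pz , does-false (z Finₚ.≟ x) (not-true ne)

true-∖ : ∀ {n} (p : Fin n → Bool) x z → p z ≡ true → z ≢ x → (p ∖ x) z ≡ true
true-∖ p x z pz ne = true-∧ pz (false-not (≢⇒≟ᵇ z x ne))

count-∖ : ∀ n p x → p x ≡ true → count n p ≡ suc (count n (p ∖ x))
count-∖ n p x px = trans (sum-cong n pointwise) (trans (sum-+ n _ _) (cong (_+ count n (p ∖ x)) (sum-≟ n x)))
  where
  pointwise : ∀ z → 𝟙 (p z) ≡ 𝟙 (z ≟ᵇ x) + 𝟙 ((p ∖ x) z)
  pointwise z with z Finₚ.≟ x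
  ... | yes refl rewrite px = refl
  ... | no  _ with p z
  ...   | true  = refl
  ...   | false = refl

count-empty : ∀ n p → count n p ≡ 0 → ∀ z → ¬ (p z ≡ true)
count-empty n p h z pz = 1+n≰n (≤-trans (≤-reflexive (cong 𝟙 (sym pz))) (≤-trans (term≤sum n (𝟙 ∘ p) z) (≤-reflexive h)))

_∋_at_ : ∀ {n} (H : ThreeGraph n) → Fin n → Fin (m H) → Set
H ∋ x at j = lookup (edge H j) x ≡ true

Triple : ∀ {n} (H : ThreeGraph n) (x y w : Fin n) (j : Fin (m H)) → Set
Triple H x y w j = (H ∋ x at j) × (H ∋ y at j) × (H ∋ w at j) × w ≢ x × w ≢ y ×
  (∀ z → H ∋ z at j → z ≡ x ⊎ (z ≡ y ⊎ z ≡ w))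

triple : ∀ {n} (H : ThreeGraph n) x y j → x ≢ y → H ∋ x at j → H ∋ y at j →
  Σ (Fin n) λ w → Triple H x y w j
triple {n} H x y j x≢y hx hy =
  w , hx , hy , proj₁ w∈p , proj₂ w∈p , proj₂ w∈p₁ , exact
  where
  p p₁ p₂ : Fin n → Bool
  p = lookup (edge H j)
  p₁ = p ∖ x
  p₂ = p₁ ∖ y
  size : 3 ≡ suc (suc (count n p₂))
  size = trans (sym (uniform H j)) (trans (card≡count (edge H j)) (trans (count-∖ n p x hx)
    (cong suc (count-∖ n p₁ y (true-∖ p x y hy (x≢y ∘ sym))))))
  size₂ : count n p₂ ≡ 1
  size₂ = sym (suc-injective (suc-injective size))
  third = count>0 n p₂ (≤-reflexive (sym size₂))
  w = proj₁ third
  w∈p₁ = ∖-true p₁ y w (proj₂ third)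
  w∈p = ∖-true p x w (proj₁ w∈p₁)
  exact : ∀ z → H ∋ z at j → z ≡ x ⊎ (z ≡ y ⊎ z ≡ w)
  exact z hz with z Finₚ.≟ x | z Finₚ.≟ y | z Finₚ.≟ w
  ... | yes e | _     | _     = inj₁ e
  ... | no _  | yes e | _     = inj₂ (inj₁ e)
  ... | no _  | no _  | yes e = inj₂ (inj₂ e)
  ... | no z≢x | no z≢y | no z≢w = ⊥-elim (count-empty n (p₂ ∖ w)
          (suc-injective (trans (sym (count-∖ n p₂ w (proj₂ third))) size₂)) z
          (true-∖ p₂ w z (true-∖ p₁ y z (true-∖ p x z hz z≢x) z≢y) z≢w))

-- `shadowAdj` also holds on the diagonal, at every vertex of a hyperedge. With the diagonal
-- removed, `edges (shadow H)` counts each shadow edge exactly twice.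
shadow : ∀ {n} → ThreeGraph n → Fin n → Fin n → Bool
shadow H x y = not (x ≟ᵇ y) ∧ shadowAdj H x y

-- Fixes the third vertex as a function of the ordered pair, before any random colouring or
-- selection is made.
third : ∀ {n} (H : ThreeGraph n) x y → Σ (Fin n) λ w → shadow H x y ≡ true → Σ (Fin (m H)) (Triple H x y w)
third H x y with shadow H x y in eq
-- An arbitrary value outside the shadow.
... | false = x , λ ()
... | true  with ∧-true {not (x ≟ᵇ y)} eq
...   | ne , adj with anyFin⁻ (m H) _ adj
...     | j , e with ∧-true e
...       | hx , hy with triple H x y j (does-false (x Finₚ.≟ y) (not-true ne)) hx hy
...         | w , t = w , λ _ → j , t

shadow-sym : ∀ {n} (H : ThreeGraph n) x y → shadow H x y ≡ true → shadow H y x ≡ true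
shadow-sym H x y h with ∧-true {not (x ≟ᵇ y)} h
... | ne , adj with anyFin⁻ (m H) _ adj
...   | j , e with ∧-true {lookup (edge H j) x} e
...     | hx , hy = true-∧ (false-not (≢⇒≟ᵇ y x (does-false (x Finₚ.≟ y) (not-true ne) ∘ sym)))
                      (anyFin⁺ (m H) _ j (true-∧ hy hx))

edge-sym : ∀ {k} (G : SimpleGraph k) {u v} → Edge G u v → Edge G v u
edge-sym G {u} {v} e = trans (symm G v u) e

edge-≢ : ∀ {k} (G : SimpleGraph k) {u v} → Edge G u v → u ≢ v
edge-≢ G {u} e refl = true≢false e (irrefl G u)

-- It suffices to assign a hyperedge to one orientation of each edge of G.
berge : ∀ {k n} (G : SimpleGraph k) (H : ThreeGraph n) (i : Fin k → Fin n) → Inj i →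
  (Good : Fin k → Fin k → Fin (m H) → Set) →
  (∀ u v → Edge G u v → Σ (Fin (m H)) λ j → Good u v j ⊎ Good v u j) →
  (∀ {u v j} → Good u v j → (H ∋ i u at j) × (H ∋ i v at j)) →
  (∀ {u v u′ v′ j} → Good u v j → Good u′ v′ j → (u ≡ u′ × v ≡ v′) ⊎ (u ≡ v′ × v ≡ u′)) →
  ContainsBerge G H
berge {k} {n} G H i i-inj Good exists contained determines =
  i , i-inj , f , f-sym , (λ u v u′ v′ e e′ eq → unique (f-good u v e) (subst (Good± u′ v′) (sym eq) (f-good u′ v′ e′))) ,
  (λ u v e → contains (f-good u v e))
  where
  Good± : Fin k → Fin k → Fin (m H) → Set
  Good± u v j = Good u v j ⊎ Good v u j
  flip : ∀ {u v j} → Good± u v j → Good± v u j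
  flip (inj₁ g) = inj₂ g
  flip (inj₂ g) = inj₁ g
  contains : ∀ {u v j} → Good± u v j → (H ∋ i u at j) × (H ∋ i v at j)
  contains (inj₁ g) = contained g
  contains (inj₂ g) = let a , b = contained g in b , a
  unique : ∀ {u v u′ v′ j} → Good± u v j → Good± u′ v′ j → (u ≡ u′ × v ≡ v′) ⊎ (u ≡ v′ × v ≡ u′)
  unique (inj₁ g) (inj₁ h) = determines g h
  unique (inj₁ g) (inj₂ h) with determines g h
  ... | inj₁ (a , b) = inj₂ (a , b)
  ... | inj₂ (a , b) = inj₁ (a , b)
  unique (inj₂ g) (inj₁ h) with determines g h
  ... | inj₁ (a , b) = inj₂ (b , a)
  ... | inj₂ (a , b) = inj₁ (b , a)
  unique (inj₂ g) (inj₂ h) with determines g h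
  ... | inj₁ (a , b) = inj₁ (b , a)
  ... | inj₂ (a , b) = inj₂ (b , a)
  f : ∀ u v → Edge G u v → Fin (m H)
  -- The order of the endpoints decides the orientation, which makes `f` symmetric. The hyperedge
  -- given by `exists` may depend on the proof of adjacency, hence `uip` in `f-sym`.
  f u v e with Finₚ.<-cmp u v
  ... | tri< _ _ _ = proj₁ (exists u v e)
  ... | tri≈ _ u≡v _ = ⊥-elim (edge-≢ G e u≡v)
  ... | tri> _ _ _ = proj₁ (exists v u (edge-sym G e))
  f-good : ∀ u v e → Good± u v (f u v e)
  f-good u v e with Finₚ.<-cmp u v
  ... | tri< _ _ _ = proj₂ (exists u v e)
  ... | tri≈ _ u≡v _ = ⊥-elim (edge-≢ G e u≡v)
  ... | tri> _ _ _ = flip (proj₂ (exists v u (edge-sym G e)))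
  f-sym : ∀ u v e e′ → f u v e ≡ f v u e′
  f-sym u v e e′ with Finₚ.<-cmp u v | Finₚ.<-cmp v u
  ... | tri< _ _ _ | tri> _ _ _ = cong (λ z → proj₁ (exists u v z)) (uip _ _)
  ... | tri> _ _ _ | tri< _ _ _ = cong (λ z → proj₁ (exists v u z)) (uip _ _)
  ... | tri≈ _ u≡v _ | _ = ⊥-elim (edge-≢ G e u≡v)
  ... | _ | tri≈ _ v≡u _ = ⊥-elim (edge-≢ G e′ v≡u)
  ... | tri< a _ _ | tri< b _ _ = ⊥-elim (<-asym a b)
  ... | tri> _ _ a | tri> _ _ b = ⊥-elim (<-asym b a)

-- Tripartitions

↑ˡ≢↑ʳ : ∀ {m n} (i : Fin m) (j : Fin n) → i ↑ˡ n ≢ m ↑ʳ j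
↑ˡ≢↑ʳ {suc m} (suc i) j e = ↑ˡ≢↑ʳ i j (Finₚ.suc-injective e)

pattern 0F = zero
pattern 1F = suc zero
pattern 2F = suc (suc zero)

record Tripartite {n} (H : ThreeGraph n) : Set where
  field
    F   : Fin n → Fin n → Bool
    w   : Fin n → Fin n → Fin n
    c   : Fin n → Fin 3
    c-x : ∀ {x y} → F x y ≡ true → c x ≡ 0F
    c-y : ∀ {x y} → F x y ≡ true → c y ≡ 1F
    c-w : ∀ {x y} → F x y ≡ true → c (w x y) ≡ 2F
    hyp : ∀ {x y} → F x y ≡ true → Σ (Fin (m H)) (Triple H x y (w x y))

  Hyp : Fin n → Fin n → Fin (m H) → Set
  Hyp x y j = F x y ≡ true × Triple H x y (w x y) j

  clash : ∀ {a b : Fin n} {i j} → i ≢ j → c a ≡ i → c b ≡ j → a ≢ b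
  clash i≢j ca cb refl = i≢j (trans (sym ca) cb)

  -- The colours identify x, y and the third vertex inside the hyperedge. Different pairs of `F`
  -- thus carry different hyperedges, and a Berge copy only needs the edges of `G` to be assigned to
  -- different pairs.
  Hyp-injective : ∀ {x y x′ y′ j} → Hyp x y j → Hyp x′ y′ j → x ≡ x′ × y ≡ y′
  Hyp-injective {x} {y} {x′} {y′} (f , hx , hy , _) (f′ , _ , _ , _ , _ , _ , exact) = xs , ys
    where
    xs : x ≡ x′
    xs with exact x hx
    ... | inj₁ e = e
    ... | inj₂ (inj₁ e) = ⊥-elim (clash (λ ()) (c-x f) (c-y f′) e)
    ... | inj₂ (inj₂ e) = ⊥-elim (clash (λ ()) (c-x f) (c-w f′) e)
    ys : y ≡ y′
    ys with exact y hy
    ... | inj₁ e = ⊥-elim (clash (λ ()) (c-y f) (c-x f′) e)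
    ... | inj₂ (inj₁ e) = e
    ... | inj₂ (inj₂ e) = ⊥-elim (clash (λ ()) (c-y f) (c-w f′) e)

-- The vertices x, y and `w x y` are distinct, so a random colouring gives them the colours 0, 1, 2
-- in this order with probability 1 / 27.
tripartition : ∀ {n} (H : ThreeGraph n) → Σ (Tripartite H) λ T →
  edges (shadow H) ≤ 27 * edges (Tripartite.F T)
tripartition {n} H = T , bound
  where
  open ≤-Reasoning
  w : Fin n → Fin n → Fin n
  w x y = proj₁ (third H x y)
  tests : (Fin n → Fin 3) → Fin n → Fin n → Bool
  tests c x y = (c x ≟ᵇ 0F) ∧ ((c y ≟ᵇ 1F) ∧ (c (w x y) ≟ᵇ 2F))
  F : (Fin n → Fin 3) → Fin n → Fin n → Bool
  F c x y = shadow H x y ∧ tests c x y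
  best = sumFun≤max n 2 (λ c → edges (F c))
  c = proj₁ best
  distinct₃ : ∀ x y → shadow H x y ≡ true → x ≢ y × w x y ≢ x × w x y ≢ y
  distinct₃ x y s = does-false (x Finₚ.≟ y) (not-true (proj₁ (∧-true {not (x ≟ᵇ y)} s))) ,
    (let _ , _ , _ , _ , a , b , _ = proj₂ (third H x y) s in a , b)
  factor : ∀ c x y → 𝟙 (tests c x y) ≡ 𝟙 (c x ≟ᵇ 0F) * (𝟙 (c y ≟ᵇ 1F) * (𝟙 (c (w x y) ≟ᵇ 2F) * 1))
  factor c x y = trans (𝟙-∧ (c x ≟ᵇ 0F) _) (cong (𝟙 (c x ≟ᵇ 0F) *_) (trans (𝟙-∧ (c y ≟ᵇ 1F) _)
    (cong (𝟙 (c y ≟ᵇ 1F) *_) (sym (*-identityʳ _)))))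
  average : ∀ x y → 3 ^ n * 𝟙 (shadow H x y) ≤ 27 * sumFun n 3 (λ c → 𝟙 (F c x y))
  average x y = split (shadow H x y) refl
   where
   split : ∀ b → shadow H x y ≡ b → 3 ^ n * 𝟙 b ≤ 27 * sumFun n 3 (λ c → 𝟙 (b ∧ tests c x y))
   split false _ = ≤-trans (≤-reflexive (*-zeroʳ (3 ^ n))) z≤n
   split true eq = let x≢y , w≢x , w≢y = distinct₃ x y eq in begin
    3 ^ n * 1                                ≡⟨ sumFun-const n 3 1 ⟨
    sumFun n 3 (λ _ → 1)                     ≡⟨ sumFun-indep n 3 (w x y) 2F _ (λ _ _ _ → refl) ⟨
    3 * sumFun n 3 g₁                        ≡⟨ cong (3 *_) (sumFun-indep n 3 y 1F g₁ (λ c c′ h → cong (λ z → 𝟙 (z ≟ᵇ 2F) * 1) (h (w x y) w≢y))) ⟨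
    3 * (3 * sumFun n 3 g₂)                  ≡⟨ cong (λ z → 3 * (3 * z)) (sumFun-indep n 3 x 0F g₂
        (λ c c′ h → cong₂ (λ z z′ → 𝟙 (z ≟ᵇ 1F) * (𝟙 (z′ ≟ᵇ 2F) * 1)) (h y (x≢y ∘ sym)) (h (w x y) w≢x))) ⟨
    3 * (3 * (3 * sumFun n 3 g₃))            ≡⟨ e₁ (sumFun n 3 g₃) ⟩
    27 * sumFun n 3 g₃                       ≤⟨ *-monoʳ-≤ 27 (sumFun-mono n 3 λ c → ≤-reflexive (sym (factor c x y))) ⟩
    27 * sumFun n 3 (λ c → 𝟙 (tests c x y))  ∎
    where
    g₁ g₂ g₃ : (Fin n → Fin 3) → ℕ
    g₁ c = 𝟙 (c (w x y) ≟ᵇ 2F) * 1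
    g₂ c = 𝟙 (c y ≟ᵇ 1F) * g₁ c
    g₃ c = 𝟙 (c x ≟ᵇ 0F) * g₂ c
    e₁ : ∀ z → 3 * (3 * (3 * z)) ≡ 27 * z
    e₁ = solve-∀
  bound : edges (shadow H) ≤ 27 * edges (F c)
  bound = *-cancel-≤ (3 ^ n) (m^n>0 3 n) (begin
    3 ^ n * edges (shadow H)                          ≡⟨ ∑∑-*ˡ n n (3 ^ n) _ ⟨
    ∑∑ n n (λ x y → 3 ^ n * 𝟙 (shadow H x y))         ≤⟨ ∑∑-mono n n average ⟩
    ∑∑ n n (λ x y → 27 * sumFun n 3 (λ c → 𝟙 (F c x y))) ≡⟨ ∑∑-*ˡ n n 27 _ ⟩
    27 * ∑∑ n n (λ x y → sumFun n 3 (λ c → 𝟙 (F c x y)))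
      ≡⟨ cong (27 *_) (trans (sumFun-sum n 3 n _) (sum-cong n λ x → sumFun-sum n 3 n _)) ⟨
    27 * sumFun n 3 (λ c → edges (F c))               ≤⟨ *-monoʳ-≤ 27 (proj₂ best) ⟩
    27 * (3 ^ n * edges (F c))                        ≡⟨ e₂ (3 ^ n) (edges (F c)) ⟩
    3 ^ n * (27 * edges (F c))                        ∎)
    where
    e₂ : ∀ a b → 27 * (a * b) ≡ a * (27 * b)
    e₂ = solve-∀
  parts : ∀ x y → F c x y ≡ true → shadow H x y ≡ true × (c x ≡ 0F × c y ≡ 1F × c (w x y) ≡ 2F)
  parts x y f with ∧-true {shadow H x y} f
  ... | s , r with ∧-true {c x ≟ᵇ 0F} r
  ...   | e , r′ with ∧-true {c y ≟ᵇ 1F} r′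
  ...     | e′ , e″ = s , ≟ᵇ⇒≡ _ _ e , ≟ᵇ⇒≡ _ _ e′ , ≟ᵇ⇒≡ _ _ e″
  T : Tripartite H
  T = record
    { F = F c ; w = w ; c = c
    ; c-x = λ {x} {y} f → proj₁ (proj₂ (parts x y f))
    ; c-y = λ {x} {y} f → proj₁ (proj₂ (proj₂ (parts x y f)))
    ; c-w = λ {x} {y} f → proj₂ (proj₂ (proj₂ (parts x y f)))
    ; hyp = λ {x} {y} f → proj₂ (third H x y) (proj₁ (parts x y f)) }

-- Graphs with condition (1) inside a fan

module FanEmbedding {k n} (G : SimpleGraph k) (H : ThreeGraph n) (T : Tripartite H)
  (triangle-free : TriangleFree G) (a : Fin k) (side : Fin k → Bool)
  (bipartite : ∀ u v → u ≢ a → v ≢ a → Edge G u v → side u ≢ side v)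
  (fan : Fan (Tripartite.F T) (Tripartite.w T) k) where

  open Tripartite T

  v = proj₁ fan
  xs = proj₁ (proj₂ fan)
  ys = proj₁ (proj₂ (proj₂ fan))
  as = proj₁ (proj₂ (proj₂ (proj₂ fan)))
  bs = proj₁ (proj₂ (proj₂ (proj₂ (proj₂ fan))))
  facts = proj₂ (proj₂ (proj₂ (proj₂ (proj₂ fan))))
  xs-inj = λ {i} {j} → proj₁ facts {i} {j}
  ys-inj = λ {i} {j} → proj₁ (proj₂ facts) {i} {j}
  as-inj = λ {i} {j} → proj₁ (proj₂ (proj₂ facts)) {i} {j}
  bs-inj = λ {i} {j} → proj₁ (proj₂ (proj₂ (proj₂ facts))) {i} {j}
  adjacency = proj₂ (proj₂ (proj₂ (proj₂ facts)))
  F-xy = λ i → proj₁ (proj₁ adjacency i)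
  w-xy = λ i → proj₂ (proj₁ adjacency i)
  F-xa = proj₁ (proj₂ adjacency)
  F-by = proj₁ (proj₂ (proj₂ adjacency))
  F-ba = proj₁ (proj₂ (proj₂ (proj₂ adjacency)))
  as≢ys = proj₁ (proj₂ (proj₂ (proj₂ (proj₂ adjacency))))
  bs≢xs = proj₂ (proj₂ (proj₂ (proj₂ (proj₂ adjacency))))

  -- A neighbour of the apex sits on a matching edge, with index in the first half on the left side
  -- and in the second half on the right side. All other vertices sit on `bs` or `as`.
  left right : Bool → Fin k → Fin n
  left  nbr u = if nbr then xs (u ↑ˡ k) else bs u
  right nbr u = if nbr then ys (k ↑ʳ u) else as u

  L R : Fin k → Fin n
  L u = left (adj G a u) u
  R u = right (adj G a u) u

  left-color : ∀ b u → c (left b u) ≡ 0F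
  left-color true  u = c-x (F-xy (u ↑ˡ k))
  left-color false u = c-x (F-ba u u)

  right-color : ∀ b u → c (right b u) ≡ 1F
  right-color true  u = c-y (F-xy (k ↑ʳ u))
  right-color false u = c-y (F-ba u u)

  v-color : Fin k → c v ≡ 2F
  v-color u = trans (cong c (sym (w-xy (u ↑ˡ k)))) (c-w (F-xy (u ↑ˡ k)))

  left-inj : ∀ b b′ {u u′} → left b u ≡ left b′ u′ → u ≡ u′
  left-inj true  true  e = Finₚ.↑ˡ-injective k _ _ (xs-inj e)
  left-inj true  false e = ⊥-elim (bs≢xs _ _ (sym e))
  left-inj false true  e = ⊥-elim (bs≢xs _ _ e)
  left-inj false false e = bs-inj e

  right-inj : ∀ b b′ {u u′} → right b u ≡ right b′ u′ → u ≡ u′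
  right-inj true  true  e = Finₚ.↑ʳ-injective k _ _ (ys-inj e)
  right-inj true  false e = ⊥-elim (as≢ys _ _ (sym e))
  right-inj false true  e = ⊥-elim (as≢ys _ _ e)
  right-inj false false e = as-inj e

  data Place (u : Fin k) : Fin n → Set where
    apex : u ≡ a → Place u v
    onL  : u ≢ a → side u ≡ true  → Place u (L u)
    onR  : u ≢ a → side u ≡ false → Place u (R u)

  place : ∀ u → Σ (Fin n) (Place u)
  place u with u Finₚ.≟ a | side u in eq
  ... | yes e | _     = v , apex e
  ... | no ne | true  = L u , onL ne eq
  ... | no ne | false = R u , onR ne eq

  place-inj : ∀ {u u′ p p′} → Place u p → Place u′ p′ → p ≡ p′ → u ≡ u′
  place-inj (apex e) (apex e′) _ = trans e (sym e′)
  place-inj {u} (apex _) (onL _ _) e = ⊥-elim (clash (λ ()) (v-color u) (left-color _ _) e)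
  place-inj {u} (apex _) (onR _ _) e = ⊥-elim (clash (λ ()) (v-color u) (right-color _ _) e)
  place-inj {u} (onL _ _) (apex _) e = ⊥-elim (clash (λ ()) (left-color _ _) (v-color u) e)
  place-inj (onL _ _) (onL _ _) e = left-inj _ _ e
  place-inj (onL _ _) (onR _ _) e = ⊥-elim (clash (λ ()) (left-color _ _) (right-color _ _) e)
  place-inj {u} (onR _ _) (apex _) e = ⊥-elim (clash (λ ()) (right-color _ _) (v-color u) e)
  place-inj (onR _ _) (onL _ _) e = ⊥-elim (clash (λ ()) (right-color _ _) (left-color _ _) e)
  place-inj (onR _ _) (onR _ _) e = right-inj _ _ e

  img : Fin k → Fin n
  img u = proj₁ (place u)

  -- The pair of `F` that carries an edge of `G`. An edge at the apex uses the hyperedge through `v`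
  -- over a matching edge. One end of this matching edge is the image of no vertex, because the two
  -- halves of the indices serve opposite sides; hence no `cross` pair coincides with it.
  data Pair : Fin k → Fin k → Fin n → Fin n → Set where
    spokeL : ∀ {u z} → img z ≡ v → z ≡ a → img u ≡ xs (u ↑ˡ k) → Pair z u (xs (u ↑ˡ k)) (ys (u ↑ˡ k))
    spokeR : ∀ {u z} → img z ≡ v → z ≡ a → img u ≡ ys (k ↑ʳ u) → Pair z u (xs (k ↑ʳ u)) (ys (k ↑ʳ u))
    cross  : ∀ {u u′} → img u ≡ L u → img u′ ≡ R u′ → Pair u u′ (L u) (R u′)

  ys≢right : ∀ b {u u′} → ys (u ↑ˡ k) ≢ right b u′
  ys≢right true  e = ↑ˡ≢↑ʳ _ _ (ys-inj e)
  ys≢right false e = as≢ys _ _ (sym e)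

  xs≢left : ∀ b {u u′} → xs (k ↑ʳ u) ≢ left b u′
  xs≢left true  e = ↑ˡ≢↑ʳ _ _ (sym (xs-inj e))
  xs≢left false e = bs≢xs _ _ (sym e)

  pair-inj : ∀ {u u′ z z′ x y x′ y′} → Pair u u′ x y → Pair z z′ x′ y′ → x ≡ x′ → y ≡ y′ → u ≡ z × u′ ≡ z′
  pair-inj (spokeL _ e _) (spokeL _ e′ _) ex ey = trans e (sym e′) , Finₚ.↑ˡ-injective k _ _ (xs-inj ex)
  pair-inj (spokeL _ _ _) (spokeR _ _ _) ex ey = ⊥-elim (↑ˡ≢↑ʳ _ _ (xs-inj ex))
  pair-inj (spokeL _ _ _) (cross _ _)  ex ey = ⊥-elim (ys≢right _ ey)
  pair-inj (spokeR _ _ _) (spokeL _ _ _) ex ey = ⊥-elim (↑ˡ≢↑ʳ _ _ (sym (xs-inj ex)))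
  pair-inj (spokeR _ e _) (spokeR _ e′ _) ex ey = trans e (sym e′) , Finₚ.↑ʳ-injective k _ _ (xs-inj ex)
  pair-inj (spokeR _ _ _) (cross _ _)  ex ey = ⊥-elim (xs≢left _ ex)
  pair-inj (cross _ _) (spokeL _ _ _) ex ey = ⊥-elim (ys≢right _ (sym ey))
  pair-inj (cross _ _) (spokeR _ _ _) ex ey = ⊥-elim (xs≢left _ (sym ex))
  pair-inj (cross _ _) (cross _ _)  ex ey = left-inj _ _ ex , right-inj _ _ ey

  Good : Fin k → Fin k → Fin (m H) → Set
  Good u u′ j = Σ (Fin n) λ x → Σ (Fin n) λ y → Pair u u′ x y × Hyp x y j

  good-spoke : ∀ z u → z ≡ a → img z ≡ v → Edge G a u → (img u ≡ L u ⊎ img u ≡ R u) → Σ (Fin (m H)) (Good z u)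
  good-spoke z u z≡a iz e (inj₁ iu) = let j , t = hyp (F-xy (u ↑ˡ k)) in
    j , _ , _ , spokeL iz z≡a (trans iu (cong (λ b → left b u) e)) , F-xy _ , t
  good-spoke z u z≡a iz e (inj₂ iu) = let j , t = hyp (F-xy (k ↑ʳ u)) in
    j , _ , _ , spokeR iz z≡a (trans iu (cong (λ b → right b u) e)) , F-xy _ , t

  -- Two adjacent neighbours of the apex would need a pair formed by ends of two different matching
  -- edges, about which a fan says nothing. Triangle-freeness excludes this case.
  cross-edge : ∀ b b′ u u′ → (b ≡ true → b′ ≡ true → ⊥) → F (left b u) (right b′ u′) ≡ true
  cross-edge true  true  u u′ h = ⊥-elim (h refl refl)
  cross-edge true  false u u′ h = F-xa _ _
  cross-edge false true  u u′ h = F-by _ _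
  cross-edge false false u u′ h = F-ba _ _

  good-cross : ∀ u u′ → Edge G u u′ → img u ≡ L u → img u′ ≡ R u′ → Σ (Fin (m H)) (Good u u′)
  good-cross u u′ e iu iu′ = let f = cross-edge _ _ u u′ (λ p p′ → triangle-free a u u′ p e p′)
                                 j , t = hyp f in
    j , _ , _ , cross iu iu′ , f , t

  exists′ : ∀ u u′ {p p′} → Place u p → Place u′ p′ → img u ≡ p → img u′ ≡ p′ → Edge G u u′ →
    Σ (Fin (m H)) λ j → Good u u′ j ⊎ Good u′ u j
  exists′ u u′ (apex e) (apex e′) _ _ d = ⊥-elim (edge-≢ G d (trans e (sym e′)))
  exists′ u u′ (apex refl) (onL _ _) i i′ d = let j , g = good-spoke u u′ refl i d (inj₁ i′) in j , inj₁ g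
  exists′ u u′ (apex refl) (onR _ _) i i′ d = let j , g = good-spoke u u′ refl i d (inj₂ i′) in j , inj₁ g
  exists′ u u′ (onL _ _) (apex refl) i i′ d = let j , g = good-spoke u′ u refl i′ (edge-sym G d) (inj₁ i) in j , inj₂ g
  exists′ u u′ (onR _ _) (apex refl) i i′ d = let j , g = good-spoke u′ u refl i′ (edge-sym G d) (inj₂ i) in j , inj₂ g
  exists′ u u′ (onL n s) (onL n′ s′) _ _ d = ⊥-elim (bipartite u u′ n n′ d (trans s (sym s′)))
  exists′ u u′ (onR n s) (onR n′ s′) _ _ d = ⊥-elim (bipartite u u′ n n′ d (trans s (sym s′)))
  exists′ u u′ (onL _ _) (onR _ _) i i′ d = let j , g = good-cross u u′ d i i′ in j , inj₁ g
  exists′ u u′ (onR _ _) (onL _ _) i i′ d = let j , g = good-cross u′ u (edge-sym G d) i′ i in j , inj₂ g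

  contained : ∀ {u u′ j} → Good u u′ j → (H ∋ img u at j) × (H ∋ img u′ at j)
  contained {j = j} (x , y , spokeL iz _ iu , _ , hx , hy , hw , _) =
    subst (λ z → H ∋ z at j) (trans (w-xy _) (sym iz)) hw , subst (λ z → H ∋ z at j) (sym iu) hx
  contained {j = j} (x , y , spokeR iz _ iu , _ , hx , hy , hw , _) =
    subst (λ z → H ∋ z at j) (trans (w-xy _) (sym iz)) hw , subst (λ z → H ∋ z at j) (sym iu) hy
  contained {j = j} (x , y , cross iu iu′ , _ , hx , hy , hw , _) =
    subst (λ z → H ∋ z at j) (sym iu) hx , subst (λ z → H ∋ z at j) (sym iu′) hy

  embedding : ContainsBerge G H
  embedding = berge G H img (λ {u} {u′} → place-inj (proj₂ (place u)) (proj₂ (place u′))) Good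
    (λ u u′ → exists′ u u′ (proj₂ (place u)) (proj₂ (place u′)) refl refl)
    contained
    λ { (_ , _ , p , h) (_ , _ , p′ , h′) → let ex , ey = Hyp-injective h h′ in inj₁ (pair-inj p p′ ex ey) }

-- Graphs with condition (2) inside stars

record StarSystem {n} (H : ThreeGraph n) (t : ℕ) : Set₁ where
  field
    ps qs ys : Fin t → Fin n
    ps-inj : Inj ps
    qs-inj : Inj qs
    ys-inj : Inj ys
    ps≢qs  : ∀ i j → ps i ≢ qs j
    ps≢ys  : ∀ i j → ps i ≢ ys j
    qs≢ys  : ∀ i j → qs i ≢ ys j
    Star   : Fin t → Fin t → Fin (m H) → Set
    star   : ∀ i j → Σ (Fin (m H)) (Star i j)
    star-∋ : ∀ {i j e} → Star i j e → (H ∋ ps i at e) × (H ∋ qs i at e) × (H ∋ ys j at e)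
    star-inj : ∀ {i j i′ j′ e} → Star i j e → Star i′ j′ e → i ≡ i′ × j ≡ j′

module _ {n} {H : ThreeGraph n} (T : Tripartite H) where
  open Tripartite T

  -- Whichever colour class contains the centres, the outcome of `fan-or-stars` becomes the same
  -- kind of system, so that one embedding serves both.
  starsX : ∀ {t} → Stars F w t → StarSystem H t
  starsX (xs , ws , ys , xs-inj , ws-inj , ys-inj , ok) = record
    { ps = xs ; qs = ws ; ys = ys ; ps-inj = xs-inj ; qs-inj = ws-inj ; ys-inj = ys-inj
    ; ps≢qs = λ i j → clash (λ ()) (c-x (f i i)) (cw j)
    ; ps≢ys = λ i j → clash (λ ()) (c-x (f i j)) (c-y (f i j))
    ; qs≢ys = λ i j → clash (λ ()) (cw i) (c-y (f i j))
    ; Star = λ i j → Hyp (xs i) (ys j)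
    ; star = λ i j → let e , t = hyp (f i j) in e , f i j , t
    ; star-∋ = λ { {i} {j} {e} (_ , hx , hy , hw , _) → hx , subst (λ z → H ∋ z at e) (proj₂ (ok i j)) hw , hy }
    ; star-inj = λ h h′ → let ex , ey = Hyp-injective h h′ in xs-inj ex , ys-inj ey }
    where
    f = λ i j → proj₁ (ok i j)
    cw : ∀ j → c (ws j) ≡ 2F
    cw j = trans (cong c (sym (proj₂ (ok j j)))) (c-w (f j j))

  starsY : ∀ {t} → Stars (λ y x → F x y) (λ y x → w x y) t → StarSystem H t
  starsY (xs , ws , ys , xs-inj , ws-inj , ys-inj , ok) = record
    { ps = xs ; qs = ws ; ys = ys ; ps-inj = xs-inj ; qs-inj = ws-inj ; ys-inj = ys-inj
    ; ps≢qs = λ i j → clash (λ ()) (c-y (f i i)) (cw j)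
    ; ps≢ys = λ i j → clash (λ ()) (c-y (f i j)) (c-x (f i j))
    ; qs≢ys = λ i j → clash (λ ()) (cw i) (c-x (f i j))
    ; Star = λ i j → Hyp (ys j) (xs i)
    ; star = λ i j → let e , t = hyp (f i j) in e , f i j , t
    ; star-∋ = λ { {i} {j} {e} (_ , hx , hy , hw , _) → hy , subst (λ z → H ∋ z at e) (proj₂ (ok i j)) hw , hx }
    ; star-inj = λ h h′ → let ey , ex = Hyp-injective h h′ in xs-inj ex , ys-inj ey }
    where
    f = λ i j → proj₁ (ok i j)
    cw : ∀ j → c (ws j) ≡ 2F
    cw j = trans (cong c (sym (proj₂ (ok j j)))) (c-w (f j j))

module StarEmbedding {k n} (G : SimpleGraph k) (H : ThreeGraph n) (triangle-free : TriangleFree G)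
  (side : Fin k → Bool) (inB : Fin k → Fin k → Bool) (inB-sym : ∀ u v → inB u v ≡ inB v u)
  (cut : ∀ u v → inB u v ≡ true → side u ≢ side v) (i : Bool)
  (inside : ∀ u v → Edge G u v → inB u v ≡ false → side u ≡ i × side v ≡ i)
  (matching : ∀ u v w → Edge G u v → inB u v ≡ false → Edge G u w → inB u w ≡ false → v ≡ w)
  (S : StarSystem H (k + k)) where

  open StarSystem S

  Mate : Fin k → Fin k → Set
  Mate u v = Edge G u v × inB u v ≡ false

  mate-sym : ∀ {u v} → Mate u v → Mate v u
  mate-sym {u} {v} (e , b) = edge-sym G e , trans (inB-sym v u) b

  mate-unique : ∀ {u v w} → Mate u v → Mate u w → v ≡ w
  mate-unique {u} {v} {w} (e , b) (e′ , b′) = matching u v w e b e′ b′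

  lo : Fin k → Fin (k + k)
  lo u = u ↑ˡ k

  -- A mated pair u < u′ is sent to ps u and qs u.
  data Place (u : Fin k) : Fin n → Set where
    outer : side u ≢ i → Place u (ys (lo u))
    lower : side u ≡ i → (∀ u′ → Mate u u′ → u′ Fin.< u → ⊥) → Place u (ps (lo u))
    upper : ∀ {u′} → side u ≡ i → Mate u u′ → u′ Fin.< u → Place u (qs (lo u′))

  place : ∀ u → Σ (Fin n) (Place u)
  place u with side u Boolₚ.≟ i
  ... | no ne = _ , outer ne
  ... | yes e with Finₚ.any? (λ u′ → ((adj G u u′ Boolₚ.≟ true) ×-dec (inB u u′ Boolₚ.≟ false)) ×-dec (u′ Finₚ.<? u))
  ...   | yes (u′ , mate , lt) = _ , upper e mate lt
  ...   | no none = _ , lower e λ u′ mate lt → none (u′ , mate , lt)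

  place-inj : ∀ {u u′ p p′} → Place u p → Place u′ p′ → p ≡ p′ → u ≡ u′
  place-inj (outer _) (outer _) e = Finₚ.↑ˡ-injective k _ _ (ys-inj e)
  place-inj (outer _) (lower _ _) e = ⊥-elim (ps≢ys _ _ (sym e))
  place-inj (outer _) (upper _ _ _) e = ⊥-elim (qs≢ys _ _ (sym e))
  place-inj (lower _ _) (outer _) e = ⊥-elim (ps≢ys _ _ e)
  place-inj (lower _ _) (lower _ _) e = Finₚ.↑ˡ-injective k _ _ (ps-inj e)
  place-inj (lower _ _) (upper _ _ _) e = ⊥-elim (ps≢qs _ _ e)
  place-inj (upper _ _ _) (outer _) e = ⊥-elim (qs≢ys _ _ e)
  place-inj (upper _ _ _) (lower _ _) e = ⊥-elim (ps≢qs _ _ (sym e))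
  place-inj (upper _ mate _) (upper _ mate′ _) e with Finₚ.↑ˡ-injective k _ _ (qs-inj e)
  ... | refl = mate-unique (mate-sym mate) (mate-sym mate′)

  img : Fin k → Fin n
  img u = proj₁ (place u)

  -- An edge inside the part uses the hyperedge of its pair `ps`, `qs` with a vertex from the upper
  -- half of the `ys`, reserved for this purpose; hence the size `k + k`. An edge across uses the
  -- image of its other end in the lower half.
  data Pair : Fin k → Fin k → Fin (k + k) → Fin (k + k) → Set where
    mated : ∀ {u u′} → Mate u u′ → img u ≡ ps (lo u) → img u′ ≡ qs (lo u) → Pair u u′ (lo u) (k ↑ʳ u)
    low   : ∀ {u v} → Edge G u v → img u ≡ ps (lo u) → img v ≡ ys (lo v) → Pair u v (lo u) (lo v)
    high  : ∀ {u u′ v} → Edge G u v → Mate u u′ → img u ≡ qs (lo u′) → img v ≡ ys (lo v) → Pair u v (lo u′) (lo v)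

  lo-inj : ∀ {u u′} → lo u ≡ lo u′ → u ≡ u′
  lo-inj = Finₚ.↑ˡ-injective k _ _

  pair-inj : ∀ {u v u′ v′ x y x′ y′} → Pair u v x y → Pair u′ v′ x′ y′ → x ≡ x′ → y ≡ y′ → u ≡ u′ × v ≡ v′
  pair-inj (mated mt _ _) (mated mt′ _ _) ex ey with lo-inj ex
  ... | refl = refl , mate-unique mt mt′
  pair-inj (mated _ _ _) (low _ _ _) ex ey = ⊥-elim (↑ˡ≢↑ʳ _ _ (sym ey))
  pair-inj (mated _ _ _) (high _ _ _ _) ex ey = ⊥-elim (↑ˡ≢↑ʳ _ _ (sym ey))
  pair-inj (low _ _ _) (mated _ _ _) ex ey = ⊥-elim (↑ˡ≢↑ʳ _ _ ey)
  pair-inj (low _ _ _) (low _ _ _) ex ey = lo-inj ex , lo-inj ey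
  -- The one real conflict: two mates both adjacent to the same vertex would claim the same
  -- hyperedge, but then the three form a triangle.
  pair-inj (low e _ _) (high e′ mt _ _) ex ey with lo-inj ex | lo-inj ey
  ... | refl | refl = ⊥-elim (triangle-free _ _ _ (proj₁ mt) e e′)
  pair-inj (high _ _ _ _) (mated _ _ _) ex ey = ⊥-elim (↑ˡ≢↑ʳ _ _ ey)
  pair-inj (high e mt _ _) (low e′ _ _) ex ey with lo-inj ex | lo-inj ey
  ... | refl | refl = ⊥-elim (triangle-free _ _ _ (proj₁ mt) e′ e)
  pair-inj (high _ mt _ _) (high _ mt′ _ _) ex ey with lo-inj ex
  ... | refl = mate-unique (mate-sym mt) (mate-sym mt′) , lo-inj ey

  Good : Fin k → Fin k → Fin (m H) → Set
  Good u v e = Σ (Fin (k + k)) λ x → Σ (Fin (k + k)) λ y → Pair u v x y × Star x y e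

  good : ∀ {u v x y} → Pair u v x y → Σ (Fin (m H)) (Good u v)
  good {x = x} {y} p = let e , s = star x y in e , x , y , p , s

  img-low : ∀ {u u′} → Mate u u′ → u Fin.< u′ → img u ≡ ps (lo u)
  img-low {u} {u′} mt lt with place u
  ... | _ , outer ne = ⊥-elim (ne (proj₁ (inside u u′ (proj₁ mt) (proj₂ mt))))
  ... | _ , lower _ _ = refl
  ... | _ , upper {u″} _ mt′ lt′ = ⊥-elim (<-asym lt (subst (Fin._< u) (mate-unique mt′ mt) lt′))

  img-high : ∀ {u u′} → Mate u u′ → u Fin.< u′ → img u′ ≡ qs (lo u)
  img-high {u} {u′} mt lt with place u′
  ... | _ , outer ne = ⊥-elim (ne (proj₂ (inside u u′ (proj₁ mt) (proj₂ mt))))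
  ... | _ , lower _ none = ⊥-elim (none u (mate-sym mt) lt)
  ... | _ , upper {u″} _ mt′ lt′ = cong (qs ∘ lo) (mate-unique mt′ (mate-sym mt))

  good-cross : ∀ u v {p p′} → Place u p → Place v p′ → img u ≡ p → img v ≡ p′ → Edge G u v →
    side u ≡ i → side v ≢ i → Σ (Fin (m H)) (Good u v)
  good-cross u v (outer ne) _ _ _ _ si _ = ⊥-elim (ne si)
  good-cross u v _ (lower s _) _ _ _ _ si = ⊥-elim (si s)
  good-cross u v _ (upper s _ _) _ _ _ _ si = ⊥-elim (si s)
  good-cross u v (lower _ _) (outer _) iu iv e _ _ = good (low e iu iv)
  good-cross u v (upper _ mt _) (outer _) iu iv e _ _ = good (high e mt iu iv)

  exists : ∀ u v → Edge G u v → Σ (Fin (m H)) λ e → Good u v e ⊎ Good v u e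
  exists u v e with inB u v in eq
  ... | false with Finₚ.<-cmp u v
  ...   | tri< lt _ _ = let j , g = good (mated (e , eq) (img-low (e , eq) lt) (img-high (e , eq) lt)) in j , inj₁ g
  ...   | tri≈ _ u≡v _ = ⊥-elim (edge-≢ G e u≡v)
  ...   | tri> _ _ gt = let mt = mate-sym (e , eq)
                            j , g = good (mated mt (img-low mt gt) (img-high mt gt)) in j , inj₂ g
  exists u v e | true with side u Boolₚ.≟ i | side v Boolₚ.≟ i
  ... | yes p | yes p′ = ⊥-elim (cut u v eq (trans p (sym p′)))
  ... | no p | no p′ = ⊥-elim (cut u v eq (≢-≢ p p′))
    where
    ≢-≢ : ∀ {a b c : Bool} → a ≢ c → b ≢ c → a ≡ b
    ≢-≢ {true}  {true}  _ _ = refl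
    ≢-≢ {false} {false} _ _ = refl
    ≢-≢ {true}  {false} {true}  h _ = ⊥-elim (h refl)
    ≢-≢ {true}  {false} {false} _ h = ⊥-elim (h refl)
    ≢-≢ {false} {true}  {true}  _ h = ⊥-elim (h refl)
    ≢-≢ {false} {true}  {false} h _ = ⊥-elim (h refl)
  ... | yes p | no p′ = let j , g = good-cross u v (proj₂ (place u)) (proj₂ (place v)) refl refl e p p′ in j , inj₁ g
  ... | no p | yes p′ = let j , g = good-cross v u (proj₂ (place v)) (proj₂ (place u)) refl refl (edge-sym G e) p′ p in j , inj₂ g

  contained : ∀ {u v j} → Good u v j → (H ∋ img u at j) × (H ∋ img v at j)
  contained {j = j} (_ , _ , mated _ iu iv , s) = let p , q , y = star-∋ s in
    subst (λ z → H ∋ z at j) (sym iu) p , subst (λ z → H ∋ z at j) (sym iv) q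
  contained {j = j} (_ , _ , low _ iu iv , s) = let p , q , y = star-∋ s in
    subst (λ z → H ∋ z at j) (sym iu) p , subst (λ z → H ∋ z at j) (sym iv) y
  contained {j = j} (_ , _ , high _ _ iu iv , s) = let p , q , y = star-∋ s in
    subst (λ z → H ∋ z at j) (sym iu) q , subst (λ z → H ∋ z at j) (sym iv) y

  embedding : ContainsBerge G H
  embedding = berge G H img (λ {u} {u′} → place-inj (proj₂ (place u)) (proj₂ (place u′))) Good exists contained
    λ { (_ , _ , p , s) (_ , _ , p′ , s′) → let ex , ey = star-inj s s′ in inj₁ (pair-inj p p′ ex ey) }

sparse-shadow : ∀ {k} (G : SimpleGraph k) → HasEdge G → Cond1 G → Cond2 G → ∀ e → 1 ≤ e →
  Σ ℕ λ N → ∀ n → N ≤ n → (H : ThreeGraph n) → n * n ≤ e * edges (shadow H) → ContainsBerge G H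
sparse-shadow {k} G (u , _) (triangle-free , a , side₁ , bip) (side , inB , inB-sym , _ , cut , i , ins , mat) e e≥1 =
  proj₁ dich , λ n N≤n H dense →
    let T , bound = tripartition H
        open Tripartite T in
    go H T (proj₂ dich n N≤n F w (≤-trans dense (≤-trans (*-monoʳ-≤ e bound)
      (≤-reflexive (sym (*-assoc e 27 _))))))
  where
  -- The factor 27 pays for the tripartition. The size `k + k` is what the stars need, and `shrink`
  -- cuts a fan down to `k`.
  dich = fan-or-stars (e * 27) (k + k) (*-mono-≤ e≥1 (s≤s z≤n)) (≤-trans (fin-positive u) (m≤m+n k k))
  shrink : ∀ {n} {F : Fin n → Fin n → Bool} {w} → Fan F w (k + k) → Fan F w k
  shrink (v , xs , ys , as , bs , xi , yi , ai , bi , xy , xa , by , ba , a≢ , b≢) =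
    v , xs ∘ (_↑ˡ (k + k)) , ys ∘ (_↑ˡ (k + k)) , as ∘ (_↑ˡ k) , bs ∘ (_↑ˡ k) ,
    (λ e → Finₚ.↑ˡ-injective (k + k) _ _ (xi e)) , (λ e → Finₚ.↑ˡ-injective (k + k) _ _ (yi e)) ,
    (λ e → Finₚ.↑ˡ-injective k _ _ (ai e)) , (λ e → Finₚ.↑ˡ-injective k _ _ (bi e)) ,
    (λ i → xy _) , (λ i j → xa _ _) , (λ j i → by _ _) , (λ j k → ba _ _) , (λ j i → a≢ _ _) , (λ j i → b≢ _ _)
  go : ∀ {n} (H : ThreeGraph n) (T : Tripartite H) → let open Tripartite T in
    Fan F w (k + k) ⊎ (Stars F w (k + k) ⊎ Stars (λ y x → F x y) (λ y x → w x y) (k + k)) → ContainsBerge G H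
  go H T (inj₁ f) = FanEmbedding.embedding G H T triangle-free a side₁ bip (shrink {F = F} {w} f)
    where open Tripartite T
  go H T (inj₂ (inj₁ s)) = StarEmbedding.embedding G H triangle-free side inB inB-sym cut i ins mat (starsX T s)
  go H T (inj₂ (inj₂ s)) = StarEmbedding.embedding G H triangle-free side inB inB-sym cut i ins mat (starsY T s)

-- The Erdős–Stone theorem

nonNeighbours : ∀ {n} → (Fin n → Fin n → Bool) → Fin n → ℕ
nonNeighbours {n} A x = count n (not ∘ A x)

nonEdges : ∀ {n} → (Fin n → Fin n → Bool) → ℕ
nonEdges {n} A = sumFin n (nonNeighbours A)

Symmetric : ∀ {n} → (Fin n → Fin n → Bool) → Set
Symmetric A = ∀ x y → A x y ≡ A y x

-- Deleting `x` removes its row and its column of ordered non-edges. The diagonal pair (x, x) lies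
-- in both, hence the correction by 1.
nonEdges-remove : ∀ {n} (A : Fin (suc n) → Fin (suc n) → Bool) → Symmetric A → ∀ x →
  nonEdges (λ i j → A (punchIn x i) (punchIn x j)) + 2 * nonNeighbours A x ≤ nonEdges A + 1
nonEdges-remove {n} A A-sym x = begin
  N′ + 2 * nonNeighbours A x                          ≡⟨ e₁ N′ (nonNeighbours A x) ⟩
  nonNeighbours A x + (nonNeighbours A x + N′)        ≡⟨ cong (λ z → nonNeighbours A x + (z + N′)) (sum-remove n (λ y → 𝟙 (not (A x y))) x) ⟩
  nonNeighbours A x + (𝟙 (not (A x x)) + col + N′)    ≤⟨ +-monoʳ-≤ (nonNeighbours A x) (+-monoˡ-≤ N′ (+-monoˡ-≤ col (𝟙≤1 _))) ⟩
  nonNeighbours A x + (1 + col + N′)                  ≡⟨ e₂ (nonNeighbours A x) col N′ ⟩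
  nonNeighbours A x + (col + N′) + 1                  ≡⟨ cong (λ z → nonNeighbours A x + (z + N′) + 1)
      (sum-cong n λ i → cong (𝟙 ∘ not) (A-sym x (punchIn x i))) ⟩
  nonNeighbours A x + (sumFin n (λ i → 𝟙 (not (A (punchIn x i) x))) + N′) + 1
    ≡⟨ cong (λ z → nonNeighbours A x + z + 1) (sum-+ n _ _) ⟨
  nonNeighbours A x + sumFin n (λ i → 𝟙 (not (A (punchIn x i) x)) + sumFin n (λ j → 𝟙 (not (A (punchIn x i) (punchIn x j))))) + 1
    ≡⟨ cong (λ z → nonNeighbours A x + z + 1) (sum-cong n λ i → sum-remove n (λ y → 𝟙 (not (A (punchIn x i) y))) x) ⟨
  nonNeighbours A x + sumFin n (λ i → nonNeighbours A (punchIn x i)) + 1 ≡⟨ cong (_+ 1) (sum-remove n (nonNeighbours A) x) ⟨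
  nonEdges A + 1                                      ∎
  where
  open ≤-Reasoning
  N′ = nonEdges (λ i j → A (punchIn x i) (punchIn x j))
  col = sumFin n (λ i → 𝟙 (not (A x (punchIn x i))))
  e₁ : ∀ a b → a + 2 * b ≡ b + (b + a)
  e₁ = solve-∀
  e₂ : ∀ a b c → a + (1 + b + c) ≡ a + (b + c) + 1
  e₂ = solve-∀

-- In terms of non-neighbours, minimum degree at least (1 - 1/r + 1/(r(E+1))) n.
HighDegree : ∀ {n} → ℕ → ℕ → (Fin n → Fin n → Bool) → Set
HighDegree {n} E r A = ∀ x → suc E * r * nonNeighbours A x ≤ E * n

middle≤ : ∀ a b c → b ≤ a + b + c
middle≤ a b c = ≤-trans (m≤n+m b a) (m≤m+n _ c)

-- Vertices with too many non-neighbours are deleted one at a time. Each deletion lowers the left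
-- side of the hypothesis at least as much as the right side, so the hypothesis survives; its term
-- linear in `n` pays for the diagonal pair. The term `K` keeps the final `q` large.
core : ∀ E r K → 1 ≤ K → ∀ n (A : Fin n → Fin n → Bool) → Symmetric A →
  suc E * r * nonEdges A + K + suc E * r * n ≤ E * (n * n) →
  Σ ℕ λ q → Σ (Fin q → Fin n) λ ι → Inj ι × K ≤ E * (q * q) × HighDegree E r (λ x y → A (ι x) (ι y))
core E r K K≥1 zero A A-sym h = ⊥-elim (<⇒≱ K≥1 (≤-trans (middle≤ (suc E * r * nonEdges A) K (suc E * r * 0))
  (≤-trans h (≤-reflexive (*-zeroʳ E)))))
core E r K K≥1 (suc n) A A-sym h
  with Finₚ.all? (λ x → suc E * r * nonNeighbours A x ≤? E * suc n)
... | yes high = suc n , id , id , ≤-trans (middle≤ (suc E * r * nonEdges A) K (suc E * r * suc n)) h , high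
... | no ¬high with Finₚ.¬∀⟶∃¬ (suc n) _ (λ x → suc E * r * nonNeighbours A x ≤? E * suc n) ¬high
...   | x , low = extend (core E r K K≥1 n A′ (λ i j → A-sym _ _) smaller)
  where
  open ≤-Reasoning
  A′ : Fin n → Fin n → Bool
  A′ i j = A (punchIn x i) (punchIn x j)
  c = suc E * r
  extend : (Σ ℕ λ q → Σ (Fin q → Fin n) λ ι → Inj ι × K ≤ E * (q * q) × HighDegree E r (λ x y → A′ (ι x) (ι y))) →
    Σ ℕ λ q → Σ (Fin q → Fin (suc n)) λ ι → Inj ι × K ≤ E * (q * q) × HighDegree E r (λ x y → A (ι x) (ι y))
  extend (q , ι , ι-inj , K≤ , high) = q , punchIn x ∘ ι , (λ e → ι-inj (Finₚ.punchIn-injective x _ _ e)) , K≤ , high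
  smaller : c * nonEdges A′ + K + c * n ≤ E * (n * n)
  smaller = +-cancelʳ-≤ (2 * (E * suc n)) _ _ (begin
    c * nonEdges A′ + K + c * n + 2 * (E * suc n)     ≤⟨ +-monoʳ-≤ (c * nonEdges A′ + K + c * n) (*-monoʳ-≤ 2 (<⇒≤ (≰⇒> low))) ⟩
    c * nonEdges A′ + K + c * n + 2 * (c * nonNeighbours A x) ≡⟨ e₁ c (nonEdges A′) K n (nonNeighbours A x) ⟩
    c * (nonEdges A′ + 2 * nonNeighbours A x) + K + c * n ≤⟨ +-monoˡ-≤ (c * n) (+-monoˡ-≤ K (*-monoʳ-≤ c (nonEdges-remove A A-sym x))) ⟩
    c * (nonEdges A + 1) + K + c * n                  ≡⟨ e₂ c (nonEdges A) K n ⟩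
    c * nonEdges A + K + c * suc n                    ≤⟨ h ⟩
    E * (suc n * suc n)                               ≤⟨ m≤m+n _ E ⟩
    E * (suc n * suc n) + E                           ≡⟨ e₃ E n ⟩
    E * (n * n) + 2 * (E * suc n)                     ∎)
    where
    e₁ : ∀ c N K n d → c * N + K + c * n + 2 * (c * d) ≡ c * (N + 2 * d) + K + c * n
    e₁ = solve-∀
    e₂ : ∀ c N K n → c * (N + 1) + K + c * n ≡ c * N + K + c * (1 + n)
    e₂ = solve-∀
    e₃ : ∀ E n → E * ((1 + n) * (1 + n)) + E ≡ E * (n * n) + 2 * (E * (1 + n))
    e₃ = solve-∀

-- For an irreflexive `A` different classes are disjoint, which is how `vertex-inj` separates them.
Multipartite : ∀ {n} → (Fin n → Fin n → Bool) → ℕ → ℕ → Set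
Multipartite {n} A j t = Σ (Fin j → Fin t → Fin n) λ φ → (∀ a → Inj (φ a)) ×
  (∀ a b → a ≢ b → ∀ i l → A (φ a i) (φ b l) ≡ true)

module Step {n} (E r : ℕ) (r≥1 : 1 ≤ r) (A : Fin n → Fin n → Bool) (A-sym : Symmetric A)
  (high : HighDegree E r A) (j : ℕ) (j≤r : j ≤ r) (t : ℕ) (t≥1 : 1 ≤ t)
  (φ : Fin j → Fin (t + suc (2 * E) * t) → Fin n) (φ-inj : ∀ a → Inj (φ a))
  (φ-adj : ∀ a b → a ≢ b → ∀ i l → A (φ a i) (φ b l) ≡ true) where

  open ≤-Reasoning
  -- A vertex with fewer than `t` neighbours in some old class of size `s` misses at least `s′`
  -- vertices there. Over all vertices there are at most s E n / (E + 1) missing pairs, so with s =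
  -- 2(E + 1)t and s′ = (2E + 1)t at least n / (2E + 1) vertices are not poor.
  s′ = suc (2 * E) * t
  s = t + s′

  d : Fin j → Fin n → ℕ
  d a z = count s (λ i → A (φ a i) z)

  missing : Fin j → Fin n → ℕ
  missing a z = count s (λ i → not (A (φ a i) z))

  poor : Fin n → Bool
  poor z = anyFin j (λ a → not (t ≤ᵇ d a z))

  poor≤ : ∀ z → 𝟙 (poor z) * s′ ≤ sumFin j (λ a → missing a z)
  poor≤ z with poor z in eq
  ... | false = z≤n
  ... | true with anyFin⁻ j _ eq
  ...   | a , few = ≤-trans (≤-reflexive (+-identityʳ s′)) (≤-trans (+-cancelˡ-≤ t _ _ (begin
    t + s′                       ≡⟨ count-not s _ ⟨
    d a z + missing a z          ≤⟨ +-monoˡ-≤ (missing a z) (<⇒≤ (≤ᵇ-false {t} {d a z} (not-true few))) ⟩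
    t + missing a z              ∎)) (term≤sum j (λ a → missing a z) a))

  total : suc E * (count n poor * s′) ≤ s * (E * n)
  total = *-cancel-≤ r r≥1 (begin
    r * (suc E * (count n poor * s′))          ≡⟨ e₁ r (suc E) _ ⟩
    suc E * r * (count n poor * s′)            ≡⟨ cong (suc E * r *_) (sum-*ʳ n s′ _) ⟨
    suc E * r * sumFin n (λ z → 𝟙 (poor z) * s′) ≤⟨ *-monoʳ-≤ (suc E * r) (sum-mono n poor≤) ⟩
    suc E * r * ∑∑ n j (λ z a → missing a z)   ≡⟨ cong (suc E * r *_) (trans (sum-swap n j _) (sum-cong j λ a → sum-swap n s _)) ⟩
    suc E * r * ∑∑ j s (λ a i → nonNeighbours A (φ a i)) ≡⟨ ∑∑-*ˡ j s (suc E * r) _ ⟨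
    ∑∑ j s (λ a i → suc E * r * nonNeighbours A (φ a i)) ≤⟨ sum-≤-const j (s * (E * n)) (λ a → sum-≤-const s (E * n) λ i → high (φ a i)) ⟩
    j * (s * (E * n))                          ≤⟨ *-monoˡ-≤ (s * (E * n)) j≤r ⟩
    r * (s * (E * n))                          ∎)
    where
    e₁ : ∀ r E b → r * (E * b) ≡ E * r * b
    e₁ = solve-∀

  poor-few : suc (2 * E) * count n poor ≤ 2 * E * n
  poor-few = *-cancel-≤ (suc E * t) (*-mono-≤ {1} {suc E} (s≤s z≤n) t≥1) (begin
    suc E * t * (suc (2 * E) * count n poor)   ≡⟨ e₁ E t (count n poor) ⟩
    suc E * (count n poor * s′)                ≤⟨ total ⟩
    s * (E * n)                                ≡⟨ e₂ E t n ⟩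
    suc E * t * (2 * E * n)                    ∎)
    where
    e₁ : ∀ E t b → (1 + E) * t * ((1 + 2 * E) * b) ≡ (1 + E) * (b * ((1 + 2 * E) * t))
    e₁ = solve-∀
    e₂ : ∀ E t n → (t + (1 + 2 * E) * t) * (E * n) ≡ (1 + E) * t * (2 * E * n)
    e₂ = solve-∀

  rich-many : n ≤ suc (2 * E) * count n (not ∘ poor)
  rich-many = +-cancelʳ-≤ (2 * E * n) _ _ (begin
    suc (2 * E) * n                            ≡⟨ cong (suc (2 * E) *_) (count-not n poor) ⟨
    suc (2 * E) * (count n poor + count n (not ∘ poor)) ≡⟨ e₁ (suc (2 * E)) (count n poor) _ ⟩
    suc (2 * E) * count n (not ∘ poor) + suc (2 * E) * count n poor ≤⟨ +-monoʳ-≤ (suc (2 * E) * count n (not ∘ poor)) poor-few ⟩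
    suc (2 * E) * count n (not ∘ poor) + 2 * E * n ∎)
    where
    e₁ : ∀ c a b → c * (a + b) ≡ c * b + c * a
    e₁ = solve-∀

  f : Fin (j * s) → Fin n → Bool
  f l z = A (φ (proj₁ (remQuot {j} s l)) (proj₂ (remQuot {j} s l))) z

  refined = refine n (j * s) f (not ∘ poor)
  q = proj₁ refined

  -- Vertices that are not poor and have identical neighbourhoods in the old classes form the new
  -- class; each old class shrinks to `t` of their common neighbours.
  extend : suc (2 * E) * 2 ^ (j * s) * t ≤ n → Multipartite A (suc j) t
  extend n-large = φ′ , φ′-inj , φ′-adj
    where
    picked = pick n q t (large (suc (2 * E) * 2 ^ (j * s)) t (*-mono-≤ {1} {suc (2 * E)} (s≤s z≤n) (1≤2^ (j * s))) n-large
      (≤-trans rich-many (≤-trans (*-monoʳ-≤ (suc (2 * E)) (proj₂ (proj₂ (proj₂ refined))))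
        (≤-reflexive (sym (*-assoc (suc (2 * E)) (2 ^ (j * s)) _))))))
    ζ = proj₁ picked
    ζ∈q = proj₂ (proj₂ picked)
    z₀ = ζ (first t≥1)
    rich : ∀ a → t ≤ d a z₀
    rich a = ≤ᵇ-true (¬false⇒true λ eq →
      true≢false (anyFin⁺ j _ a (false-not eq)) (not-true (proj₁ (proj₂ refined) z₀ (ζ∈q (first t≥1)))))
    nbrs : ∀ a → Σ (Fin t → Fin s) λ σ → Inj σ × (∀ i → A (φ a (σ i)) z₀ ≡ true)
    nbrs a = pick s (λ i → A (φ a i) z₀) t (rich a)
    φ′ : Fin (suc j) → Fin t → Fin n
    φ′ zero    = ζ
    φ′ (suc a) = φ a ∘ proj₁ (nbrs a)
    φ′-inj : ∀ a → Inj (φ′ a)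
    φ′-inj zero    = proj₁ (proj₂ picked)
    φ′-inj (suc a) e = proj₁ (proj₂ (nbrs a)) (φ-inj a e)
    joined : ∀ a i l → A (φ′ (suc a) i) (ζ l) ≡ true
    joined a i l = trans (subst (λ (z : Fin j × Fin s) → A (φ (proj₁ z) (proj₂ z)) (ζ l) ≡ A (φ (proj₁ z) (proj₂ z)) z₀)
      (Finₚ.remQuot-combine {j} {s} a (proj₁ (nbrs a) i))
      (proj₁ (proj₂ (proj₂ refined)) (combine a (proj₁ (nbrs a) i)) (ζ l) z₀ (ζ∈q l) (ζ∈q _)))
      (proj₂ (proj₂ (nbrs a)) i)
    φ′-adj : ∀ a b → a ≢ b → ∀ i l → A (φ′ a i) (φ′ b l) ≡ true
    φ′-adj zero    zero    a≢b i l = ⊥-elim (a≢b refl)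
    φ′-adj zero    (suc b) a≢b i l = trans (A-sym _ _) (joined b l i)
    φ′-adj (suc a) zero    a≢b i l = joined a i l
    φ′-adj (suc a) (suc b) a≢b i l = φ-adj a b (a≢b ∘ cong suc) _ _

multipartite : ∀ E r → 1 ≤ r → ∀ j → j ≤ suc r → ∀ t → 1 ≤ t → Σ ℕ λ N → ∀ n → N ≤ n →
  (A : Fin n → Fin n → Bool) → Symmetric A → HighDegree E r A → Multipartite A j t
multipartite E r r≥1 zero    j≤ t t≥1 = 0 , λ n _ A _ _ → (λ ()) , (λ ()) , λ ()
multipartite E r r≥1 (suc j) j≤ t t≥1
  with multipartite E r r≥1 j (≤-trans (n≤1+n j) j≤) (t + suc (2 * E) * t) (≤-trans t≥1 (m≤m+n t _))
... | N , ih = N + N′ , grow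
  where
  N′ = suc (2 * E) * 2 ^ (j * (t + suc (2 * E) * t)) * t
  grow : ∀ n → N + N′ ≤ n → (A : Fin n → Fin n → Bool) → Symmetric A → HighDegree E r A → Multipartite A (suc j) t
  grow n N≤n A A-sym high with ih n (≤-trans (m≤m+n N N′) N≤n) A A-sym high
  ... | φ , φ-inj , φ-adj =
    Step.extend E r r≥1 A A-sym high j (s≤s⁻¹ j≤) t t≥1 φ φ-inj φ-adj (≤-trans (m≤n+m N′ N) N≤n)

square-≤ : ∀ {a b} → a * a ≤ b * b → a ≤ b
square-≤ {a} {b} h with a ≤? b
... | yes p = p
... | no  p = ⊥-elim (<⇒≱ (*-mono-< (≰⇒> p) (≰⇒> p)) h)

-- Divided by (e + 1)(r + 1), the hypothesis asks for at least (1 - 1 / (r + 1) + 1 / (e + 1))(n² -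
-- n) ordered edges.
erdős-stone : ∀ e r t → 1 ≤ t → Σ ℕ λ N → ∀ n → N ≤ n → (A : Fin n → Fin n → Bool) → Symmetric A →
  (suc e * r + suc r) * (n * n) ≤ suc e * suc r * edges A + (suc e * r + suc r) * n →
  Multipartite A (suc (suc r)) t
erdős-stone e′ r′ t t≥1 = suc (K + L) , proof
  where
  e = suc e′
  r = suc r′
  -- E + 1 = 2e: the minimum degree is asked to keep at most half of the surplus density 1 / e, and
  -- the rest absorbs the constant and linear terms in the hypothesis of `core`.
  E = suc (2 * e′)
  P = e * r′ + r
  multi = multipartite E r (s≤s z≤n) (suc r) ≤-refl t t≥1
  N₀ = suc (proj₁ multi)
  -- Chosen so that the bound returned by `core` yields q ≥ N₀.
  K = E * (N₀ * N₀)
  L = suc E * r + 2 * P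
  proof : ∀ n → suc (K + L) ≤ n → (A : Fin n → Fin n → Bool) → Symmetric A →
    P * (n * n) ≤ e * r * edges A + P * n → Multipartite A (suc r) t
  proof n N≤n A A-sym dense =
    let φ , φ-inj , φ-adj = proj₂ multi q (≤-trans (n≤1+n _) (square-≤ (*-cancelˡ-≤ E K≤))) (λ x y → A (ι x) (ι y)) (λ x y → A-sym _ _) high in
    (λ a i → ι (φ a i)) , (λ a h → φ-inj a (ι-inj h)) , φ-adj
    where
    open ≤-Reasoning
    NN = nonEdges A
    complement : edges A + NN ≡ n * n
    complement = trans (sym (sum-+ n _ _)) (trans (sum-cong n λ x → count-not n (A x)) (sum-const n n))
    quadratic : K + L * n ≤ n * n
    quadratic = begin
      K + L * n            ≤⟨ +-monoˡ-≤ (L * n) (≤-trans (≤-reflexive (sym (*-identityʳ K))) (*-monoʳ-≤ K (≤-trans (s≤s z≤n) N≤n))) ⟩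
      K * n + L * n        ≡⟨ *-distribʳ-+ n K L ⟨
      (K + L) * n          ≤⟨ *-monoˡ-≤ n (≤-trans (n≤1+n _) N≤n) ⟩
      n * n                ∎
    few : suc E * r * NN + K + suc E * r * n ≤ E * (n * n)
    few = +-cancelʳ-≤ (n * n + 2 * (e * r * edges A) + 2 * (P * n)) _ _ (begin
      suc E * r * NN + K + suc E * r * n + (n * n + 2 * (e * r * edges A) + 2 * (P * n))
        ≡⟨ e₁ e′ r P NN K n (edges A) ⟩
      2 * (e * r * (edges A + NN)) + n * n + (K + L * n)    ≤⟨ +-monoʳ-≤ (2 * (e * r * (edges A + NN)) + n * n) quadratic ⟩
      2 * (e * r * (edges A + NN)) + n * n + n * n          ≡⟨ cong (λ z → 2 * (e * r * z) + n * n + n * n) complement ⟩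
      2 * (e * r * (n * n)) + n * n + n * n                 ≤⟨ m≤m+n _ (2 * (r′ * (n * n))) ⟩
      2 * (e * r * (n * n)) + n * n + n * n + 2 * (r′ * (n * n)) ≡⟨ e₂ e′ r′ n ⟩
      E * (n * n) + n * n + 2 * (P * (n * n))               ≤⟨ +-monoʳ-≤ (E * (n * n) + n * n) (*-monoʳ-≤ 2 dense) ⟩
      E * (n * n) + n * n + 2 * (e * r * edges A + P * n)   ≡⟨ e₃ (E * (n * n)) (n * n) (e * r * edges A) (P * n) ⟩
      E * (n * n) + (n * n + 2 * (e * r * edges A) + 2 * (P * n)) ∎)
      where
      e₁ : ∀ e r P N K n M → (2 + 2 * e) * r * N + K + (2 + 2 * e) * r * n + (n * n + 2 * ((1 + e) * r * M) + 2 * (P * n))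
        ≡ 2 * ((1 + e) * r * (M + N)) + n * n + (K + ((2 + 2 * e) * r + 2 * P) * n)
      e₁ = solve-∀
      e₂ : ∀ e r n → 2 * ((1 + e) * (1 + r) * (n * n)) + n * n + n * n + 2 * (r * (n * n))
        ≡ (1 + 2 * e) * (n * n) + n * n + 2 * (((1 + e) * r + (1 + r)) * (n * n))
      e₂ = solve-∀
      e₃ : ∀ a b c d → a + b + 2 * (c + d) ≡ a + (b + 2 * c + 2 * d)
      e₃ = solve-∀
    core′ = core E r K (*-mono-≤ {1} {E} (s≤s z≤n) (*-mono-≤ {1} {N₀} {1} {N₀} (s≤s z≤n) (s≤s z≤n))) n A A-sym few
    q = proj₁ core′
    ι = proj₁ (proj₂ core′)
    ι-inj = λ {i} {j} → proj₁ (proj₂ (proj₂ core′)) {i} {j}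
    K≤ = proj₁ (proj₂ (proj₂ (proj₂ core′)))
    high = proj₂ (proj₂ (proj₂ (proj₂ core′)))

-- From a blow-up in the shadow to a Berge copy

shadow-irrefl : ∀ {n} (H : ThreeGraph n) x → shadow H x x ≡ true → ⊥
shadow-irrefl H x h = does-false (x Finₚ.≟ x) (not-true (proj₁ (∧-true {not (x ≟ᵇ x)} h))) refl

-- Choosing one vertex per block at random, the expected number of triples u, v, z for which the third
-- vertex of the hyperedge chosen for u v is the vertex chosen for z is at most k³ / b < 1.
module BlockSelection {k n r} (G : SimpleGraph k) (H : ThreeGraph n) (col : Fin k → Fin r)
  (proper : ∀ u v → Edge G u v → col u ≢ col v)
  (b′ : ℕ) (k³≤b′ : k * (k * k) ≤ b′) (φ : Fin r → Fin (k * suc b′) → Fin n) (φ-inj : ∀ a → Inj (φ a))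
  (φ-adj : ∀ a b → a ≢ b → ∀ i l → shadow H (φ a i) (φ b l) ≡ true) where

  b = suc b′

  -- Every class of the blow-up is cut into `k` blocks of size `b`, and `u` chooses inside block `u`
  -- of its class. Any choice thus gives an injective map.
  vertex : Fin k → Fin b → Fin n
  vertex u x = φ (col u) (combine u x)

  vertex-inj : ∀ {u v x y} → vertex u x ≡ vertex v y → combine u x ≡ combine v y
  vertex-inj {u} {v} {x} {y} e with col u Finₚ.≟ col v
  ... | yes eq = φ-inj (col u) (trans e (cong (λ a → φ a (combine v y)) (sym eq)))
  ... | no ne  = ⊥-elim (shadow-irrefl H (vertex u x) (subst (λ z → shadow H (vertex u x) z ≡ true) (sym e)
                   (φ-adj (col u) (col v) ne (combine u x) (combine v y))))

  w : Fin n → Fin n → Fin n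
  w x y = proj₁ (third H x y)

  bad : Fin k → Fin k → Fin k → (Fin k → Fin b) → Bool
  bad u v z c = (not (u ≟ᵇ z) ∧ not (v ≟ᵇ z)) ∧ (w (vertex u (c u)) (vertex v (c v)) ≟ᵇ vertex z (c z))

  bad⁻ : ∀ u v z c → bad u v z c ≡ true → u ≢ z × v ≢ z × w (vertex u (c u)) (vertex v (c v)) ≡ vertex z (c z)
  bad⁻ u v z c h =
    let h₁ , h₂ = ∧-true {not (u ≟ᵇ z) ∧ not (v ≟ᵇ z)} h
        h₃ , h₄ = ∧-true {not (u ≟ᵇ z)} h₁ in
    does-false (u Finₚ.≟ z) (not-true h₃) , does-false (v Finₚ.≟ z) (not-true h₄) , ≟ᵇ⇒≡ _ _ h₂

  bad⁺ : ∀ u v z c → z ≢ u → z ≢ v → vertex z (c z) ≡ w (vertex u (c u)) (vertex v (c v)) → bad u v z c ≡ true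
  bad⁺ u v z c z≢u z≢v e = true-∧ (true-∧ (false-not (≢⇒≟ᵇ u z (z≢u ∘ sym))) (false-not (≢⇒≟ᵇ v z (z≢v ∘ sym))))
    (≡⇒≟ᵇ (w (vertex u (c u)) (vertex v (c v))) (vertex z (c z)) (sym e))

  -- The choices for `u` and `v` fix the third vertex; as `z` differs from both, at most one choice
  -- for `z` hits it.
  bad-rare : ∀ u v z → b * sumFun k b (𝟙 ∘ bad u v z) ≤ b ^ k
  bad-rare u v z = sumFun-unique k b z (bad u v z) λ c c′ agree h h′ →
    let u≢z , v≢z , e = bad⁻ u v z c h
        _ , _ , e′ = bad⁻ u v z c′ h′ in
    Finₚ.combine-injectiveʳ z (c z) z (c′ z) (vertex-inj (trans (sym e) (trans
      (cong₂ (λ x y → w (vertex u x) (vertex v y)) (agree u u≢z) (agree v v≢z)) e′)))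

  badness : (Fin k → Fin b) → ℕ
  badness c = sumFin k λ u → sumFin k λ v → sumFin k λ z → 𝟙 (bad u v z c)

  badness≡0 : Σ (Fin k → Fin b) λ c → badness c ≡ 0
  badness≡0 = c , small (badness c) (*-cancel-≤ (b ^ k) (m^n>0 b k) (begin
    b ^ k * (b * badness c)                 ≡⟨ e₁ (b ^ k) b (badness c) ⟩
    b * (b ^ k * badness c)                 ≤⟨ *-monoʳ-≤ b (proj₂ choice) ⟩
    b * sumFun k b badness                  ≡⟨ cong (b *_) (trans (sumFun-sum k b k _) (sum-cong k λ u →
                                                 trans (sumFun-sum k b k _) (sum-cong k λ v → sumFun-sum k b k _))) ⟩
    b * ∑∑ k k (λ u v → sumFin k λ z → sumFun k b (𝟙 ∘ bad u v z)) ≡⟨ ∑∑-*ˡ k k b _ ⟨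
    ∑∑ k k (λ u v → b * sumFin k (λ z → sumFun k b (𝟙 ∘ bad u v z))) ≡⟨ ∑∑-cong k k (λ u v → sum-*ˡ k b _) ⟨
    ∑∑ k k (λ u v → sumFin k λ z → b * sumFun k b (𝟙 ∘ bad u v z))
      ≤⟨ sum-≤-const k (k * (k * b ^ k)) (λ u → sum-≤-const k (k * b ^ k) λ v → sum-≤-const k (b ^ k) (bad-rare u v)) ⟩
    k * (k * (k * b ^ k))                   ≡⟨ e₂ k (b ^ k) ⟩
    b ^ k * (k * (k * k))                   ∎))
    where
    open ≤-Reasoning
    choice = min≤sumFun k b′ badness
    c = proj₁ choice
    e₁ : ∀ x y z → x * (y * z) ≡ y * (x * z)
    e₁ = solve-∀
    e₂ : ∀ k x → k * (k * (k * x)) ≡ x * (k * (k * k))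
    e₂ = solve-∀
    small : ∀ x → b * x ≤ k * (k * k) → x ≡ 0
    small zero    _ = refl
    small (suc x) h = ⊥-elim (<⇒≱ (s≤s k³≤b′) (≤-trans (m≤m*n b (suc x)) h))

  selection : Σ (Fin k → Fin b) λ c → ∀ u v z → ¬ (bad u v z c ≡ true)
  selection = proj₁ badness≡0 , λ u v z h → 1+n≰n (≤-trans (≤-reflexive (cong 𝟙 (sym h)))
    (≤-trans (≤-trans (term≤sum k (λ z → 𝟙 (bad u v z (proj₁ badness≡0))) z)
      (≤-trans (term≤sum k (λ v → sumFin k λ z → 𝟙 (bad u v z (proj₁ badness≡0))) v)
        (term≤sum k (λ u → sumFin k λ v → sumFin k λ z → 𝟙 (bad u v z (proj₁ badness≡0))) u)))
      (≤-reflexive (proj₂ badness≡0))))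

  module Image (c : Fin k → Fin b) (never-bad : ∀ u v z → ¬ (bad u v z c ≡ true)) where
    img : Fin k → Fin n
    img u = vertex u (c u)

    img-inj : Inj img
    img-inj {u} {v} e = Finₚ.combine-injectiveˡ u (c u) v (c v) (vertex-inj e)

    Good : Fin k → Fin k → Fin (m H) → Set
    Good u v j = Edge G u v × Triple H (img u) (img v) (w (img u) (img v)) j

    -- Avoiding all bad triples keeps the third vertex away from the other images, so a chosen
    -- hyperedge determines the edge of `G` it was chosen for.
    only : ∀ {u v j} → Good u v j → ∀ z → H ∋ img z at j → z ≡ u ⊎ z ≡ v
    only {u} {v} (_ , _ , _ , _ , _ , _ , exact) z hz with exact (img z) hz
    ... | inj₁ e = inj₁ (img-inj e)
    ... | inj₂ (inj₁ e) = inj₂ (img-inj e)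
    ... | inj₂ (inj₂ e) with z Finₚ.≟ u | z Finₚ.≟ v
    ...   | yes p | _     = inj₁ p
    ...   | no _  | yes p = inj₂ p
    ...   | no p  | no p′ = ⊥-elim (never-bad u v z (bad⁺ u v z c p p′ e))

    determines : ∀ {u v u′ v′ j} → Good u v j → Good u′ v′ j → (u ≡ u′ × v ≡ v′) ⊎ (u ≡ v′ × v ≡ u′)
    determines {u} {v} {u′} {v′} g g′@(e′ , hu , hv , _) with only g u′ hu | only g v′ hv
    ... | inj₁ a | inj₁ b = ⊥-elim (edge-≢ G e′ (trans a (sym b)))
    ... | inj₁ a | inj₂ b = inj₁ (sym a , sym b)
    ... | inj₂ a | inj₁ b = inj₂ (sym b , sym a)
    ... | inj₂ a | inj₂ b = ⊥-elim (edge-≢ G e′ (trans a (sym b)))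

    embedding : ContainsBerge G H
    embedding = berge G H img img-inj Good
      (λ u v e → let j , t = proj₂ (third H (img u) (img v)) (φ-adj (col u) (col v) (proper u v e) _ _) in j , inj₁ (e , t))
      (λ { (_ , hu , hv , _) → hu , hv })
      determines

  berge-copy : ContainsBerge G H
  berge-copy = Image.embedding (proj₁ selection) (proj₂ selection)

dense-shadow : ∀ {k} (G : SimpleGraph k) → 1 ≤ k → ∀ r → Colorable G (suc (suc r)) → ∀ e →
  Σ ℕ λ N → ∀ n → N ≤ n → (H : ThreeGraph n) →
  (suc e * r + suc r) * (n * n) ≤ suc e * suc r * edges (shadow H) + (suc e * r + suc r) * n → ContainsBerge G H
dense-shadow {k} G k≥1 r (col , proper) e = proj₁ es , proof
  where
  -- One block for each of the `k` vertices of `G`, of size k³ + 1 so that the expected number of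
  -- bad triples is below 1.
  es = erdős-stone e r (k * suc (k * (k * k))) (*-mono-≤ {1} {k} {1} {suc (k * (k * k))} k≥1 (s≤s z≤n))
  proof : ∀ n → proj₁ es ≤ n → (H : ThreeGraph n) →
    (suc e * r + suc r) * (n * n) ≤ suc e * suc r * edges (shadow H) + (suc e * r + suc r) * n → ContainsBerge G H
  proof n N≤n H dense = BlockSelection.berge-copy G H col proper (k * (k * k)) ≤-refl
    (proj₁ multi) (proj₁ (proj₂ multi)) (proj₂ (proj₂ multi))
    where
    multi : Multipartite (shadow H) (suc (suc r)) (k * suc (k * (k * k)))
    multi = proj₂ es n N≤n (shadow H) (λ x y → bool-ext (shadow-sym H x y) (shadow-sym H y x)) dense

-- Constructions

-- The hyperedges of a `ThreeGraph` must be listed without repetition. Running through all subsets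
-- guarantees this, whereas a list of ordered triples would repeat sets.
enumerate : ∀ n (P : Subset n → Bool) → Σ ℕ λ m → Σ (Fin m → Subset n) λ e →
  Inj e × (∀ j → P (e j) ≡ true) × (∀ S → P S ≡ true → Σ (Fin m) λ j → e j ≡ S)
enumerate zero P with P [] in eq
... | true  = 1 , (λ _ → []) , (λ { {0F} {0F} _ → refl }) , (λ _ → eq) , λ { [] _ → 0F , refl }
... | false = 0 , (λ ()) , (λ { {()} }) , (λ ()) , λ { [] h → ⊥-elim (true≢false h eq) }
enumerate (suc n) P with enumerate n (P ∘ (true ∷_)) | enumerate n (P ∘ (false ∷_))
... | m₁ , e₁ , inj₁′ , ok₁ , all₁ | m₂ , e₂ , inj₂′ , ok₂ , all₂ =
  m₁ + m₂ , e , e-inj , (λ j → ok (splitAt m₁ j)) , all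
  where
  h : Fin m₁ ⊎ Fin m₂ → Subset (suc n)
  h (inj₁ j) = true ∷ e₁ j
  h (inj₂ j) = false ∷ e₂ j
  h-inj : ∀ a b → h a ≡ h b → a ≡ b
  h-inj (inj₁ _) (inj₁ _) eq = cong inj₁ (inj₁′ (Vecₚ.∷-injectiveʳ eq))
  h-inj (inj₂ _) (inj₂ _) eq = cong inj₂ (inj₂′ (Vecₚ.∷-injectiveʳ eq))
  h-inj (inj₁ _) (inj₂ _) ()
  h-inj (inj₂ _) (inj₁ _) ()
  ok : ∀ a → P (h a) ≡ true
  ok (inj₁ j) = ok₁ j
  ok (inj₂ j) = ok₂ j
  e : Fin (m₁ + m₂) → Subset (suc n)
  e j = h (splitAt m₁ j)
  e-inj : Inj e
  e-inj {i} {j} eq = trans (sym (Finₚ.join-splitAt m₁ m₂ i))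
    (trans (cong (Fin.join m₁ m₂) (h-inj _ _ eq)) (Finₚ.join-splitAt m₁ m₂ j))
  all : ∀ S → P S ≡ true → Σ (Fin (m₁ + m₂)) λ j → e j ≡ S
  all (true  ∷ S) p = let j , eq = all₁ S p in j ↑ˡ m₂ , trans (cong h (Finₚ.splitAt-↑ˡ m₁ j m₂)) (cong (true ∷_) eq)
  all (false ∷ S) p = let j , eq = all₂ S p in m₁ ↑ʳ j , trans (cong h (Finₚ.splitAt-↑ʳ m₁ m₂ j)) (cong (false ∷_) eq)

member : ∀ {n} (x y z : Fin n) → Fin n → Bool
member x y z v = (v ≟ᵇ x) ∨ ((v ≟ᵇ y) ∨ (v ≟ᵇ z))

⟪_,_,_⟫ : ∀ {n} (x y z : Fin n) → Subset n
⟪ x , y , z ⟫ = tabulate (member x y z)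

lookup-⟪⟫ : ∀ {n} (x y z v : Fin n) → lookup ⟪ x , y , z ⟫ v ≡ member x y z v
lookup-⟪⟫ x y z v = Vecₚ.lookup∘tabulate (member x y z) v

member⁻ : ∀ {n} (x y z v : Fin n) → member x y z v ≡ true → v ≡ x ⊎ (v ≡ y ⊎ v ≡ z)
member⁻ x y z v h with ∨-true {v ≟ᵇ x} h
... | inj₁ e = inj₁ (≟ᵇ⇒≡ v x e)
... | inj₂ h′ with ∨-true {v ≟ᵇ y} h′
...   | inj₁ e = inj₂ (inj₁ (≟ᵇ⇒≡ v y e))
...   | inj₂ e = inj₂ (inj₂ (≟ᵇ⇒≡ v z e))

member⁺ : ∀ {n} (x y z : Fin n) → member x y z x ≡ true × member x y z y ≡ true × member x y z z ≡ true
member⁺ x y z = ∨ˡ (≟ᵇ-refl x) , ∨ʳ (y ≟ᵇ x) (∨ˡ (≟ᵇ-refl y)) , ∨ʳ (z ≟ᵇ x) (∨ʳ (z ≟ᵇ y) (≟ᵇ-refl z))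
  where
  ∨ˡ : ∀ {a b} → a ≡ true → a ∨ b ≡ true
  ∨ˡ refl = refl
  ∨ʳ : ∀ a {b} → b ≡ true → a ∨ b ≡ true
  ∨ʳ a refl = Boolₚ.∨-zeroʳ a

card-⟪⟫ : ∀ {n} (x y z : Fin n) → x ≢ y → x ≢ z → y ≢ z → ∣ ⟪ x , y , z ⟫ ∣ ≡ 3
card-⟪⟫ {n} x y z x≢y x≢z y≢z = begin
  ∣ ⟪ x , y , z ⟫ ∣                   ≡⟨ card≡count ⟪ x , y , z ⟫ ⟩
  count n (lookup ⟪ x , y , z ⟫)      ≡⟨ sum-cong n (λ v → cong 𝟙 (lookup-⟪⟫ x y z v)) ⟩
  count n p                           ≡⟨ count-∖ n p x (proj₁ (member⁺ x y z)) ⟩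
  1 + count n (p ∖ x)                 ≡⟨ cong suc (count-∖ n (p ∖ x) y (true-∖ p x y (proj₁ (proj₂ (member⁺ x y z))) (x≢y ∘ sym))) ⟩
  2 + count n ((p ∖ x) ∖ y)           ≡⟨ cong (2 +_) (count-∖ n ((p ∖ x) ∖ y) z (true-∖ (p ∖ x) y z
                                           (true-∖ p x z (proj₂ (proj₂ (member⁺ x y z))) (x≢z ∘ sym)) (y≢z ∘ sym))) ⟩
  3 + count n (((p ∖ x) ∖ y) ∖ z)     ≡⟨ cong (3 +_) (sum-zero n empty) ⟩
  3                                   ∎
  where
  open ≡-Reasoning
  p = member x y z
  empty : ∀ v → 𝟙 ((((p ∖ x) ∖ y) ∖ z) v) ≡ 0
  empty v = cong 𝟙 (¬true⇒false λ h →
    let h₁ , v≢z = ∖-true ((p ∖ x) ∖ y) z v h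
        h₂ , v≢y = ∖-true (p ∖ x) y v h₁
        h₃ , v≢x = ∖-true p x v h₂ in
    [ v≢x , [ v≢y , v≢z ]′ ]′ (member⁻ x y z v h₃))

-- `T` speaks of ordered triples and may be asymmetric: a set is a hyperedge when at least one of
-- its orderings satisfies `T`.
record Triples {n} (T : Fin n → Fin n → Fin n → Bool) : Set where
  field
    H     : ThreeGraph n
    sound : ∀ j → Σ (Fin n) λ x → Σ (Fin n) λ y → Σ (Fin n) λ z → T x y z ≡ true × edge H j ≡ ⟪ x , y , z ⟫
    complete : ∀ x y z → T x y z ≡ true → Σ (Fin (m H)) λ j → edge H j ≡ ⟪ x , y , z ⟫

  ∋⇒ : ∀ {j x y z v} → edge H j ≡ ⟪ x , y , z ⟫ → H ∋ v at j → v ≡ x ⊎ (v ≡ y ⊎ v ≡ z)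
  ∋⇒ {j} {x} {y} {z} {v} e h = member⁻ x y z v (trans (sym (lookup-⟪⟫ x y z v)) (subst (λ S → lookup S v ≡ true) e h))

  ⇒∋ : ∀ {j x y z} → edge H j ≡ ⟪ x , y , z ⟫ → (H ∋ x at j) × (H ∋ y at j) × (H ∋ z at j)
  ⇒∋ {j} {x} {y} {z} e = let a , b , c = member⁺ x y z in at x a , at y b , at z c
    where
    at : ∀ v → member x y z v ≡ true → H ∋ v at j
    at v h = subst (λ S → lookup S v ≡ true) (sym e) (trans (lookup-⟪⟫ x y z v) h)

  shadow-⟪⟫ : ∀ x y z → x ≢ y → T x y z ≡ true ⊎ (T y x z ≡ true ⊎ (T x z y ≡ true ⊎ T z x y ≡ true)) → shadow H x y ≡ true
  shadow-⟪⟫ x y z x≢y t = true-∧ (false-not (≢⇒≟ᵇ x y x≢y)) (go t)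
    where
    via : ∀ j → H ∋ x at j → H ∋ y at j → shadowAdj H x y ≡ true
    via j hx hy = anyFin⁺ (m H) _ j (true-∧ hx hy)
    go : T x y z ≡ true ⊎ (T y x z ≡ true ⊎ (T x z y ≡ true ⊎ T z x y ≡ true)) → shadowAdj H x y ≡ true
    go (inj₁ t) = let j , e = complete x y z t ; a , b , _ = ⇒∋ e in via j a b
    go (inj₂ (inj₁ t)) = let j , e = complete y x z t ; a , b , _ = ⇒∋ e in via j b a
    go (inj₂ (inj₂ (inj₁ t))) = let j , e = complete x z y t ; a , _ , b = ⇒∋ e in via j a b
    go (inj₂ (inj₂ (inj₂ t))) = let j , e = complete z x y t ; _ , a , b = ⇒∋ e in via j a b

triples : ∀ {n} (T : Fin n → Fin n → Fin n → Bool) →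
  (∀ x y z → T x y z ≡ true → x ≢ y × x ≢ z × y ≢ z) → Triples T
triples {n} T distinct₃ = record
  { H = record { m = proj₁ list ; edge = e ; distinct = proj₁ (proj₂ (proj₂ list)) ; uniform = size }
  ; sound = found
  ; complete = λ x y z t → proj₂ (proj₂ (proj₂ (proj₂ list))) ⟪ x , y , z ⟫ (true-does (is? ⟪ x , y , z ⟫) (x , y , z , t , refl)) }
  where
  Is : Subset n → Set
  Is S = Σ (Fin n) λ x → Σ (Fin n) λ y → Σ (Fin n) λ z → T x y z ≡ true × S ≡ ⟪ x , y , z ⟫
  is? : ∀ S → Dec (Is S)
  is? S = Finₚ.any? λ x → Finₚ.any? λ y → Finₚ.any? λ z →
    (T x y z Boolₚ.≟ true) ×-dec (Vecₚ.≡-dec Boolₚ._≟_ S ⟪ x , y , z ⟫)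
  list = enumerate n (λ S → does (is? S))
  e = proj₁ (proj₂ list)
  found : ∀ j → Is (e j)
  found j = does-true (is? (e j)) (proj₁ (proj₂ (proj₂ (proj₂ list))) j)
  size : ∀ j → ∣ e j ∣ ≡ 3
  size j with found j
  ... | x , y , z , t , eq = let a , b , c = distinct₃ x y z t in trans (cong ∣_∣ eq) (card-⟪⟫ x y z a b c)

-- Rainbow triples: the multipartite construction and the triples through one vertex

module Rainbow {n r} (col : Fin n → Fin r) where

  T : Fin n → Fin n → Fin n → Bool
  T x y z = not (col x ≟ᵇ col y) ∧ (not (col x ≟ᵇ col z) ∧ not (col y ≟ᵇ col z))

  T⁻ : ∀ x y z → T x y z ≡ true → col x ≢ col y × col x ≢ col z × col y ≢ col z
  T⁻ x y z t =
    let a , t′ = ∧-true {not (col x ≟ᵇ col y)} t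
        b , c = ∧-true {not (col x ≟ᵇ col z)} t′ in
    does-false (col x Finₚ.≟ col y) (not-true a) , does-false (col x Finₚ.≟ col z) (not-true b) ,
    does-false (col y Finₚ.≟ col z) (not-true c)

  T⁺ : ∀ x y z → col x ≢ col y → col x ≢ col z → col y ≢ col z → T x y z ≡ true
  T⁺ x y z a b c = true-∧ (false-not (≢⇒≟ᵇ (col x) (col y) a))
    (true-∧ (false-not (≢⇒≟ᵇ (col x) (col z) b)) (false-not (≢⇒≟ᵇ (col y) (col z) c)))

  -- The complete 3-graph over the colour classes. Equal classes give the chromatic construction;
  -- three classes, one of them a single vertex, give all triples {x₀, a, b}.
  rainbow : Triples T
  rainbow = triples T λ x y z t → let a , b , c = T⁻ x y z t in a ∘ cong col , b ∘ cong col , c ∘ cong col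

  open Triples rainbow public

  edge-colors : ∀ j x y → H ∋ x at j → H ∋ y at j → x ≢ y → col x ≢ col y
  edge-colors j x y hx hy x≢y with sound j
  ... | a , b , c , t , e with T⁻ a b c t | ∋⇒ e hx | ∋⇒ e hy
  ... | ab , ac , bc | inj₁ refl        | inj₁ refl        = ⊥-elim (x≢y refl)
  ... | ab , ac , bc | inj₁ refl        | inj₂ (inj₁ refl) = ab
  ... | ab , ac , bc | inj₁ refl        | inj₂ (inj₂ refl) = ac
  ... | ab , ac , bc | inj₂ (inj₁ refl) | inj₁ refl        = ab ∘ sym
  ... | ab , ac , bc | inj₂ (inj₁ refl) | inj₂ (inj₁ refl) = ⊥-elim (x≢y refl)
  ... | ab , ac , bc | inj₂ (inj₁ refl) | inj₂ (inj₂ refl) = bc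
  ... | ab , ac , bc | inj₂ (inj₂ refl) | inj₁ refl        = ac ∘ sym
  ... | ab , ac , bc | inj₂ (inj₂ refl) | inj₂ (inj₁ refl) = bc ∘ sym
  ... | ab , ac , bc | inj₂ (inj₂ refl) | inj₂ (inj₂ refl) = ⊥-elim (x≢y refl)

  colors-differ : ∀ {k} (G : SimpleGraph k) (B : ContainsBerge G H) → ∀ u v → Edge G u v →
    col (proj₁ B u) ≢ col (proj₁ B v)
  colors-differ G (i , i-inj , f , _ , _ , ok) u v e =
    edge-colors (f u v e) (i u) (i v) (proj₁ (ok u v e)) (proj₂ (ok u v e)) (edge-≢ G e ∘ i-inj)

  shadow-rainbow : (∀ a b → Σ (Fin n) λ z → a ≢ col z × b ≢ col z) → ∀ x y → col x ≢ col y → shadow H x y ≡ true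
  shadow-rainbow other x y ne = let z , a , b = other (col x) (col y) in
    shadow-⟪⟫ x y z (ne ∘ cong col) (inj₁ (T⁺ x y z ne a b))

  edges-rainbow : (∀ a b → Σ (Fin n) λ z → a ≢ col z × b ≢ col z) →
    ∑∑ n n (λ x y → 𝟙 (not (col x ≟ᵇ col y))) ≤ edges (shadow H)
  edges-rainbow other = ∑∑-mono n n λ x y → 𝟙-⇒ λ h →
    shadow-rainbow other x y (does-false (col x Finₚ.≟ col y) (not-true h))

quotient-combine : ∀ {m n} (i : Fin m) (j : Fin n) → quotient {m} n (combine i j) ≡ i
quotient-combine i j = cong proj₁ (Finₚ.remQuot-combine i j)

remainder-combine : ∀ {m n} (i : Fin m) (j : Fin n) → remainder {m} n (combine i j) ≡ j
remainder-combine i j = cong proj₂ (Finₚ.remQuot-combine i j)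

quotient-class : ∀ r p (a : Fin r) → count (r * p) (λ y → a ≟ᵇ quotient {r} p y) ≡ p
quotient-class r p a = begin
  sumFin (r * p) (λ y → 𝟙 (a ≟ᵇ quotient {r} p y))              ≡⟨ sum-combine r p (λ y → 𝟙 (a ≟ᵇ quotient {r} p y)) ⟩
  ∑∑ r p (λ b j → 𝟙 (a ≟ᵇ quotient {r} p (combine b j)))        ≡⟨ ∑∑-cong r p (λ b j → cong (λ z → 𝟙 (a ≟ᵇ z)) (quotient-combine b j)) ⟩
  ∑∑ r p (λ b j → 𝟙 (a ≟ᵇ b))                                   ≡⟨ sum-cong r (λ b → sum-const p (𝟙 (a ≟ᵇ b))) ⟩
  sumFin r (λ b → p * 𝟙 (a ≟ᵇ b))                               ≡⟨ sum-*ˡ r p (λ b → 𝟙 (a ≟ᵇ b)) ⟩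
  p * sumFin r (λ b → 𝟙 (a ≟ᵇ b))                               ≡⟨ cong (p *_) (sum-≟′ r a) ⟩
  p * 1                                                         ≡⟨ *-identityʳ p ⟩
  p                                                             ∎
  where open ≡-Reasoning

turán-edges : ∀ r p → r * p * p + ∑∑ (r * p) (r * p) (λ x y → 𝟙 (not (quotient {r} p x ≟ᵇ quotient {r} p y))) ≡ r * p * (r * p)
turán-edges r p = begin
  n * p + ∑∑ n n (λ x y → 𝟙 (not (E x y)))                     ≡⟨ cong (_+ ∑∑ n n (λ x y → 𝟙 (not (E x y)))) (sum-const n p) ⟨
  sumFin n (λ _ → p) + ∑∑ n n (λ x y → 𝟙 (not (E x y)))        ≡⟨ cong (_+ ∑∑ n n (λ x y → 𝟙 (not (E x y)))) (sum-cong n λ x → quotient-class r p (quotient {r} p x)) ⟨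
  ∑∑ n n (λ x y → 𝟙 (E x y)) + ∑∑ n n (λ x y → 𝟙 (not (E x y))) ≡⟨ sum-+ n (λ x → count n (E x)) (λ x → count n (not ∘ E x)) ⟨
  sumFin n (λ x → count n (E x) + count n (not ∘ E x))         ≡⟨ sum-cong n (λ x → count-not n (E x)) ⟩
  sumFin n (λ _ → n)                                           ≡⟨ sum-const n n ⟩
  n * n                                                        ∎
  where
  open ≡-Reasoning
  n = r * p
  E : Fin n → Fin n → Bool
  E x y = quotient {r} p x ≟ᵇ quotient {r} p y

other-color : ∀ r (a b : Fin (3 + r)) → Σ (Fin (3 + r)) λ c → a ≢ c × b ≢ c
other-color r a b = let σ , _ , ok = avoid 1 2 (3 + r) (_↑ˡ r) (λ { zero → a ; (suc _) → b }) (λ {i} {j} → Finₚ.↑ˡ-injective r i j) in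
  σ 0F ↑ˡ r , (λ e → ok 0F 0F (sym e)) , (λ e → ok 0F 1F (sym e))

-- The bound is (r + 1) |∂H| ≥ r C(n, 2), doubled and without subtraction.
LowerBound : ∀ {k} → SimpleGraph k → ℕ → Set
LowerBound G r = ∀ N → Σ ℕ λ n → N ≤ n × Σ (ThreeGraph n) λ H → BergeFree G H ×
  r * (n * n) ≤ suc r * edges (shadow H) + r * n

lower-chromatic : ∀ {k} (G : SimpleGraph k) d → ¬ Colorable G (3 + d) → LowerBound G (2 + d)
lower-chromatic G d not-colorable N = n , N≤n , H , free , bound
  where
  r = 3 + d
  p = suc N
  n = r * p
  col : Fin n → Fin r
  col = quotient p
  open Rainbow col
  N≤n : N ≤ n
  N≤n = ≤-trans (n≤1+n N) (m≤m+n p _)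
  free : BergeFree G H
  free B = not-colorable (col ∘ proj₁ B , colors-differ G B)
  other : ∀ a b → Σ (Fin n) λ z → a ≢ col z × b ≢ col z
  other a b = let c , a≢c , b≢c = other-color d a b
                  e = quotient-combine {r} {p} c zero in
    combine c zero , (λ eq → a≢c (trans eq e)) , (λ eq → b≢c (trans eq e))
  open ≤-Reasoning
  bound : (2 + d) * (n * n) ≤ r * edges (shadow H) + (2 + d) * n
  bound = ≤-trans (+-cancelˡ-≤ (n * n) _ _ (begin
    n * n + (2 + d) * (n * n)                  ≡⟨⟩
    r * (n * n)                                ≡⟨ cong (r *_) (turán-edges r p) ⟨
    r * (n * p + D)                            ≡⟨ e₁ r n p D ⟩
    n * (r * p) + r * D                        ≤⟨ +-monoʳ-≤ (n * n) (*-monoʳ-≤ r (edges-rainbow other)) ⟩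
    n * n + r * edges (shadow H)               ∎)) (m≤m+n _ _)
    where
    D = ∑∑ n n (λ x y → 𝟙 (not (col x ≟ᵇ col y)))
    e₁ : ∀ r n p D → r * (n * p + D) ≡ n * (r * p) + r * D
    e₁ = solve-∀

Apex : ∀ {k} → SimpleGraph k → Set
Apex {k} G = Σ (Fin k) λ x → Σ (Fin k → Bool) λ side → ∀ u v → u ≢ x → v ≢ x → Edge G u v → side u ≢ side v

module ApexConstruction (p : ℕ) (j₀ : Fin p) where

  n : ℕ
  n = suc (2 * p)

  col : Fin n → Fin 3
  col zero    = zero
  col (suc i) = suc (quotient {2} p i)

  open Rainbow col

  -- Deleting the vertex of `G` that lies on the centre leaves a graph 2-coloured by the other two
  -- classes. If no vertex lies there, any vertex, here `u₀`, can be deleted instead.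
  free : ∀ {k} (G : SimpleGraph k) → Fin k → ¬ Apex G → BergeFree G H
  free {k} G u₀ no-apex B@(i , i-inj , _) = split (Finₚ.any? λ u → i u Finₚ.≟ zero)
    where
    side : Fin k → Bool
    side u = col (i u) ≟ᵇ 1F
    two : ∀ (a b : Fin 3) → a ≢ 0F → b ≢ 0F → (a ≟ᵇ 1F) ≡ (b ≟ᵇ 1F) → a ≡ b
    two 0F _  a≢0 _ _ = ⊥-elim (a≢0 refl)
    two _  0F _ b≢0 _ = ⊥-elim (b≢0 refl)
    two 1F 1F _ _ _ = refl
    two 2F 2F _ _ _ = refl
    col≢0 : ∀ (x : Fin n) → x ≢ zero → col x ≢ 0F
    col≢0 zero ne _ = ne refl
    side-ok : ∀ u v → i u ≢ zero → i v ≢ zero → Edge G u v → side u ≢ side v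
    side-ok u v iu iv e eq = colors-differ G B u v e (two _ _ (col≢0 (i u) iu) (col≢0 (i v) iv) eq)
    split : Dec (Σ (Fin k) λ u → i u ≡ zero) → ⊥
    split (yes (x , ix)) = no-apex (x , side , λ u v u≢x v≢x →
      side-ok u v (λ e → u≢x (i-inj (trans e (sym ix)))) (λ e → v≢x (i-inj (trans e (sym ix)))))
    split (no none) = no-apex (u₀ , side , λ u v _ _ → side-ok u v (λ e → none (u , e)) (λ e → none (v , e)))

  other : ∀ a b → Σ (Fin n) λ z → a ≢ col z × b ≢ col z
  other a b = realise (other-color 0 a b)
    where
    realise : (Σ (Fin 3) λ c → a ≢ c × b ≢ c) → Σ (Fin n) λ z → a ≢ col z × b ≢ col z
    realise (zero  , a≢c , b≢c) = zero , a≢c , b≢c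
    realise (suc c , a≢c , b≢c) = suc (combine c j₀) , (λ eq → a≢c (trans eq e)) , (λ eq → b≢c (trans eq e))
      where e = cong Fin.suc (quotient-combine {2} {p} c j₀)

  D = ∑∑ (2 * p) (2 * p) (λ x y → 𝟙 (not (quotient {2} p x ≟ᵇ quotient {2} p y)))

  ones : sumFin (2 * p) (λ _ → 1) ≡ 2 * p
  ones = trans (sum-const (2 * p) 1) (*-identityʳ (2 * p))

  total : ∑∑ n n (λ x y → 𝟙 (not (col x ≟ᵇ col y))) ≡ 2 * p + (2 * p + D)
  total = cong₂ _+_ ones (trans (sum-cong (2 * p) row)
    (trans (sum-+ (2 * p) (λ _ → 1) _) (cong (_+ D) ones)))
    where
    row : ∀ x → sumFin n (λ y → 𝟙 (not (col (suc x) ≟ᵇ col y))) ≡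
      1 + sumFin (2 * p) (λ y → 𝟙 (not (quotient {2} p x ≟ᵇ quotient {2} p y)))
    row x = refl

  arithmetic : ∀ p D E → 2 * p * p + D ≡ 2 * p * (2 * p) → 2 * p + (2 * p + D) ≤ E →
    1 * ((1 + 2 * p) * (1 + 2 * p)) ≤ 2 * E + 1 * (1 + 2 * p)
  arithmetic p D E t h = +-cancelʳ-≤ (2 * (2 * p * p)) _ _ (begin
    1 * ((1 + 2 * p) * (1 + 2 * p)) + 2 * (2 * p * p)    ≤⟨ m≤m+n _ (6 * p) ⟩
    1 * ((1 + 2 * p) * (1 + 2 * p)) + 2 * (2 * p * p) + 6 * p ≡⟨ e₁ p ⟩
    2 * (2 * p * (2 * p)) + 8 * p + (1 + 2 * p)          ≡⟨ cong (λ z → 2 * z + 8 * p + (1 + 2 * p)) t ⟨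
    2 * (2 * p * p + D) + 8 * p + (1 + 2 * p)            ≡⟨ e₂ p D ⟩
    2 * (2 * p + (2 * p + D)) + 1 * (1 + 2 * p) + 2 * (2 * p * p) ≤⟨ +-monoˡ-≤ (2 * (2 * p * p)) (+-monoˡ-≤ (1 * (1 + 2 * p)) (*-monoʳ-≤ 2 h)) ⟩
    2 * E + 1 * (1 + 2 * p) + 2 * (2 * p * p)            ∎)
    where
    open ≤-Reasoning
    e₁ : ∀ p → 1 * ((1 + 2 * p) * (1 + 2 * p)) + 2 * (2 * p * p) + 6 * p ≡ 2 * (2 * p * (2 * p)) + 8 * p + (1 + 2 * p)
    e₁ = solve-∀
    e₂ : ∀ p D → 2 * (2 * p * p + D) + 8 * p + (1 + 2 * p) ≡ 2 * (2 * p + (2 * p + D)) + 1 * (1 + 2 * p) + 2 * (2 * p * p)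
    e₂ = solve-∀

  bound : 1 * (n * n) ≤ 2 * edges (shadow H) + 1 * n
  bound = arithmetic p D (edges (shadow H)) (turán-edges 2 p) (≤-trans (≤-reflexive (sym total)) (edges-rainbow other))

lower-apex : ∀ {k} (G : SimpleGraph k) → Fin k → ¬ Apex G → LowerBound G 1
lower-apex G u₀ no-apex N =
  n , ≤-trans (n≤1+n N) (≤-trans (m≤m+n (suc N) _) (n≤1+n _)) , Rainbow.H col , free G u₀ no-apex , bound
  where open ApexConstruction (suc N) zero

-- Triples over a perfect matching of one part

∑∑-quotient : ∀ r p (g : Fin r → Fin r → ℕ) →
  ∑∑ (r * p) (r * p) (λ x y → g (quotient {r} p x) (quotient {r} p y)) ≡ p * (p * ∑∑ r r g)
∑∑-quotient r p g = begin
  sumFin (r * p) (λ x → f (quotient {r} p x))  ≡⟨ blocks f ⟩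
  p * sumFin r f                               ≡⟨ cong (p *_) (sum-cong r λ a → blocks (g a)) ⟩
  p * sumFin r (λ a → p * sumFin r (g a))      ≡⟨ cong (p *_) (sum-*ˡ r p (λ a → sumFin r (g a))) ⟩
  p * (p * ∑∑ r r g)                           ∎
  where
  open ≡-Reasoning
  f : Fin r → ℕ
  f a = sumFin (r * p) (λ y → g a (quotient {r} p y))
  blocks : ∀ (h : Fin r → ℕ) → sumFin (r * p) (λ x → h (quotient {r} p x)) ≡ p * sumFin r h
  blocks h = begin
    sumFin (r * p) (λ x → h (quotient {r} p x))             ≡⟨ sum-combine r p (λ x → h (quotient {r} p x)) ⟩
    ∑∑ r p (λ a i → h (quotient {r} p (combine a i)))       ≡⟨ ∑∑-cong r p (λ a i → cong h (quotient-combine a i)) ⟩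
    ∑∑ r p (λ a i → h a)                                    ≡⟨ sum-cong r (λ a → sum-const p (h a)) ⟩
    sumFin r (λ a → p * h a)                                ≡⟨ sum-*ˡ r p h ⟩
    p * sumFin r h                                          ∎

-- Vertices with quotient 0 or 1 and equal remainder are matched; the other quotients form the second part.
module MatchedConstruction (p : ℕ) where

  n : ℕ
  n = 4 * p

  q : Fin n → Fin 4
  q = quotient {4} p

  ρ : Fin n → Fin p
  ρ = remainder {4} p

  vertex : Fin 4 → Fin p → Fin n
  vertex = combine

  outside : Fin 4 → Bool
  outside 0F = false
  outside 1F = false
  outside _  = true

  side : Fin n → Bool
  side v = outside (q v)

  T : Fin n → Fin n → Fin n → Bool
  T x y z = (q x ≟ᵇ 0F) ∧ ((q y ≟ᵇ 1F) ∧ ((ρ x ≟ᵇ ρ y) ∧ side z))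

  T⁻ : ∀ x y z → T x y z ≡ true → q x ≡ 0F × q y ≡ 1F × ρ x ≡ ρ y × side z ≡ true
  T⁻ x y z t =
    let a , t₁ = ∧-true {q x ≟ᵇ 0F} t
        b , t₂ = ∧-true {q y ≟ᵇ 1F} t₁
        c , d  = ∧-true {ρ x ≟ᵇ ρ y} t₂ in
    ≟ᵇ⇒≡ (q x) 0F a , ≟ᵇ⇒≡ (q y) 1F b , ≟ᵇ⇒≡ (ρ x) (ρ y) c , d

  T⁺ : ∀ x y z → q x ≡ 0F → q y ≡ 1F → ρ x ≡ ρ y → side z ≡ true → T x y z ≡ true
  T⁺ x y z a b c d = true-∧ (≡⇒≟ᵇ (q x) 0F a) (true-∧ (≡⇒≟ᵇ (q y) 1F b) (true-∧ (≡⇒≟ᵇ (ρ x) (ρ y) c) d))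

  side-0 : ∀ {x} → q x ≡ 0F → side x ≡ false
  side-0 e = cong outside e

  side-1 : ∀ {x} → q x ≡ 1F → side x ≡ false
  side-1 e = cong outside e

  side-≢ : ∀ {x y} → side x ≡ false → side y ≡ true → x ≢ y
  side-≢ a b refl = true≢false b a

  q-≢ : ∀ {x y} → q x ≡ 0F → q y ≡ 1F → q x ≢ q y
  q-≢ a b e with trans (sym a) (trans e b)
  ... | ()

  matched : Triples T
  matched = triples T λ x y z t → let a , b , c , d = T⁻ x y z t in
    q-≢ a b ∘ cong q , side-≢ (side-0 a) d , side-≢ (side-1 b) d

  open Triples matched

  rebuild : ∀ {a} v → q v ≡ a → v ≡ vertex a (ρ v)
  rebuild v e = trans (sym (Finₚ.combine-remQuot {4} p v)) (cong (λ a → vertex a (ρ v)) e)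

  -- A hyperedge meets the first part in a matched pair, so one vertex from each part determines it.
  -- This is what excludes Berge triangles.
  determined : ∀ j a b → H ∋ a at j → H ∋ b at j → side a ≡ false → side b ≡ true →
    edge H j ≡ ⟪ vertex 0F (ρ a) , vertex 1F (ρ a) , b ⟫
  determined j a b ha hb sa sb = let x , y , z , t , e = sound j in go x y z (T⁻ x y z t) e (∋⇒ e ha) (∋⇒ e hb)
    where
    same : ∀ x y → q x ≡ 0F → q y ≡ 1F → ρ x ≡ ρ a → ρ y ≡ ρ a → ⟪ x , y , b ⟫ ≡ ⟪ vertex 0F (ρ a) , vertex 1F (ρ a) , b ⟫
    same x y qx qy ex ey = cong₂ (λ u v → ⟪ u , v , b ⟫)
      (trans (rebuild x qx) (cong (vertex 0F) ex)) (trans (rebuild y qy) (cong (vertex 1F) ey))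
    go : ∀ x y z → q x ≡ 0F × q y ≡ 1F × ρ x ≡ ρ y × side z ≡ true → edge H j ≡ ⟪ x , y , z ⟫ →
      a ≡ x ⊎ (a ≡ y ⊎ a ≡ z) → b ≡ x ⊎ (b ≡ y ⊎ b ≡ z) → edge H j ≡ ⟪ vertex 0F (ρ a) , vertex 1F (ρ a) , b ⟫
    go x y z (qx , qy , r , sz) e _ (inj₁ b≡x) = ⊥-elim (side-≢ (side-0 qx) sb (sym b≡x))
    go x y z (qx , qy , r , sz) e _ (inj₂ (inj₁ b≡y)) = ⊥-elim (side-≢ (side-1 qy) sb (sym b≡y))
    go x y z (qx , qy , r , sz) e (inj₂ (inj₂ a≡z)) _ = ⊥-elim (side-≢ sa sz a≡z)
    go x y z (qx , qy , r , sz) e (inj₁ refl) (inj₂ (inj₂ refl)) = trans e (same x y qx qy refl (sym r))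
    go x y z (qx , qy , r , sz) e (inj₂ (inj₁ refl)) (inj₂ (inj₂ refl)) = trans e (same x y qx qy r refl)

  inner : ∀ j a b → H ∋ a at j → H ∋ b at j → a ≢ b → side a ≡ side b → side a ≡ false × ρ a ≡ ρ b × q a ≢ q b
  inner j a b ha hb a≢b s = let x , y , z , t , e = sound j in go x y z (T⁻ x y z t) (∋⇒ e ha) (∋⇒ e hb)
    where
    go : ∀ x y z → q x ≡ 0F × q y ≡ 1F × ρ x ≡ ρ y × side z ≡ true →
      a ≡ x ⊎ (a ≡ y ⊎ a ≡ z) → b ≡ x ⊎ (b ≡ y ⊎ b ≡ z) → side a ≡ false × ρ a ≡ ρ b × q a ≢ q b
    go x y z _ (inj₁ refl) (inj₁ refl) = ⊥-elim (a≢b refl)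
    go x y z (qx , qy , r , _) (inj₁ refl) (inj₂ (inj₁ refl)) = side-0 qx , r , q-≢ qx qy
    go x y z (qx , qy , r , sz) (inj₁ refl) (inj₂ (inj₂ refl)) = ⊥-elim (true≢false sz (trans (sym s) (side-0 qx)))
    go x y z (qx , qy , r , _) (inj₂ (inj₁ refl)) (inj₁ refl) = side-1 qy , sym r , q-≢ qx qy ∘ sym
    go x y z _ (inj₂ (inj₁ refl)) (inj₂ (inj₁ refl)) = ⊥-elim (a≢b refl)
    go x y z (qx , qy , r , sz) (inj₂ (inj₁ refl)) (inj₂ (inj₂ refl)) = ⊥-elim (true≢false sz (trans (sym s) (side-1 qy)))
    go x y z (qx , qy , r , sz) (inj₂ (inj₂ refl)) (inj₁ refl) = ⊥-elim (true≢false sz (trans s (side-0 qx)))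
    go x y z (qx , qy , r , sz) (inj₂ (inj₂ refl)) (inj₂ (inj₁ refl)) = ⊥-elim (true≢false sz (trans s (side-1 qy)))
    go x y z _ (inj₂ (inj₂ refl)) (inj₂ (inj₂ refl)) = ⊥-elim (a≢b refl)

  two-inside : ∀ (a b c : Fin 4) → outside a ≡ false → outside b ≡ false → outside c ≡ false → a ≢ b → a ≢ c → b ≡ c
  two-inside 0F 1F 1F _ _ _ _ _ = refl
  two-inside 1F 0F 0F _ _ _ _ _ = refl
  two-inside 0F 0F _  _ _ _ ne _ = ⊥-elim (ne refl)
  two-inside 1F 1F _  _ _ _ ne _ = ⊥-elim (ne refl)
  two-inside 0F 1F 0F _ _ _ _ ne = ⊥-elim (ne refl)
  two-inside 1F 0F 1F _ _ _ _ ne = ⊥-elim (ne refl)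

  mate-unique : ∀ a b c → side a ≡ false → side b ≡ false → side c ≡ false →
    ρ a ≡ ρ b → ρ a ≡ ρ c → q a ≢ q b → q a ≢ q c → b ≡ c
  mate-unique a b c sa sb sc rb rc nb nc = trans (rebuild b refl) (trans
    (cong₂ vertex (two-inside (q a) (q b) (q c) sa sb sc nb nc) (trans (sym rb) rc)) (sym (rebuild c refl)))

  module Embedded {k} (G : SimpleGraph k) (B : ContainsBerge G H) where

    i = proj₁ B
    i-inj = λ {u} {v} → proj₁ (proj₂ B) {u} {v}
    f = proj₁ (proj₂ (proj₂ B))
    f-inj = proj₁ (proj₂ (proj₂ (proj₂ (proj₂ B))))
    f-ok = proj₂ (proj₂ (proj₂ (proj₂ (proj₂ B))))

    s : Fin k → Bool
    s u = side (i u)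

    inner-edge : ∀ u v → Edge G u v → s u ≡ s v → s u ≡ false × ρ (i u) ≡ ρ (i v) × q (i u) ≢ q (i v)
    inner-edge u v e = inner (f u v e) (i u) (i v) (proj₁ (f-ok u v e)) (proj₂ (f-ok u v e)) (edge-≢ G e ∘ i-inj)

    inner-unique : ∀ u v w → Edge G u v → s u ≡ s v → Edge G u w → s u ≡ s w → v ≡ w
    inner-unique u v w e eq e′ eq′ =
      let su , r , ne = inner-edge u v e eq
          _ , r′ , ne′ = inner-edge u w e′ eq′ in
      i-inj (mate-unique (i u) (i v) (i w) su (trans (sym eq) su) (trans (sym eq′) su) r r′ ne ne′)

    -- B consists of the edges of `G` between the two parts. No hyperedge has two vertices in the
    -- second part, and two vertices of one in the first part are matched; so the other edges form a
    -- matching inside the part `false`.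
    cond2 : Cond2 G
    cond2 = s , inB , inB-sym , (λ u v h → proj₁ (∧-true {adj G u v} h)) ,
      (λ u v h → does-false (s u Boolₚ.≟ s v) (not-true (proj₂ (∧-true {adj G u v} h)))) ,
      false , (λ u v e b → let su = proj₁ (inner-edge u v e (same u v e b)) in su , trans (sym (same u v e b)) su) ,
      λ u v w e b e′ b′ → inner-unique u v w e (same u v e b) e′ (same u w e′ b′)
      where
      inB : Fin k → Fin k → Bool
      inB u v = adj G u v ∧ not (does (s u Boolₚ.≟ s v))
      inB⇒ : ∀ u v → inB u v ≡ true → inB v u ≡ true
      inB⇒ u v h = let e , ne = ∧-true {adj G u v} h in
        true-∧ (edge-sym G e) (false-not (false-does (s v Boolₚ.≟ s u) (does-false (s u Boolₚ.≟ s v) (not-true ne) ∘ sym)))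
      inB-sym : ∀ u v → inB u v ≡ inB v u
      inB-sym u v = bool-ext (inB⇒ u v) (inB⇒ v u)
      same : ∀ u v → Edge G u v → inB u v ≡ false → s u ≡ s v
      same u v e b with s u Boolₚ.≟ s v
      ... | yes p = p
      ... | no  _ = ⊥-elim (true≢false (true-∧ e refl) b)

    -- The images of u and v are matched, so the edges uw and vw would both need the only hyperedge
    -- containing this pair and the image of w.
    corner : ∀ u v w → Edge G u v → Edge G v w → Edge G u w → s u ≡ false → s v ≡ false → s w ≡ true → ⊥
    corner u v w uv vw uw su sv sw = [ (λ h → edge-≢ G uv (proj₁ h)) , (λ h → edge-≢ G uw (proj₁ h)) ]′
      (f-inj u w v w uw vw (distinct H (trans (determined _ (i u) (i w) (proj₁ (f-ok u w uw)) (proj₂ (f-ok u w uw)) su sw)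
        (trans (cong (λ r → ⟪ vertex 0F r , vertex 1F r , i w ⟫) (proj₁ (proj₂ (inner-edge u v uv (trans su (sym sv))))))
          (sym (determined _ (i v) (i w) (proj₁ (f-ok v w vw)) (proj₂ (f-ok v w vw)) sv sw))))))

    triangle-free : TriangleFree G
    triangle-free u v w uv vw uw = cases (s u) (s v) (s w) refl refl refl
      where
      not-both : ∀ a b → Edge G a b → s a ≡ true → s b ≡ true → ⊥
      not-both a b e sa sb = true≢false sa (proj₁ (inner-edge a b e (trans sa (sym sb))))
      cases : ∀ x y z → s u ≡ x → s v ≡ y → s w ≡ z → ⊥
      cases true  true  _     a b c = not-both u v uv a b
      cases true  _     true  a b c = not-both u w uw a c
      cases _     true  true  a b c = not-both v w vw b c
      cases false false true  a b c = corner u v w uv vw uw a b c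
      cases false true  false a b c = corner u w v uw (edge-sym G vw) uv a c b
      cases true  false false a b c = corner v w u vw (edge-sym G uw) (edge-sym G uv) b c a
      cases false false false a b c = edge-≢ G vw
        (inner-unique u v w uv (trans a (sym b)) uw (trans a (sym c)))

  cross-shadow : ∀ x y → side x ≡ false → side y ≡ true → shadow H x y ≡ true
  cross-shadow x y sx sy = go (q x) refl
    where
    go : ∀ a → q x ≡ a → shadow H x y ≡ true
    go 0F e = shadow-⟪⟫ x y (vertex 1F (ρ x)) (side-≢ sx sy) (inj₂ (inj₂ (inj₁
      (T⁺ x (vertex 1F (ρ x)) y e (quotient-combine {4} 1F (ρ x)) (sym (remainder-combine {4} 1F (ρ x))) sy))))
    go 1F e = shadow-⟪⟫ x y (vertex 0F (ρ x)) (side-≢ sx sy) (inj₂ (inj₂ (inj₂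
      (T⁺ (vertex 0F (ρ x)) x y (quotient-combine {4} 0F (ρ x)) e (remainder-combine {4} 0F (ρ x)) sy))))
    go (suc (suc a)) e = ⊥-elim (true≢false (cong outside e) sx)

  xor-shadow : ∀ x y → (side x xor side y) ≡ true → shadow H x y ≡ true
  xor-shadow x y h = go (side x) (side y) refl refl h
    where
    go : ∀ a b → side x ≡ a → side y ≡ b → (a xor b) ≡ true → shadow H x y ≡ true
    go true  false sx sy _ = shadow-sym H y x (cross-shadow y x sy sx)
    go false true  sx sy _ = cross-shadow x y sx sy

  bound : 1 * (n * n) ≤ 2 * edges (shadow H) + 1 * n
  bound = begin
    1 * (n * n)                        ≡⟨ e₁ p ⟩
    -- Eight of the sixteen ordered pairs of quotients cross between the parts, so the crossing
    -- pairs alone are half of all ordered pairs.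
    2 * (p * (p * 8))                  ≡⟨ cong (2 *_) (∑∑-quotient 4 p (λ a b → 𝟙 (outside a xor outside b))) ⟨
    2 * ∑∑ n n (λ x y → 𝟙 (side x xor side y)) ≤⟨ *-monoʳ-≤ 2 (∑∑-mono n n λ x y → 𝟙-⇒ (xor-shadow x y)) ⟩
    2 * edges (shadow H)               ≤⟨ m≤m+n _ _ ⟩
    2 * edges (shadow H) + 1 * n       ∎
    where
    open ≤-Reasoning
    e₁ : ∀ p → 1 * (4 * p * (4 * p)) ≡ 2 * (p * (p * 8))
    e₁ = solve-∀

lower-matched : ∀ {k} (G : SimpleGraph k) → ¬ (TriangleFree G × Cond2 G) → LowerBound G 1
lower-matched G h N = n , m≤m+n N _ , Triples.H matched , (λ B → h (Embedded.triangle-free G B , Embedded.cond2 G B)) , bound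
  where open MatchedConstruction N

-- Constructively, a negated conjunction does not tell which part fails. The apex condition is
-- decided by a search over all vertices and subsets, triangle-freeness over all triples; when both
-- hold, (2) must fail. The matched construction treats the failure of triangle-freeness or of (2),
-- the other one a missing apex.
lower-half : ∀ {k} (G : SimpleGraph k) → Fin k → ¬ (Cond1 G × Cond2 G) → LowerBound G 1
lower-half {k} G u₀ h = split apex? triangle-free?
  where
  triangle-free? : Dec (TriangleFree G)
  triangle-free? = Finₚ.all? λ u → Finₚ.all? λ v → Finₚ.all? λ w →
    (adj G u v Boolₚ.≟ true) →-dec ((adj G v w Boolₚ.≟ true) →-dec ((adj G u w Boolₚ.≟ true) →-dec no λ ()))
  Proper : Fin k → (Fin k → Bool) → Set
  Proper x side = ∀ u v → u ≢ x → v ≢ x → Edge G u v → side u ≢ side v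
  proper? : ∀ x side → Dec (Proper x side)
  proper? x side = Finₚ.all? λ u → Finₚ.all? λ v → ¬? (u Finₚ.≟ x) →-dec (¬? (v Finₚ.≟ x) →-dec
    ((adj G u v Boolₚ.≟ true) →-dec ¬? (side u Boolₚ.≟ side v)))
  apex? : Dec (Σ (Fin k) λ x → Σ (Subset k) λ S → Proper x (lookup S))
  apex? = Finₚ.any? λ x → anySubset? λ S → proper? x (lookup S)
  split : Dec (Σ (Fin k) λ x → Σ (Subset k) λ S → Proper x (lookup S)) → Dec (TriangleFree G) → LowerBound G 1
  split (yes (x , S , ok)) (yes tf) = lower-matched G λ { (_ , c₂) → h ((tf , x , lookup S , ok) , c₂) }
  split _ (no ¬tf) = lower-matched G λ { (tf , _) → ¬tf tf }
  split (no none) _ = lower-apex G u₀ λ { (x , side , ok) → none (x , tabulate side , λ u v u≢x v≢x e eq →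
    ok u v u≢x v≢x e (trans (sym (Vecₚ.lookup∘tabulate side u)) (trans eq (Vecₚ.lookup∘tabulate side v)))) }

-- Densities

open import Data.Integer using (+_)
import Data.Integer as ℤ
import Data.Integer.Properties as ℤₚ
open import Data.Nat.Combinatorics using (_C_; nC1≡n; nCk+nC[k+1]≡[n+1]C[k+1])
open import Data.Rational using (ℚ; mkℚ; 1ℚ; 0ℚ; ½; toℚᵘ; _-_; _/_) renaming (_+_ to _+ℚ_; _*_ to _*ℚ_; _≤_ to _≤ℚ_; _<_ to _<ℚ_)
import Data.Rational as ℚ
import Data.Rational.Properties as ℚₚ
open import Data.Rational.Unnormalised using (mkℚᵘ; *≡*; *≤*)
import Data.Rational.Unnormalised as ℚᵘ
import Data.Rational.Unnormalised.Properties as ℚᵘₚ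

2*[nC2]+n : ∀ n → 2 * (n C 2) + n ≡ n * n
2*[nC2]+n zero    = refl
2*[nC2]+n (suc n) = begin
  2 * (suc n C 2) + suc n            ≡⟨ cong (λ z → 2 * z + suc n) (nCk+nC[k+1]≡[n+1]C[k+1] n 1) ⟨
  2 * (n C 1 + n C 2) + suc n        ≡⟨ cong (λ z → 2 * (z + n C 2) + suc n) (nC1≡n n) ⟩
  2 * (n + n C 2) + suc n            ≡⟨ e₁ n (n C 2) ⟩
  2 * (n C 2) + n + (n + suc n)      ≡⟨ cong (_+ (n + suc n)) (2*[nC2]+n n) ⟩
  n * n + (n + suc n)                ≡⟨ e₂ n ⟩
  suc n * suc n                      ∎
  where
  open ≡-Reasoning
  e₁ : ∀ n c → 2 * (n + c) + (1 + n) ≡ 2 * c + n + (n + (1 + n))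
  e₁ = solve-∀
  e₂ : ∀ n → n * n + (n + (1 + n)) ≡ (1 + n) * (1 + n)
  e₂ = solve-∀

edges-shadow : ∀ {n} (H : ThreeGraph n) → edges (shadow H) ≡ 2 * shadowSize H
edges-shadow {n} H = begin
  edges (shadow H)                                     ≡⟨ ∑∑-cong n n pointwise ⟩
  ∑∑ n n (λ x y → 𝟙 (up x y) + 𝟙 (up y x))             ≡⟨ ∑∑-+ n n (λ x y → 𝟙 (up x y)) (λ x y → 𝟙 (up y x)) ⟩
  S + ∑∑ n n (λ x y → 𝟙 (up y x))                      ≡⟨ cong (λ z → S + z) (sum-swap n n (λ x y → 𝟙 (up y x))) ⟩
  S + S                                                ≡⟨ cong (λ z → S + z) (+-identityʳ S) ⟨
  2 * S                                                ∎
  where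
  open ≡-Reasoning
  S = shadowSize H
  up : Fin n → Fin n → Bool
  up x y = (toℕ x <ᵇ toℕ y) ∧ shadowAdj H x y
  adj-sym : ∀ x y → shadowAdj H x y ≡ true → shadowAdj H y x ≡ true
  adj-sym x y h = let j , e = anyFin⁻ (m H) _ h
                      hx , hy = ∧-true {lookup (edge H j) x} e in
    anyFin⁺ (m H) _ j (true-∧ hy hx)
  ≮ᵇ : ∀ {a b} → ¬ a < b → (a <ᵇ b) ≡ false
  ≮ᵇ {a} {b} a≮b = ¬true⇒false λ e → a≮b (<ᵇ⇒< a b (subst Data.Bool.T (sym e) _))
  <ᵇ-true : ∀ {a b} → a < b → (a <ᵇ b) ≡ true
  <ᵇ-true {a} {b} a<b with a <ᵇ b | <⇒<ᵇ a<b
  ... | true | _ = refl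
  case : ∀ (a b : Bool) x y → (toℕ x <ᵇ toℕ y) ≡ a → (toℕ y <ᵇ toℕ x) ≡ b → (a ∨ b) ≡ not (x ≟ᵇ y) → (a ∧ b) ≡ false →
    𝟙 (shadow H x y) ≡ 𝟙 (up x y) + 𝟙 (up y x)
  case true true x y _ _ _ ()
  case true false x y ea eb o _ rewrite ea | eb | sym o = sym (+-identityʳ _)
  case false true x y ea eb o _ rewrite ea | eb | sym o = cong 𝟙 (bool-ext (adj-sym x y) (adj-sym y x))
  case false false x y ea eb o _ rewrite ea | eb | sym o = refl
  pointwise : ∀ x y → 𝟙 (shadow H x y) ≡ 𝟙 (up x y) + 𝟙 (up y x)
  pointwise x y with <-cmp (toℕ x) (toℕ y)
  ... | tri< lt ne gt = case true false x y (<ᵇ-true lt) (≮ᵇ gt) (sym (false-not (≢⇒≟ᵇ x y (ne ∘ cong toℕ)))) refl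
  ... | tri≈ lt eq gt = case false false x y (≮ᵇ lt) (≮ᵇ gt) (sym (cong not (≡⇒≟ᵇ x y (Finₚ.toℕ-injective eq)))) refl
  ... | tri> lt ne gt = case false true x y (≮ᵇ lt) (<ᵇ-true gt) (sym (false-not (≢⇒≟ᵇ x y (ne ∘ cong toℕ)))) refl

-- Fractions are compared in the unnormalised rationals, where no reduction to lowest terms
-- intervenes.
toℚᵘ-/ : ∀ a d → toℚᵘ (a / suc d) ℚᵘ.≃ mkℚᵘ a d
toℚᵘ-/ a d = ℚₚ.toℚᵘ-fromℚᵘ (mkℚᵘ a d)

toℚᵘ-/-* : ∀ b a c → toℚᵘ ((+ b / suc a) *ℚ ℕtoℚ c) ℚᵘ.≃ mkℚᵘ (+ b) a ℚᵘ.* mkℚᵘ (+ c) 0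
toℚᵘ-/-* b a c = ℚᵘₚ.≃-trans (ℚₚ.toℚᵘ-homo-* (+ b / suc a) (ℕtoℚ c))
  (ℚᵘₚ.*-cong (toℚᵘ-/ (+ b) a) (toℚᵘ-/ (+ c) 0))

pos-*1 : ∀ a s → + (suc a * s) ≡ + s ℤ.* + (suc a * 1)
pos-*1 a s = trans (cong ℤ.+_ (trans (*-comm (suc a) s) (cong (s *_) (sym (*-identityʳ (suc a)))))) (ℤₚ.pos-* s (suc a * 1))

pos-*-*1 : ∀ b c → + (b * c) ≡ + b ℤ.* + c ℤ.* + 1
pos-*-*1 b c = trans (ℤₚ.pos-* b c) (sym (ℤₚ.*-identityʳ _))

ratio-upper : ∀ a b s c → suc a * s ≤ b * c → ℕtoℚ s ≤ℚ (+ b / suc a) *ℚ ℕtoℚ c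
ratio-upper a b s c h = ℚₚ.toℚᵘ-cancel-≤ (ℚᵘₚ.≤-respʳ-≃ (ℚᵘₚ.≃-sym (toℚᵘ-/-* b a c))
  (ℚᵘₚ.≤-respˡ-≃ (ℚᵘₚ.≃-sym (toℚᵘ-/ (+ s) 0)) (*≤* (subst₂ ℤ._≤_ (pos-*1 a s) (pos-*-*1 b c) (ℤ.+≤+ h)))))

ratio-lower : ∀ a b s c → b * c ≤ suc a * s → (+ b / suc a) *ℚ ℕtoℚ c ≤ℚ ℕtoℚ s
ratio-lower a b s c h = ℚₚ.toℚᵘ-cancel-≤ (ℚᵘₚ.≤-respˡ-≃ (ℚᵘₚ.≃-sym (toℚᵘ-/-* b a c))
  (ℚᵘₚ.≤-respʳ-≃ (ℚᵘₚ.≃-sym (toℚᵘ-/ (+ s) 0)) (*≤* (subst₂ ℤ._≤_ (pos-*-*1 b c) (pos-*1 a s) (ℤ.+≤+ h)))))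

/-+ : ∀ a b c d → (+ a / suc b) +ℚ (+ c / suc d) ≡ + (a * suc d + c * suc b) / (suc b * suc d)
/-+ a b c d = ℚₚ.toℚᵘ-injective (ℚᵘₚ.≃-trans (ℚₚ.toℚᵘ-homo-+ (+ a / suc b) (+ c / suc d))
  (ℚᵘₚ.≃-trans (ℚᵘₚ.+-cong (toℚᵘ-/ (+ a) b) (toℚᵘ-/ (+ c) d))
    (ℚᵘₚ.≃-trans (ℚᵘₚ.≃-reflexive (cong (λ z → mkℚᵘ z (d + b * suc d)) numerator))
      (ℚᵘₚ.≃-sym (toℚᵘ-/ (+ (a * suc d + c * suc b)) (d + b * suc d))))))
  where
  numerator : + a ℤ.* + suc d ℤ.+ + c ℤ.* + suc b ≡ + (a * suc d + c * suc b)
  numerator = sym (trans (ℤₚ.pos-+ (a * suc d) (c * suc b)) (cong₂ ℤ._+_ (ℤₚ.pos-* a (suc d)) (ℤₚ.pos-* c (suc b))))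

1-1/r : ∀ r → 1ℚ - (+ 1 / suc r) ≡ + r / suc r
1-1/r r = begin
  1ℚ - x                ≡⟨ cong (_- x) sum≡1 ⟨
  (+ r / suc r +ℚ x) - x ≡⟨ ℚₚ.+-assoc (+ r / suc r) x (ℚ.- x) ⟩
  + r / suc r +ℚ (x - x) ≡⟨ cong (+ r / suc r +ℚ_) (ℚₚ.+-inverseʳ x) ⟩
  + r / suc r +ℚ 0ℚ      ≡⟨ ℚₚ.+-identityʳ _ ⟩
  + r / suc r            ∎
  where
  open ≡-Reasoning
  x = + 1 / suc r
  sum≡1 : + r / suc r +ℚ x ≡ 1ℚ
  sum≡1 = ℚₚ.toℚᵘ-injective (ℚᵘₚ.≃-trans (ℚᵘₚ.≃-reflexive (cong toℚᵘ (/-+ r r 1 r)))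
    (ℚᵘₚ.≃-trans (toℚᵘ-/ (+ (r * suc r + 1 * suc r)) (r + r * suc r)) (*≡* (trans (sym (ℤₚ.pos-* (r * suc r + 1 * suc r) 1)) (trans (cong ℤ.+_ (e r)) (ℤₚ.pos-* 1 (suc r * suc r)))))))
    where
    e : ∀ r → (r * (1 + r) + 1 * (1 + r)) * 1 ≡ 1 * ((1 + r) * (1 + r))
    e = solve-∀

-- A positive fraction is at least the reciprocal of its denominator.
1/e≤ε : ∀ ε → 0ℚ <ℚ ε → Σ ℕ λ e → + 1 / suc e ≤ℚ ε
1/e≤ε (mkℚ (+ zero) d _) (ℚ.*<* (ℤ.+<+ ()))
1/e≤ε (mkℚ (+ suc a) d c) _ = d , ℚₚ.toℚᵘ-cancel-≤ (ℚᵘₚ.≤-respˡ-≃ (ℚᵘₚ.≃-sym (toℚᵘ-/ (+ 1) d))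
  (*≤* (ℤ.+≤+ (*-monoˡ-≤ (suc d) {1} {suc a} (s≤s z≤n)))))
1/e≤ε (mkℚ ℤ.-[1+ a ] d _) (ℚ.*<* ())

scale : ∀ {p q} c → p ≤ℚ q → p *ℚ ℕtoℚ c ≤ℚ q *ℚ ℕtoℚ c
scale c h = ℚₚ.*-monoʳ-≤-nonNeg (ℕtoℚ c) {{ℚₚ.normalize-nonNeg c 1}} h

Upper Lower : ∀ {k} → SimpleGraph k → ℚ → Set
Upper G q = ∀ ε → 0ℚ <ℚ ε → Σ ℕ λ N → ∀ n → N ≤ n → (H : ThreeGraph n) → BergeFree G H →
  ℕtoℚ (shadowSize H) ≤ℚ (q +ℚ ε) *ℚ ℕtoℚ (n C 2)
Lower G q = ∀ ε → 0ℚ <ℚ ε → ∀ N → Σ ℕ λ n → N ≤ n × Σ (ThreeGraph n) λ H → BergeFree G H ×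
  (q - ε) *ℚ ℕtoℚ (n C 2) ≤ℚ ℕtoℚ (shadowSize H)

-- The threshold of `dense-shadow`, divided by (r + 1)(e + 1), is r / (r + 1) + 1 / (e + 1) with 1 /
-- (e + 1) ≤ ε. A Berge-free 3-graph has to stay below it.
upper-chromatic : ∀ {k} (G : SimpleGraph k) → Fin k → ∀ r → Colorable G (2 + r) → Upper G (1ℚ - (+ 1 / suc r))
upper-chromatic G u₀ r colorable ε ε>0 = proj₁ ds , bound
  where
  e = proj₁ (1/e≤ε ε ε>0)
  ds = dense-shadow G (fin-positive u₀) r colorable e
  P = suc e * r + suc r
  bound : ∀ n → proj₁ ds ≤ n → (H : ThreeGraph n) → BergeFree G H →
    ℕtoℚ (shadowSize H) ≤ℚ ((1ℚ - (+ 1 / suc r)) +ℚ ε) *ℚ ℕtoℚ (n C 2)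
  bound n N≤n H free = ℚₚ.≤-trans
    (ratio-upper (e + r * suc e) (r * suc e + 1 * suc r) (shadowSize H) (n C 2) sparse)
    (scale (n C 2) (ℚₚ.≤-trans (ℚₚ.≤-reflexive (sym (/-+ r r 1 e)))
      (ℚₚ.≤-trans (ℚₚ.+-monoʳ-≤ (+ r / suc r) (proj₂ (1/e≤ε ε ε>0))) (ℚₚ.≤-reflexive (cong (_+ℚ ε) (sym (1-1/r r)))))))
    where
    arithmetic : ∀ e r s c n E nn → E ≡ 2 * s → 2 * c + n ≡ nn →
      (1 + e) * (1 + r) * E + ((1 + e) * r + (1 + r)) * n ≤ ((1 + e) * r + (1 + r)) * nn →
      (1 + r) * (1 + e) * s ≤ (r * (1 + e) + 1 * (1 + r)) * c
    arithmetic e r s c n E nn refl refl h = *-cancelˡ-≤ 2 (+-cancelʳ-≤ (((1 + e) * r + (1 + r)) * n) _ _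
      (subst₂ _≤_ (e₁ e r s n) (e₂ e r c n) h))
      where
      e₁ : ∀ e r s n → (1 + e) * (1 + r) * (2 * s) + ((1 + e) * r + (1 + r)) * n
        ≡ 2 * ((1 + r) * (1 + e) * s) + ((1 + e) * r + (1 + r)) * n
      e₁ = solve-∀
      e₂ : ∀ e r c n → ((1 + e) * r + (1 + r)) * (2 * c + n)
        ≡ 2 * ((r * (1 + e) + 1 * (1 + r)) * c) + ((1 + e) * r + (1 + r)) * n
      e₂ = solve-∀
    sparse : suc r * suc e * shadowSize H ≤ (r * suc e + 1 * suc r) * (n C 2)
    sparse = arithmetic e r (shadowSize H) (n C 2) n (edges (shadow H)) (n * n) (edges-shadow H) (2*[nC2]+n n)
      (<⇒≤ (≰⇒> λ dense → free (proj₂ ds n N≤n H dense)))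

upper-zero : ∀ {k} (G : SimpleGraph k) → HasEdge G → Cond1 G → Cond2 G → Upper G 0ℚ
-- From n ≥ 2 follows n² ≤ 4 (n C 2). Of this 4, one factor 2 comes from counting ordered pairs, the
-- other is the 2 in `ss`.
upper-zero G has c₁ c₂ ε ε>0 = 2 + proj₁ ss , bound
  where
  e = proj₁ (1/e≤ε ε ε>0)
  ss = sparse-shadow G has c₁ c₂ (2 * suc e) (s≤s z≤n)
  bound : ∀ n → 2 + proj₁ ss ≤ n → (H : ThreeGraph n) → BergeFree G H →
    ℕtoℚ (shadowSize H) ≤ℚ (0ℚ +ℚ ε) *ℚ ℕtoℚ (n C 2)
  bound n N≤n H free = ℚₚ.≤-trans
    (ratio-upper e 1 (shadowSize H) (n C 2) sparse)
    (scale (n C 2) (ℚₚ.≤-trans (proj₂ (1/e≤ε ε ε>0)) (ℚₚ.≤-reflexive (sym (ℚₚ.+-identityˡ ε)))))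
    where
    open ≤-Reasoning
    n≤2c : n ≤ 2 * (n C 2)
    n≤2c = +-cancelʳ-≤ n _ _ (begin
      n + n             ≡⟨ cong (λ z → n + z) (+-identityʳ n) ⟨
      2 * n             ≤⟨ *-monoˡ-≤ n (≤-trans (m≤m+n 2 _) N≤n) ⟩
      n * n             ≡⟨ 2*[nC2]+n n ⟨
      2 * (n C 2) + n   ∎)
    sparse : suc e * shadowSize H ≤ 1 * (n C 2)
    sparse = *-cancelˡ-≤ 4 (begin
      4 * (suc e * shadowSize H)               ≡⟨ e₁ (suc e) (shadowSize H) ⟩
      2 * suc e * (2 * shadowSize H)           ≡⟨ cong (2 * suc e *_) (edges-shadow H) ⟨
      2 * suc e * edges (shadow H)             ≤⟨ <⇒≤ (≰⇒> λ dense → free (proj₂ ss n (≤-trans (m≤n+m _ 2) N≤n) H dense)) ⟩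
      n * n                                    ≡⟨ 2*[nC2]+n n ⟨
      2 * (n C 2) + n                          ≤⟨ +-monoʳ-≤ (2 * (n C 2)) n≤2c ⟩
      2 * (n C 2) + 2 * (n C 2)                ≡⟨ e₂ (n C 2) ⟩
      4 * (1 * (n C 2))                        ∎)
      where
      e₁ : ∀ e s → 4 * (e * s) ≡ 2 * e * (2 * s)
      e₁ = solve-∀
      e₂ : ∀ c → 2 * c + 2 * c ≡ 4 * (1 * c)
      e₂ = solve-∀

minus-≤ : ∀ q {ε} → 0ℚ <ℚ ε → q - ε ≤ℚ q
minus-≤ q ε>0 = ℚₚ.≤-trans (ℚₚ.+-monoʳ-≤ q (ℚₚ.neg-antimono-≤ (ℚₚ.<⇒≤ ε>0))) (ℚₚ.≤-reflexive (ℚₚ.+-identityʳ q))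

lower-density : ∀ {k} (G : SimpleGraph k) r → LowerBound G r → Lower G (1ℚ - (+ 1 / suc r))
lower-density G r lb ε ε>0 N =
  let n , N≤n , H , free , dense = lb N in
  n , N≤n , H , free , ℚₚ.≤-trans (scale (n C 2) (ℚₚ.≤-trans (minus-≤ _ ε>0) (ℚₚ.≤-reflexive (1-1/r r))))
    (ratio-lower r r (shadowSize H) (n C 2) (arithmetic r (shadowSize H) (n C 2) n (edges (shadow H)) (n * n)
      (edges-shadow H) (2*[nC2]+n n) dense))
  where
  arithmetic : ∀ r s c n E nn → E ≡ 2 * s → 2 * c + n ≡ nn → r * nn ≤ (1 + r) * E + r * n → r * c ≤ (1 + r) * s
  arithmetic r s c n E nn refl refl h = *-cancelˡ-≤ 2 (+-cancelʳ-≤ (r * n) _ _ (subst₂ _≤_ (e₁ r c n) (e₂ r s n) h))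
    where
    e₁ : ∀ r c n → r * (2 * c + n) ≡ 2 * (r * c) + r * n
    e₁ = solve-∀
    e₂ : ∀ r s n → (1 + r) * (2 * s) + r * n ≡ 2 * ((1 + r) * s) + r * n
    e₂ = solve-∀

emptyGraph : ∀ n → ThreeGraph n
emptyGraph n = record { m = 0 ; edge = λ () ; distinct = λ { {()} } ; uniform = λ () }

lower-zero : ∀ {k} (G : SimpleGraph k) → HasEdge G → Lower G 0ℚ
lower-zero G (u , v , e) ε ε>0 N = N , ≤-refl , emptyGraph N , free ,
  ℚₚ.≤-trans (scale (N C 2) (minus-≤ 0ℚ ε>0)) (ℚₚ.≤-trans (ℚₚ.≤-reflexive (ℚₚ.*-zeroˡ (ℕtoℚ (N C 2))))
    (ℚₚ.nonNegative⁻¹ (ℕtoℚ (shadowSize (emptyGraph N))) {{ℚₚ.normalize-nonNeg (shadowSize (emptyGraph N)) 1}}))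
  where
  free : BergeFree G (emptyGraph N)
  free (_ , _ , f , _) with f u v e
  ... | ()

theorem4 : ∀ {k} (G : SimpleGraph k) → HasEdge G →
    (∀ d → IsChromaticNumber G (suc (suc (suc (suc d)))) →
    ShadowDensity G (1ℚ - (+ 1 / suc (suc (suc d))))) ×
    (Colorable G 3 → Cond1 G → Cond2 G → ShadowDensity G 0ℚ) ×
    (Colorable G 3 → ¬ (Cond1 G × Cond2 G) → ShadowDensity G ½)
theorem4 G has@(u₀ , _) =
  -- Here χ = 4 + d, so χ - 1 is `suc r` for r = 2 + d.
  (λ d (colorable , minimal) → upper-chromatic G u₀ (2 + d) colorable ,
    lower-density G (2 + d) (lower-chromatic G d (minimal (3 + d) ≤-refl))) ,
  (λ _ c₁ c₂ → upper-zero G has c₁ c₂ , lower-zero G has) ,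
  -- Three colours correspond to r = 1, and 1 - 1/2 computes to `½`.
  (λ colorable h → upper-chromatic G u₀ 1 colorable , lower-density G 1 (lower-half G u₀ h))
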